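{- Let $g\in\mathbb{F}_q[T]$ be monic and $c\in\mathbb{F}_q[T]$. Then, for all $u\in\mathbb{C}$ (as an identity of meromorphic functions of $u$), $$\mathcal{Z}(u;c,g)=u^{\deg(g)-1}\sum_{\lambda\in\mathbb{F}_q^\times}\Big[\frac{e_q(-\lambda)}{q}-\frac{1}{q(1-qu)}\Big]\mathcal{D}_1\Big(\frac{1}{qu};\frac{\lambda c}{g}\Big).$$
   Context: $q=p^\eta$ is a prime power; $e_q(y)=\exp(2\pi i\,\mathrm{Tr}_{\mathbb{F}_q/\mathbb{F}_p}(y)/p)$ for $y\in\mathbb{F}_q$; for $\alpha=\sum_{j\le N}\alpha_jT^j\in\mathbb{F}_q((1/T))$, $e(\alpha)=e_q(\alpha_{ -1})$. Let $\mathcal{M}$ be the set of monic polynomials in $\mathbb{F}_q[T]$. For $|u|<1/q$ define $$\mathcal{Z}(u;c,g)=\sum_{\substack{f\in\mathcal{M}\\ f\equiv c\ (\mathrm{mod}\ g)}}u^{\deg f},\qquad \mathcal{D}_1(u;c/g)=\sum_{f\in\mathcal{M}}e(cf/g)\,u^{\deg f};$$ both are extended by meromorphic continuation to all $u\in\mathbb{C}$ (they are rational functions of $u$). -}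

module Defs where

open import Level using (Level; _⊔_) renaming (suc to lsuc)
open import Algebra.Bundles using (CommutativeRing; RawSemiring)
open import Algebra.Structures using (IsCommutativeRing)
import Algebra.Definitions.RawSemiring as RawSemiringOps
import Algebra.Properties.Group as GroupProperties
import Algebra.Properties.Ring as RingProperties
open import Data.Fin.Base using (Fin; toℕ)
import Data.Fin.Properties as Fin
open import Data.Integer.Base as ℤ using (ℤ; +_; -[1+_])
open import Data.List.Base as List using (List; []; _∷_; _++_; [_])
open import Data.List.Relation.Unary.Any using (Any)
open import Data.Nat.Base as ℕ using (ℕ; zero; suc; _!; NonZero)
import Data.Nat.Properties as ℕ
open import Data.Nat.Primality using (Prime)
open import Data.Product.Base using (∃-syntax; _×_; _,_; proj₁; proj₂)
open import Data.Sum.Base using (inj₁; inj₂)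
open import Data.Vec.Base as Vec using (Vec; []; _∷_)
open import Function.Base using (_∘_)
open import Function.Bundles using (_↔_; Inverse)
open import Function.Construct.Symmetry using (↔-sym)
open import Function.Properties.Inverse using (↔⇒↣)
open import Relation.Binary.Bundles using (StrictTotalOrder)
open import Relation.Binary.Core using (Rel)
open import Relation.Binary.Definitions using (DecidableEquality; tri<; tri≈; tri>)
open import Relation.Binary.PropositionalEquality as ≡
  using (_≡_; _≢_; refl; cong; cong₂; module ≡-Reasoning)
open import Relation.Binary.Structures using (IsStrictTotalOrder)
import Relation.Binary.Construct.StrictToNonStrict as StrictToNonStrict
import Relation.Binary.Reasoning.StrictPartialOrder as StrictReasoning
open import Relation.Nullary using (¬_; Dec; yes; no; ¬?; contradiction)
open import Relation.Nullary.Decidable using (via-injection; map′)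

------------------------------------------------------------------------
-- The real numbers

-- The library has no real numbers.  An Archimedean, Cauchy complete,
-- totally ordered field is, classically, ℝ up to a unique isomorphism.
record CompleteOrderedField c ℓ₁ ℓ₂ : Set (lsuc (c ⊔ ℓ₁ ⊔ ℓ₂)) where
  infix  8 -_
  infixl 7 _*_
  infixl 6 _+_ _-_
  infix  4 _≈_ _<_ ∣_-_∣<_
  field
    Carrier            : Set c
    _≈_                : Rel Carrier ℓ₁
    _<_                : Rel Carrier ℓ₂
    _+_ _*_            : Carrier → Carrier → Carrier
    -_                 : Carrier → Carrier
    0# 1#              : Carrier
    isCommutativeRing  : IsCommutativeRing _≈_ _+_ _*_ -_ 0# 1#
    isStrictTotalOrder : IsStrictTotalOrder _≈_ _<_
    inverse            : ∀ x → ¬ (x ≈ 0#) → ∃[ y ] x * y ≈ 1#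
    0<1                : 0# < 1#
    +-monoˡ-<          : ∀ z {x y} → x < y → z + x < z + y
    *-pos              : ∀ {x y} → 0# < x → 0# < y → 0# < x * y

  rawSemiring : RawSemiring c ℓ₁
  rawSemiring = record { _≈_ = _≈_ ; _+_ = _+_ ; _*_ = _*_ ; 0# = 0# ; 1# = 1# }

  fromℕ : ℕ → Carrier
  fromℕ n = RawSemiringOps._×_ rawSemiring n 1#

  _-_ : Carrier → Carrier → Carrier
  x - y = x + - y

  ∣_-_∣<_ : Carrier → Carrier → Carrier → Set ℓ₂
  ∣ x - y ∣< ε = (x - y < ε) × (y - x < ε)

  field
    archimedean : ∀ x → ∃[ n ] x < fromℕ n
    complete    : ∀ (s : ℕ → Carrier) →
                  (∀ ε → 0# < ε → ∃[ N ] ∀ m n → N ℕ.≤ m → N ℕ.≤ n → ∣ s m - s n ∣< ε) →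
                  ∃[ l ] ∀ ε → 0# < ε → ∃[ N ] ∀ n → N ℕ.≤ n → ∣ s n - l ∣< ε

  commutativeRing : CommutativeRing c ℓ₁
  commutativeRing = record { isCommutativeRing = isCommutativeRing }

  strictTotalOrder : StrictTotalOrder c ℓ₁ ℓ₂
  strictTotalOrder = record { isStrictTotalOrder = isStrictTotalOrder }

module Real {c ℓ₁ ℓ₂} (R : CompleteOrderedField c ℓ₁ ℓ₂) where
  open CompleteOrderedField R public
    using (fromℕ; 0<1; +-monoˡ-<; *-pos; inverse; ∣_-_∣<_; archimedean; complete; commutativeRing)
  open CommutativeRing commutativeRing public
  open StrictTotalOrder (CompleteOrderedField.strictTotalOrder R) public
    using (_<_; compare; strictPartialOrder; <-respʳ-≈; <-respˡ-≈; irrefl)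
    renaming (_≟_ to infix 4 _≟_; trans to <-trans)
  open RawSemiringOps (CompleteOrderedField.rawSemiring R) public using (_^_)

  -- Total, with 0⁻¹ = 0.
  infix 9 _⁻¹
  _⁻¹ : Carrier → Carrier
  x ⁻¹ with x ≟ 0#
  ... | yes _   = 0#
  ... | no  x≉0 = proj₁ (inverse x x≉0)

  ∑ : (ℕ → Carrier) → ℕ → Carrier
  ∑ a zero  = 0#
  ∑ a (suc n) = ∑ a n + a n

------------------------------------------------------------------------
-- Order lemmas leading to the convergence of the exponential series

module ExponentialBounds {c ℓ₁ ℓ₂} (R : CompleteOrderedField c ℓ₁ ℓ₂) where
  open Real R hiding (refl)
  open RingProperties ring
  open StrictReasoning strictPartialOrder
  open StrictToNonStrict _≈_ _<_ public using (_≤_)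

  private
    ≡⇒≈ : ∀ {x y : Carrier} → x ≡ y → x ≈ y
    ≡⇒≈ refl = CommutativeRing.refl commutativeRing

  ≈-refl : ∀ {x} → x ≈ x
  ≈-refl = CommutativeRing.refl commutativeRing

  ≤-refl : ∀ {x} → x ≤ x
  ≤-refl = inj₂ ≈-refl

  ≤-trans : ∀ {x y z} → x ≤ y → y ≤ z → x ≤ z
  ≤-trans {x} {y} {z} x≤y y≤z = begin x ≤⟨ x≤y ⟩ y ≤⟨ y≤z ⟩ z ∎

  +-monoʳ-≤ : ∀ z {x y} → x ≤ y → z + x ≤ z + y
  +-monoʳ-≤ z (inj₁ x<y) = inj₁ (+-monoˡ-< z x<y)
  +-monoʳ-≤ z (inj₂ x≈y) = inj₂ (+-congˡ x≈y)

  +-monoˡ-≤ : ∀ z {x y} → x ≤ y → x + z ≤ y + z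
  +-monoˡ-≤ z {x} {y} x≤y = begin
    x + z ≈⟨ +-comm x z ⟩
    z + x ≤⟨ +-monoʳ-≤ z x≤y ⟩
    z + y ≈⟨ +-comm z y ⟩
    y + z ∎

  +-mono-≤ : ∀ {w x y z} → w ≤ x → y ≤ z → w + y ≤ x + z
  +-mono-≤ {w} {x} {y} {z} p q = ≤-trans (+-monoˡ-≤ y p) (+-monoʳ-≤ x q)

  x<y⇒0<y-x : ∀ {x y} → x < y → 0# < y - x
  x<y⇒0<y-x {x} {y} x<y = begin-strict
    0#      ≈⟨ -‿inverseˡ x ⟨
    - x + x <⟨ +-monoˡ-< (- x) x<y ⟩
    - x + y ≈⟨ +-comm (- x) y ⟩
    y - x   ∎

  x<0⇒0<-x : ∀ {x} → x < 0# → 0# < - x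
  x<0⇒0<-x {x} x<0 = begin-strict
    0#       <⟨ x<y⇒0<y-x x<0 ⟩
    0# - x   ≈⟨ +-identityˡ (- x) ⟩
    - x      ∎

  *-monoʳ-< : ∀ {z x y} → 0# < z → x < y → z * x < z * y
  *-monoʳ-< {z} {x} {y} 0<z x<y = begin-strict
    z * x                   ≈⟨ +-identityʳ _ ⟨
    z * x + 0#              <⟨ +-monoˡ-< (z * x) (*-pos 0<z (x<y⇒0<y-x x<y)) ⟩
    z * x + z * (y - x)     ≈⟨ distribˡ z x (y - x) ⟨
    z * (x + (y - x))       ≈⟨ *-congˡ (+-congˡ (+-comm y (- x))) ⟩
    z * (x + (- x + y))     ≈⟨ *-congˡ (+-assoc x (- x) y) ⟨
    z * (x - x + y)         ≈⟨ *-congˡ (+-congʳ (-‿inverseʳ x)) ⟩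
    z * (0# + y)            ≈⟨ *-congˡ (+-identityˡ y) ⟩
    z * y                   ∎

  *-monoʳ-≤ : ∀ {z x y} → 0# ≤ z → x ≤ y → z * x ≤ z * y
  *-monoʳ-≤ 0≤z (inj₂ x≈y) = inj₂ (*-congˡ x≈y)
  *-monoʳ-≤ (inj₁ 0<z) (inj₁ x<y) = inj₁ (*-monoʳ-< 0<z x<y)
  *-monoʳ-≤ {z} {x} {y} (inj₂ 0≈z) (inj₁ _) = inj₂ (begin-equality
    z * x  ≈⟨ *-congʳ 0≈z ⟨
    0# * x ≈⟨ zeroˡ x ⟩
    0#     ≈⟨ zeroˡ y ⟨
    0# * y ≈⟨ *-congʳ 0≈z ⟩
    z * y  ∎)

  *-monoˡ-≤ : ∀ {z x y} → 0# ≤ z → x ≤ y → x * z ≤ y * z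
  *-monoˡ-≤ {z} {x} {y} 0≤z x≤y = begin
    x * z ≈⟨ *-comm x z ⟩
    z * x ≤⟨ *-monoʳ-≤ 0≤z x≤y ⟩
    z * y ≈⟨ *-comm z y ⟩
    y * z ∎

  *-nonneg : ∀ {x y} → 0# ≤ x → 0# ≤ y → 0# ≤ x * y
  *-nonneg {x} {y} 0≤x 0≤y = begin
    0#     ≈⟨ zeroʳ x ⟨
    x * 0# ≤⟨ *-monoʳ-≤ 0≤x 0≤y ⟩
    x * y  ∎

  x+x≈2x : ∀ x → x + x ≈ (1# + 1#) * x
  x+x≈2x x = begin-equality
    x + x             ≈⟨ +-cong (*-identityˡ x) (*-identityˡ x) ⟨
    1# * x + 1# * x   ≈⟨ distribʳ x 1# 1# ⟨
    (1# + 1#) * x     ∎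

  0≤fromℕ : ∀ n → 0# ≤ fromℕ n
  0≤fromℕ zero = ≤-refl
  0≤fromℕ (suc n) = begin
    0#           ≈⟨ +-identityˡ 0# ⟨
    0# + 0#      ≤⟨ +-mono-≤ (inj₁ 0<1) (0≤fromℕ n) ⟩
    1# + fromℕ n ∎

  0<fromℕ : ∀ n .{{_ : NonZero n}} → 0# < fromℕ n
  0<fromℕ (suc n) = begin-strict
    0#           <⟨ 0<1 ⟩
    1#           ≈⟨ +-identityʳ 1# ⟨
    1# + 0#      ≤⟨ +-monoʳ-≤ 1# (0≤fromℕ n) ⟩
    1# + fromℕ n ∎

  fromℕ-+ : ∀ m n → fromℕ (m ℕ.+ n) ≈ fromℕ m + fromℕ n
  fromℕ-+ zero n = sym (+-identityˡ _)
  fromℕ-+ (suc m) n = begin-equality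
    1# + fromℕ (m ℕ.+ n)     ≈⟨ +-congˡ (fromℕ-+ m n) ⟩
    1# + (fromℕ m + fromℕ n) ≈⟨ +-assoc 1# _ _ ⟨
    1# + fromℕ m + fromℕ n   ∎

  fromℕ-* : ∀ m n → fromℕ (m ℕ.* n) ≈ fromℕ m * fromℕ n
  fromℕ-* zero n = sym (zeroˡ _)
  fromℕ-* (suc m) n = begin-equality
    fromℕ (n ℕ.+ m ℕ.* n)             ≈⟨ fromℕ-+ n (m ℕ.* n) ⟩
    fromℕ n + fromℕ (m ℕ.* n)         ≈⟨ +-cong (sym (*-identityˡ _)) (fromℕ-* m n) ⟩
    1# * fromℕ n + fromℕ m * fromℕ n  ≈⟨ distribʳ (fromℕ n) 1# (fromℕ m) ⟨
    (1# + fromℕ m) * fromℕ n          ∎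

  fromℕ-mono : ∀ {m n} → m ℕ.≤ n → fromℕ m ≤ fromℕ n
  fromℕ-mono {n = n} ℕ.z≤n = 0≤fromℕ n
  fromℕ-mono (ℕ.s≤s m≤n) = +-monoʳ-≤ 1# (fromℕ-mono m≤n)

  *-inverseʳ : ∀ {x} → ¬ (x ≈ 0#) → x * x ⁻¹ ≈ 1#
  *-inverseʳ {x} x≉0 with x ≟ 0#
  ... | yes x≈0 = contradiction x≈0 x≉0
  ... | no  x≉0 = proj₂ (inverse x x≉0)

  pos⇒≉0 : ∀ {x} → 0# < x → ¬ (x ≈ 0#)
  pos⇒≉0 0<x x≈0 = irrefl (sym x≈0) 0<x

  ⁻¹-pos : ∀ {x} → 0# < x → 0# < x ⁻¹
  ⁻¹-pos {x} 0<x with compare 0# (x ⁻¹)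
  ... | tri< 0<x⁻¹ _ _ = 0<x⁻¹
  ... | tri≈ _ 0≈x⁻¹ _ = contradiction
    (begin-equality
      0#       ≈⟨ zeroʳ x ⟨
      x * 0#   ≈⟨ *-congˡ 0≈x⁻¹ ⟩
      x * x ⁻¹ ≈⟨ *-inverseʳ (pos⇒≉0 0<x) ⟩
      1#       ∎)
    (λ 0≈1 → irrefl 0≈1 0<1)
  ... | tri> _ _ x⁻¹<0 = contradiction
    (begin-strict
      0#       <⟨ 0<1 ⟩
      1#       ≈⟨ *-inverseʳ (pos⇒≉0 0<x) ⟨
      x * x ⁻¹ <⟨ *-monoʳ-< 0<x x⁻¹<0 ⟩
      x * 0#   ≈⟨ zeroʳ x ⟩
      0#       ∎)
    (irrefl ≈-refl)

  *-cancelˡ-≈ : ∀ {z x y} → 0# < z → z * x ≈ z * y → x ≈ y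
  *-cancelˡ-≈ {z} {x} {y} 0<z eq with compare x y
  ... | tri< x<y _ _ = contradiction (*-monoʳ-< 0<z x<y) (irrefl eq)
  ... | tri≈ _ x≈y _ = x≈y
  ... | tri> _ _ y<x = contradiction (*-monoʳ-< 0<z y<x) (irrefl (sym eq))

  *-cancelˡ-< : ∀ {z x y} → 0# < z → z * x < z * y → x < y
  *-cancelˡ-< {z} {x} {y} 0<z lt with compare x y
  ... | tri< x<y _ _ = x<y
  ... | tri≈ _ x≈y _ = contradiction lt (irrefl (*-congˡ x≈y))
  ... | tri> _ _ y<x = contradiction (<-trans lt (*-monoʳ-< 0<z y<x)) (irrefl ≈-refl)

  -- ∣ x ∣ ≤ a
  record Bounded (a x : Carrier) : Set (ℓ₁ ⊔ ℓ₂) where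
    constructor _,_
    field
      upper : x ≤ a
      lower : - x ≤ a

  Bounded-neg : ∀ {a x} → Bounded a x → Bounded a (- x)
  Bounded-neg {a} {x} (u , l) = l , (begin - - x ≈⟨ -‿involutive x ⟩ x ≤⟨ u ⟩ a ∎)

  Bounded-resp : ∀ {a x y} → x ≈ y → Bounded a x → Bounded a y
  Bounded-resp {a} {x} {y} eq (u , l) =
    (begin y ≈⟨ eq ⟨ x ≤⟨ u ⟩ a ∎) , (begin - y ≈⟨ -‿cong eq ⟨ - x ≤⟨ l ⟩ a ∎)

  Bounded-≤ : ∀ {a b x} → a ≤ b → Bounded a x → Bounded b x
  Bounded-≤ a≤b (u , l) = ≤-trans u a≤b , ≤-trans l a≤b

  Bounded-+ : ∀ {a b x y} → Bounded a x → Bounded b y → Bounded (a + b) (x + y)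
  Bounded-+ {a} {b} {x} {y} (u , l) (u′ , l′) = +-mono-≤ u u′ , (begin
    - (x + y)   ≈⟨ -‿+-comm x y ⟨
    - x + - y   ≤⟨ +-mono-≤ l l′ ⟩
    a + b       ∎)

  Bounded-nonneg-* : ∀ {a b x y} → 0# ≤ b → 0# ≤ x → x ≤ a → Bounded b y → Bounded (a * b) (x * y)
  Bounded-nonneg-* {a} {b} {x} {y} 0≤b 0≤x x≤a (u , l) =
    ≤-trans (*-monoʳ-≤ 0≤x u) (*-monoˡ-≤ 0≤b x≤a) , (begin
      - (x * y) ≈⟨ -‿distribʳ-* x y ⟩
      x * - y   ≤⟨ *-monoʳ-≤ 0≤x l ⟩
      x * b     ≤⟨ *-monoˡ-≤ 0≤b x≤a ⟩
      a * b     ∎)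

  Bounded-* : ∀ {a b x y} → 0# ≤ b → Bounded a x → Bounded b y → Bounded (a * b) (x * y)
  Bounded-* {a} {b} {x} {y} 0≤b (u , l) by with compare x 0#
  ... | tri< x<0 _ _ = Bounded-resp
    (begin-equality
      - x * - y     ≈⟨ -‿distribˡ-* x (- y) ⟨
      - (x * - y)   ≈⟨ -‿cong (-‿distribʳ-* x y) ⟨
      - - (x * y)   ≈⟨ -‿involutive _ ⟩
      x * y         ∎)
    (Bounded-nonneg-* 0≤b (inj₁ (x<0⇒0<-x x<0)) l (Bounded-neg by))
  ... | tri≈ _ x≈0 _ = Bounded-nonneg-* 0≤b (inj₂ (sym x≈0)) u by
  ... | tri> _ _ 0<x = Bounded-nonneg-* 0≤b (inj₁ 0<x) u by

  bound : ∀ x → ∃[ m ] Bounded (fromℕ m) x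
  bound x with archimedean x | archimedean (- x)
  ... | m , x<m | n , -x<n = m ℕ.+ n ,
    (≤-trans (inj₁ x<m) (fromℕ-mono (ℕ.m≤m+n m n)) , ≤-trans (inj₁ -x<n) (fromℕ-mono (ℕ.m≤n+m n m)))

  !⁻¹ : ℕ → Carrier
  !⁻¹ k = fromℕ (k !) ⁻¹

  !⁻¹-pos : ∀ k → 0# < !⁻¹ k
  !⁻¹-pos k = ⁻¹-pos (0<fromℕ (k !) {{ℕ._!≢0 k}})

  !⁻¹-suc : ∀ k → fromℕ (suc k) * !⁻¹ (suc k) ≈ !⁻¹ k
  !⁻¹-suc k = *-cancelˡ-≈ (0<fromℕ (k !) {{ℕ._!≢0 k}}) (begin-equality
    fromℕ (k !) * (fromℕ (suc k) * !⁻¹ (suc k)) ≈⟨ *-assoc _ _ _ ⟨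
    fromℕ (k !) * fromℕ (suc k) * !⁻¹ (suc k)   ≈⟨ *-congʳ (*-comm _ _) ⟩
    fromℕ (suc k) * fromℕ (k !) * !⁻¹ (suc k)   ≈⟨ *-congʳ (fromℕ-* (suc k) (k !)) ⟨
    fromℕ ((suc k) !) * !⁻¹ (suc k)               ≈⟨ *-inverseʳ (pos⇒≉0 (0<fromℕ ((suc k) !) {{ℕ._!≢0 (suc k)}})) ⟩
    1#                                          ≈⟨ *-inverseʳ (pos⇒≉0 (0<fromℕ (k !) {{ℕ._!≢0 k}})) ⟨
    fromℕ (k !) * !⁻¹ k                         ∎)

  module Dominated (B : ℕ) where

    y : ℕ → Carrier
    y k = !⁻¹ k * fromℕ B ^ k

    0≤^ : ∀ k → 0# ≤ fromℕ B ^ k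
    0≤^ zero = inj₁ 0<1
    0≤^ (suc k) = *-nonneg (0≤fromℕ B) (0≤^ k)

    0≤y : ∀ k → 0# ≤ y k
    0≤y k = *-nonneg (inj₁ (!⁻¹-pos k)) (0≤^ k)

    y-step : ∀ k → B ℕ.+ B ℕ.≤ suc k → y (suc k) + y (suc k) ≤ y k
    y-step k 2B≤1+k = begin
      i * (b * b^k) + i * (b * b^k)   ≈⟨ +-cong lemma lemma ⟩
      b * i * b^k + b * i * b^k       ≈⟨ distribʳ b^k (b * i) (b * i) ⟨
      (b * i + b * i) * b^k           ≈⟨ *-congʳ (distribʳ i b b) ⟨
      (b + b) * i * b^k               ≈⟨ *-congʳ (*-congʳ (fromℕ-+ B B)) ⟨
      fromℕ (B ℕ.+ B) * i * b^k       ≤⟨ *-monoˡ-≤ (0≤^ k) (*-monoˡ-≤ (inj₁ (!⁻¹-pos (suc k))) (fromℕ-mono 2B≤1+k)) ⟩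
      fromℕ (suc k) * i * b^k         ≈⟨ *-congʳ (!⁻¹-suc k) ⟩
      !⁻¹ k * b^k                     ∎
      where
      i = !⁻¹ (suc k)
      b = fromℕ B
      b^k = b ^ k
      lemma : i * (b * b^k) ≈ b * i * b^k
      lemma = begin-equality
        i * (b * b^k) ≈⟨ *-assoc i b b^k ⟨
        i * b * b^k   ≈⟨ *-congʳ (*-comm i b) ⟩
        b * i * b^k   ∎

    2^_ : ℕ → Carrier
    2^ j = (1# + 1#) ^ j

    0<2^ : ∀ j → 0# < 2^ j
    0<2^ zero = 0<1
    0<2^ (suc j) = *-pos 0<2 (0<2^ j)
      where
      0<2 : 0# < 1# + 1#
      0<2 = begin-strict
        0#      <⟨ 0<1 ⟩
        1#      ≈⟨ +-identityʳ 1# ⟨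
        1# + 0# <⟨ +-monoˡ-< 1# 0<1 ⟩
        1# + 1# ∎

    1≤2^ : ∀ j → 1# ≤ 2^ j
    1≤2^ zero = ≤-refl
    1≤2^ (suc j) = begin
      1#                ≤⟨ 1≤2^ j ⟩
      2^ j              ≈⟨ +-identityʳ _ ⟨
      2^ j + 0#         ≤⟨ +-monoʳ-≤ _ (inj₁ (0<2^ j)) ⟩
      2^ j + 2^ j       ≈⟨ x+x≈2x _ ⟩
      (1# + 1#) * 2^ j  ∎

    fromℕ≤2^ : ∀ j → fromℕ j ≤ 2^ j
    fromℕ≤2^ zero = inj₁ 0<1
    fromℕ≤2^ (suc j) = begin
      1# + fromℕ j       ≤⟨ +-mono-≤ (1≤2^ j) (fromℕ≤2^ j) ⟩
      2^ j + 2^ j        ≈⟨ x+x≈2x _ ⟩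
      (1# + 1#) * 2^ j   ∎

    y-decay : ∀ j → 2^ j * y (j ℕ.+ (B ℕ.+ B)) ≤ y (B ℕ.+ B)
    y-decay zero = inj₂ (*-identityˡ _)
    y-decay (suc j) = begin
      (1# + 1#) * 2^ j * y (suc n)         ≈⟨ *-congʳ (*-comm _ _) ⟩
      2^ j * (1# + 1#) * y (suc n)         ≈⟨ *-assoc _ _ _ ⟩
      2^ j * ((1# + 1#) * y (suc n))       ≈⟨ *-congˡ (x+x≈2x _) ⟨
      2^ j * (y (suc n) + y (suc n))       ≤⟨ *-monoʳ-≤ (inj₁ (0<2^ j)) (y-step n (ℕ.≤-trans (ℕ.m≤n+m (B ℕ.+ B) j) (ℕ.n≤1+n n))) ⟩
      2^ j * y n                           ≤⟨ y-decay j ⟩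
      y (B ℕ.+ B)                          ∎
      where n = j ℕ.+ (B ℕ.+ B)

    upper-tail : ∀ (x : ℕ → Carrier) → (∀ k → x k ≤ y k) → ∀ N → B ℕ.+ B ℕ.≤ N → ∀ j →
                 ∑ x (j ℕ.+ N) + (y (j ℕ.+ N) + y (j ℕ.+ N)) ≤ ∑ x N + (y N + y N)
    upper-tail x x≤y N K≤N zero = ≤-refl
    upper-tail x x≤y N K≤N (suc j) = begin
      ∑ x n + x n + (y (suc n) + y (suc n)) ≤⟨ +-mono-≤ (+-monoʳ-≤ _ (x≤y n)) (y-step n (ℕ.≤-trans K≤N (ℕ.≤-trans (ℕ.m≤n+m N j) (ℕ.n≤1+n n)))) ⟩
      ∑ x n + y n + y n                     ≈⟨ +-assoc _ _ _ ⟩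
      ∑ x n + (y n + y n)                   ≤⟨ upper-tail x x≤y N K≤N j ⟩
      ∑ x N + (y N + y N)                   ∎
      where n = j ℕ.+ N

    upper : ∀ (x : ℕ → Carrier) → (∀ k → x k ≤ y k) → ∀ N → B ℕ.+ B ℕ.≤ N → ∀ n → N ℕ.≤ n →
            ∑ x n ≤ ∑ x N + (y N + y N)
    upper x x≤y N K≤N n N≤n = begin
      ∑ x n                                      ≈⟨ ≡⇒≈ (cong (∑ x) eq) ⟨
      ∑ x m                                      ≈⟨ +-identityʳ _ ⟨
      ∑ x m + 0#                                 ≈⟨ +-congˡ (+-identityˡ 0#) ⟨
      ∑ x m + (0# + 0#)                          ≤⟨ +-monoʳ-≤ _ (+-mono-≤ (0≤y m) (0≤y m)) ⟩
      ∑ x m + (y m + y m)                        ≤⟨ upper-tail x x≤y N K≤N (n ℕ.∸ N) ⟩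
      ∑ x N + (y N + y N)                        ∎
      where
      m = (n ℕ.∸ N) ℕ.+ N
      eq : m ≡ n
      eq = ℕ.m∸n+n≡m N≤n

    ∑-neg : ∀ (x : ℕ → Carrier) n → ∑ (λ k → - x k) n ≈ - ∑ x n
    ∑-neg x zero = sym -0#≈0#
    ∑-neg x (suc n) = begin-equality
      ∑ (λ k → - x k) n + - x n ≈⟨ +-congʳ (∑-neg x n) ⟩
      - ∑ x n + - x n         ≈⟨ -‿+-comm _ _ ⟩
      - (∑ x n + x n)           ∎

    module _ (x : ℕ → Carrier) (x-bound : ∀ k → Bounded (y k) (x k)) where

      close : ∀ N → B ℕ.+ B ℕ.≤ N → ∀ m n → N ℕ.≤ m → N ℕ.≤ n →
              ∑ x m - ∑ x n ≤ (y N + y N) + (y N + y N)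
      close N K≤N m n N≤m N≤n = begin
        ∑ x m - ∑ x n                             ≤⟨ +-mono-≤ (upper x (Bounded.upper ∘ x-bound) N K≤N m N≤m) low ⟩
        ∑ x N + (y N + y N) + (- ∑ x N + (y N + y N))  ≈⟨ +-congʳ (+-comm _ _) ⟩
        (y N + y N) + ∑ x N + (- ∑ x N + (y N + y N))  ≈⟨ +-assoc _ _ _ ⟩
        (y N + y N) + (∑ x N + (- ∑ x N + (y N + y N)))  ≈⟨ +-congˡ (+-assoc _ _ _) ⟨
        (y N + y N) + (∑ x N - ∑ x N + (y N + y N))        ≈⟨ +-congˡ (+-congʳ (-‿inverseʳ _)) ⟩
        (y N + y N) + (0# + (y N + y N))                       ≈⟨ +-congˡ (+-identityˡ _) ⟩
        (y N + y N) + (y N + y N)                              ∎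
        where
        low : - ∑ x n ≤ - ∑ x N + (y N + y N)
        low = begin
          - ∑ x n                             ≈⟨ ∑-neg x n ⟨
          ∑ (λ k → - x k) n                     ≤⟨ upper (λ k → - x k) (Bounded.lower ∘ x-bound) N K≤N n N≤n ⟩
          ∑ (λ k → - x k) N + (y N + y N)       ≈⟨ +-congʳ (∑-neg x N) ⟩
          - ∑ x N + (y N + y N)               ∎

      4·_ : Carrier → Carrier
      4· t = (t + t) + (t + t)

      cauchy : ∀ ε → 0# < ε → ∃[ N ] ∀ m n → N ℕ.≤ m → N ℕ.≤ n → ∣ ∑ x m - ∑ x n ∣< ε
      cauchy ε 0<ε with archimedean (ε ⁻¹ * (4· y (B ℕ.+ B)))
      ... | j , lt = N , λ m n N≤m N≤n → diff m n N≤m N≤n , diff n m N≤n N≤m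
        where
        K = B ℕ.+ B
        N = j ℕ.+ K
        *-4· : ∀ s t → s * (4· t) ≈ 4· (s * t)
        *-4· s t = begin-equality
          s * ((t + t) + (t + t))           ≈⟨ distribˡ s _ _ ⟩
          s * (t + t) + s * (t + t)         ≈⟨ +-cong (distribˡ s t t) (distribˡ s t t) ⟩
          (s * t + s * t) + (s * t + s * t) ∎
        4·-mono : ∀ {s t} → s ≤ t → 4· s ≤ 4· t
        4·-mono s≤t = +-mono-≤ (+-mono-≤ s≤t s≤t) (+-mono-≤ s≤t s≤t)
        small : 4· y N < ε
        small = *-cancelˡ-< (0<2^ j) (begin-strict
          2^ j * (4· y N)                ≈⟨ *-4· _ _ ⟩
          4· (2^ j * y N)                ≤⟨ 4·-mono (y-decay j) ⟩
          4· y K                         ≈⟨ *-identityˡ _ ⟨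
          1# * (4· y K)                  ≈⟨ *-congʳ (*-inverseʳ (pos⇒≉0 0<ε)) ⟨
          ε * ε ⁻¹ * (4· y K)            ≈⟨ *-assoc _ _ _ ⟩
          ε * (ε ⁻¹ * (4· y K))          <⟨ *-monoʳ-< 0<ε lt ⟩
          ε * fromℕ j                    ≤⟨ *-monoʳ-≤ (inj₁ 0<ε) (fromℕ≤2^ j) ⟩
          ε * 2^ j                       ≈⟨ *-comm _ _ ⟩
          2^ j * ε                       ∎)
        diff : ∀ m n → N ℕ.≤ m → N ℕ.≤ n → ∑ x m - ∑ x n < ε
        diff m n N≤m N≤n = begin-strict
          ∑ x m - ∑ x n   ≤⟨ close N (ℕ.m≤n+m K j) m n N≤m N≤n ⟩
          4· y N              <⟨ small ⟩
          ε                   ∎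

------------------------------------------------------------------------
-- The complex numbers

module Complex {c ℓ₁ ℓ₂} (R : CompleteOrderedField c ℓ₁ ℓ₂) where
  open ExponentialBounds R
  private
    module ℝ = Real R
    open ℝ using () renaming (Carrier to ℝ)

  infix 5 _+i_
  record ℂ : Set c where
    constructor _+i_
    field
      re im : ℝ
  open ℂ public

  infix  8 -_
  infixl 7 _*_
  infixl 6 _+_ _-_
  infix  4 _≈_ _≉_

  _≈_ : Rel ℂ ℓ₁
  z ≈ w = (re z ℝ.≈ re w) × (im z ℝ.≈ im w)

  _≉_ : Rel ℂ ℓ₁
  z ≉ w = ¬ (z ≈ w)

  _+_ _*_ _-_ : ℂ → ℂ → ℂ
  z + w = re z ℝ.+ re w +i im z ℝ.+ im w
  z * w = re z ℝ.* re w ℝ.- im z ℝ.* im w +i re z ℝ.* im w ℝ.+ im z ℝ.* re w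
  z - w = re z ℝ.- re w +i im z ℝ.- im w

  -_ : ℂ → ℂ
  - z = ℝ.- re z +i ℝ.- im z

  fromℝ : ℝ → ℂ
  fromℝ x = x +i ℝ.0#

  0# 1# : ℂ
  0# = fromℝ ℝ.0#
  1# = fromℝ ℝ.1#

  rawSemiring : RawSemiring c ℓ₁
  rawSemiring = record { _≈_ = _≈_ ; _+_ = _+_ ; _*_ = _*_ ; 0# = 0# ; 1# = 1# }

  open RawSemiringOps rawSemiring public using (_^_)

  fromℕ : ℕ → ℂ
  fromℕ n = fromℝ (ℝ.fromℕ n)

  ∣_∣² : ℂ → ℝ
  ∣ z ∣² = re z ℝ.* re z ℝ.+ im z ℝ.* im z

  -- Total, with 0⁻¹ = 0.
  infix 9 _⁻¹
  _⁻¹ : ℂ → ℂ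
  z ⁻¹ = re z ℝ.* ∣ z ∣² ℝ.⁻¹ +i ℝ.- im z ℝ.* ∣ z ∣² ℝ.⁻¹

  infixr 8 _^ᶻ_
  _^ᶻ_ : ℂ → ℤ → ℂ
  z ^ᶻ (+ n)    = z ^ n
  z ^ᶻ -[1+ n ] = (z ⁻¹) ^ suc n

  -- ∣ z ∣ < r for r ≥ 0, with both sides squared.
  ∣_∣<_ : ℂ → ℝ → Set ℓ₂
  ∣ z ∣< r = ∣ z ∣² ℝ.< r ℝ.* r

  partialSum : (ℕ → ℂ) → ℕ → ℂ
  partialSum a zero    = 0#
  partialSum a (suc n) = partialSum a n + a n

  HasSum : (ℕ → ℂ) → ℂ → Set (c ⊔ ℓ₂)
  HasSum a s = ∀ ε → ℝ.0# ℝ.< ε → ∃[ N ] ∀ n → N ℕ.≤ n → ∣ partialSum a n - s ∣< ε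

  expTerm : ℂ → ℕ → ℂ
  expTerm z k = fromℝ (ℝ.fromℕ (k !) ℝ.⁻¹) * z ^ k

  module ExpConvergence (z : ℂ) where
    private
      open StrictReasoning ℝ.strictPartialOrder
      open RingProperties ℝ.ring

      reB = bound (re z)
      imB = bound (im z)
      m = proj₁ reB ℕ.+ proj₁ imB

      re-bound : Bounded (ℝ.fromℕ m) (re z)
      re-bound = Bounded-≤ (fromℕ-mono (ℕ.m≤m+n (proj₁ reB) (proj₁ imB))) (proj₂ reB)

      im-bound : Bounded (ℝ.fromℕ m) (im z)
      im-bound = Bounded-≤ (fromℕ-mono (ℕ.m≤n+m (proj₁ imB) (proj₁ reB))) (proj₂ imB)

      open Dominated (m ℕ.+ m)

      b^_ : ℕ → ℝ
      b^ k = ℝ.fromℕ (m ℕ.+ m) ℝ.^ k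

      ^-split : ∀ k → ℝ.fromℕ m ℝ.* b^ k ℝ.+ ℝ.fromℕ m ℝ.* b^ k ℝ.≈ b^ suc k
      ^-split k = begin-equality
        ℝ.fromℕ m ℝ.* b^ k ℝ.+ ℝ.fromℕ m ℝ.* b^ k ≈⟨ ℝ.distribʳ (b^ k) _ _ ⟨
        (ℝ.fromℕ m ℝ.+ ℝ.fromℕ m) ℝ.* b^ k        ≈⟨ ℝ.*-congʳ (fromℕ-+ m m) ⟨
        ℝ.fromℕ (m ℕ.+ m) ℝ.* b^ k                ∎

      ^-bound : ∀ k → Bounded (b^ k) (re (z ^ k)) × Bounded (b^ k) (im (z ^ k))
      ^-bound zero = (≤-refl , ≤-trans (-1≤0) (inj₁ ℝ.0<1)) , (inj₁ ℝ.0<1 , (begin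
          ℝ.- ℝ.0# ≈⟨ -0#≈0# ⟩
          ℝ.0#     <⟨ ℝ.0<1 ⟩
          ℝ.1#     ∎))
        where
        -1≤0 : ℝ.- ℝ.1# ≤ ℝ.0#
        -1≤0 = begin
          ℝ.- ℝ.1#              ≈⟨ ℝ.+-identityʳ _ ⟨
          ℝ.- ℝ.1# ℝ.+ ℝ.0#     ≤⟨ +-monoʳ-≤ (ℝ.- ℝ.1#) (inj₁ ℝ.0<1) ⟩
          ℝ.- ℝ.1# ℝ.+ ℝ.1#     ≈⟨ ℝ.-‿inverseˡ ℝ.1# ⟩
          ℝ.0#                  ∎
      ^-bound (suc k) with ^-bound k
      ... | br , bi =
        Bounded-≤ (inj₂ (^-split k))
          (Bounded-+ (Bounded-* (0≤^ k) re-bound br) (Bounded-neg (Bounded-* (0≤^ k) im-bound bi))) ,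
        Bounded-≤ (inj₂ (^-split k))
          (Bounded-+ (Bounded-* (0≤^ k) re-bound bi) (Bounded-* (0≤^ k) im-bound br))

      scaled : ∀ k {x} → Bounded (b^ k) x → Bounded (y k) (!⁻¹ k ℝ.* x)
      scaled k = Bounded-nonneg-* (0≤^ k) (inj₁ (!⁻¹-pos k)) ≤-refl

    re-term-bound : ∀ k → Bounded (y k) (re (expTerm z k))
    re-term-bound k = Bounded-resp (begin-equality
      !⁻¹ k ℝ.* re (z ^ k)                                     ≈⟨ ℝ.+-identityʳ _ ⟨
      !⁻¹ k ℝ.* re (z ^ k) ℝ.+ ℝ.0#                            ≈⟨ ℝ.+-congˡ -0#≈0# ⟨
      !⁻¹ k ℝ.* re (z ^ k) ℝ.- ℝ.0#                            ≈⟨ ℝ.+-congˡ (ℝ.-‿cong (ℝ.zeroˡ _)) ⟨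
      !⁻¹ k ℝ.* re (z ^ k) ℝ.- ℝ.0# ℝ.* im (z ^ k)             ∎)
      (scaled k (proj₁ (^-bound k)))

    im-term-bound : ∀ k → Bounded (y k) (im (expTerm z k))
    im-term-bound k = Bounded-resp (begin-equality
      !⁻¹ k ℝ.* im (z ^ k)                                     ≈⟨ ℝ.+-identityʳ _ ⟨
      !⁻¹ k ℝ.* im (z ^ k) ℝ.+ ℝ.0#                            ≈⟨ ℝ.+-congˡ (ℝ.zeroˡ _) ⟨
      !⁻¹ k ℝ.* im (z ^ k) ℝ.+ ℝ.0# ℝ.* re (z ^ k)             ∎)
      (scaled k (proj₂ (^-bound k)))

    re-limit : ∃[ l ] ∀ ε → ℝ.0# ℝ.< ε → ∃[ N ] ∀ n → N ℕ.≤ n → ℝ.∣ ℝ.∑ (re ∘ expTerm z) n - l ∣< ε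
    re-limit = ℝ.complete (ℝ.∑ (re ∘ expTerm z)) (cauchy (re ∘ expTerm z) re-term-bound)

    im-limit : ∃[ l ] ∀ ε → ℝ.0# ℝ.< ε → ∃[ N ] ∀ n → N ℕ.≤ n → ℝ.∣ ℝ.∑ (im ∘ expTerm z) n - l ∣< ε
    im-limit = ℝ.complete (ℝ.∑ (im ∘ expTerm z)) (cauchy (im ∘ expTerm z) im-term-bound)

  -- exp z = ∑ₖ zᵏ / k!, summed componentwise.
  opaque
    exp : ℂ → ℂ
    exp z = proj₁ re-limit +i proj₁ im-limit
      where open ExpConvergence z

  sin : ℝ → ℝ
  sin t = im (exp (ℝ.0# +i t))

  -- π is the least positive zero of the sine.
  -- π is the least positive zero of the sine.
  IsPi : ℝ → Set (c ⊔ ℓ₁ ⊔ ℓ₂)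
  IsPi π = ℝ.0# ℝ.< π × sin π ℝ.≈ ℝ.0# × (∀ t → ℝ.0# ℝ.< t → t ℝ.< π → ¬ (sin t ℝ.≈ ℝ.0#))

  -- Coefficients from the constant term upwards.
  evaluate : List ℂ → ℂ → ℂ
  evaluate []       u = 0#
  evaluate (a ∷ as) u = a + u * evaluate as u

  -- A fraction of polynomials, not necessarily in lowest terms.
  record RationalFunction : Set (c ⊔ ℓ₁) where
    field
      numerator denominator : List ℂ
      denominator≉0         : Any (_≉ 0#) denominator
  open RationalFunction public

  _RegularAt_ : RationalFunction → ℂ → Set ℓ₁
  r RegularAt u = evaluate (denominator r) u ≉ 0#

  _⟨_⟩ : RationalFunction → ℂ → ℂ
  r ⟨ u ⟩ = evaluate (numerator r) u * evaluate (denominator r) u ⁻¹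

  -- The series ∑ₙ a u n defines a function of u on the disc ∣u∣ < ρ, of which
  -- r is a meromorphic continuation to the whole plane.
  _Continues_OnDisc_ : RationalFunction → (ℂ → ℕ → ℂ) → ℝ → Set (c ⊔ ℓ₁ ⊔ ℓ₂)
  r Continues a OnDisc ρ = ∀ u → ∣ u ∣< ρ → r RegularAt u × HasSum (a u) (r ⟨ u ⟩)

  ∑ : ∀ {a} {A : Set a} → List A → (A → ℂ) → ℂ
  ∑ xs f = List.foldr (λ x s → f x + s) 0# xs

  infix 1 ∑
  syntax ∑ xs (λ x → t) = ∑[ x ∈ xs ] t

------------------------------------------------------------------------
-- Finite fields and polynomials over them

record FiniteField f (p η : ℕ) : Set (lsuc f) where
  infix  8 -_
  infixl 7 _*_
  infixl 6 _+_
  field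
    prime             : Prime p
    Carrier           : Set f
    _+_ _*_           : Carrier → Carrier → Carrier
    -_                : Carrier → Carrier
    0# 1#             : Carrier
    isCommutativeRing : IsCommutativeRing _≡_ _+_ _*_ -_ 0# 1#
    0≢1               : 0# ≢ 1#
    inverse           : ∀ x → x ≢ 0# → ∃[ y ] x * y ≡ 1#
    enumeration       : Fin (p ℕ.^ η) ↔ Carrier

  commutativeRing : CommutativeRing f f
  commutativeRing = record { isCommutativeRing = isCommutativeRing }

  rawSemiring : RawSemiring f f
  rawSemiring = record { _≈_ = _≡_ ; _+_ = _+_ ; _*_ = _*_ ; 0# = 0# ; 1# = 1# }

  open RawSemiringOps rawSemiring public
    using (_^_) renaming (_×_ to _·_)

  q : ℕ
  q = p ℕ.^ η

  infix 4 _≟_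
  _≟_ : DecidableEquality Carrier
  _≟_ = via-injection (↔⇒↣ (↔-sym enumeration)) Fin._≟_

  elements : List Carrier
  elements = List.map (Inverse.to enumeration) (List.allFin q)

  units : List Carrier
  units = List.filter (λ x → ¬? (x ≟ 0#)) elements

  -- The trace to the prime field, as the sum of the conjugates of y.
  Tr : Carrier → Carrier
  Tr y = List.foldr (λ i s → y ^ (p ℕ.^ i) + s) 0# (List.upTo η)

  -- The representative in {0, …, p - 1} of an element of the prime field.  Tr
  -- takes values there; the value 0 elsewhere is a dummy.
  residue : Carrier → ℕ
  residue y with Fin.any? {n = p} (λ k → toℕ k · 1# ≟ y)
  ... | yes (k , _) = toℕ k
  ... | no  _       = 0

module Polynomials {f p η} (F : FiniteField f p η) where
  open FiniteField F using (0≢1; _≟_; elements) renaming (Carrier to 𝔽)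
  private
    module 𝔽 = CommutativeRing (FiniteField.commutativeRing F)
    open GroupProperties 𝔽.+-group using () renaming (∙-cancelʳ to +-cancelʳ)

  -- Coefficients from the constant term upwards; trailing zeros are allowed.
  Poly : Set f
  Poly = List 𝔽

  coeff : Poly → ℕ → 𝔽
  coeff []       _       = 𝔽.0#
  coeff (a ∷ as) zero    = a
  coeff (a ∷ as) (suc n) = coeff as n

  infix 4 _≈_
  _≈_ : Poly → Poly → Set f
  a ≈ b = ∀ n → coeff a n ≡ coeff b n

  infixl 6 _+_
  _+_ : Poly → Poly → Poly
  []       + b        = b
  (x ∷ a)  + []       = x ∷ a
  (x ∷ a)  + (y ∷ b)  = x 𝔽.+ y ∷ a + b

  infixr 8 _·_
  _·_ : 𝔽 → Poly → Poly
  x · a = List.map (x 𝔽.*_) a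

  infixl 7 _*_
  _*_ : Poly → Poly → Poly
  []      * b = []
  (x ∷ a) * b = x · b + (𝔽.0# ∷ a * b)

  -- The polynomial T^deg + ∑ lowerᵢ Tⁱ.
  record Monic : Set f where
    constructor monic
    field
      deg   : ℕ
      lower : Vec 𝔽 deg
  open Monic public

  toPoly : Monic → Poly
  toPoly g = Vec.toList (lower g) ++ [ 𝔽.1# ]

  vectors : ∀ n → List (Vec 𝔽 n)
  vectors zero    = [ [] ]
  vectors (suc n) = List.cartesianProductWith _∷_ elements (vectors n)

  monics : ℕ → List Monic
  monics n = List.map (monic n) (vectors n)

  infix 4 _≡_[mod_]
  _≡_[mod_] : Poly → Poly → Monic → Set f
  a ≡ b [mod g ] = ∃[ h ] a ≈ b + h * toPoly g

  coeff-+ : ∀ a b n → coeff (a + b) n ≡ coeff a n 𝔽.+ coeff b n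
  coeff-+ []      b       n       = ≡.sym (𝔽.+-identityˡ _)
  coeff-+ (x ∷ a) []      n       = ≡.sym (𝔽.+-identityʳ _)
  coeff-+ (x ∷ a) (y ∷ b) zero    = refl
  coeff-+ (x ∷ a) (y ∷ b) (suc n) = coeff-+ a b n

  coeff-· : ∀ x a n → coeff (x · a) n ≡ x 𝔽.* coeff a n
  coeff-· x []      n       = ≡.sym (𝔽.zeroʳ x)
  coeff-· x (y ∷ a) zero    = refl
  coeff-· x (y ∷ a) (suc n) = coeff-· x a n

  tail : Poly → Poly
  tail []      = []
  tail (_ ∷ a) = a

  coeff-*-zero : ∀ a b → coeff (a * b) 0 ≡ coeff a 0 𝔽.* coeff b 0
  coeff-*-zero []      b = ≡.sym (𝔽.zeroˡ _)
  coeff-*-zero (x ∷ a) b =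
    ≡.trans (coeff-+ (x · b) _ 0) (≡.trans (𝔽.+-identityʳ _) (coeff-· x b 0))

  coeff-*-suc : ∀ a b n → coeff (a * b) (suc n) ≡ coeff a 0 𝔽.* coeff b (suc n) 𝔽.+ coeff (tail a * b) n
  coeff-*-suc []      b n = ≡.sym (≡.trans (𝔽.+-identityʳ _) (𝔽.zeroˡ _))
  coeff-*-suc (x ∷ a) b n =
    ≡.trans (coeff-+ (x · b) _ (suc n)) (𝔽.+-congʳ (coeff-· x b (suc n)))

  coeff-lead : ∀ g → coeff (toPoly g) (deg g) ≡ 𝔽.1#
  coeff-lead (monic zero [])            = refl
  coeff-lead (monic (suc m) (_ ∷ lo)) = coeff-lead (monic m lo)

  coeff-high : ∀ g n → deg g ℕ.< n → coeff (toPoly g) n ≡ 𝔽.0#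
  coeff-high (monic zero [])            (suc n) _             = refl
  coeff-high (monic (suc m) (_ ∷ lo)) (suc n) (ℕ.s≤s m<n) = coeff-high (monic m lo) n m<n

  module _ (g : Monic) where
    private
      G = toPoly g
      m = deg g

    AgreeAbove : Poly → Poly → Set f
    AgreeAbove a b = ∀ n → m ℕ.≤ n → coeff a n ≡ coeff b n

    private
      lead-step : ∀ x X y Y → X ≡ Y → x 𝔽.* coeff G m 𝔽.+ X ≡ y 𝔽.* coeff G m 𝔽.+ Y → x ≡ y
      lead-step x X y .X refl eq = begin
        x                 ≡⟨ 𝔽.*-identityʳ x ⟨
        x 𝔽.* 𝔽.1#        ≡⟨ cong (x 𝔽.*_) (coeff-lead g) ⟨
        x 𝔽.* coeff G m   ≡⟨ +-cancelʳ X _ _ eq ⟩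
        y 𝔽.* coeff G m   ≡⟨ cong (y 𝔽.*_) (coeff-lead g) ⟩
        y 𝔽.* 𝔽.1#        ≡⟨ 𝔽.*-identityʳ y ⟩
        y                 ∎
        where open ≡-Reasoning

      step : ∀ h k → (AgreeAbove (tail h * G) (tail k * G) → tail h * G ≈ tail k * G) →
             AgreeAbove (h * G) (k * G) → h * G ≈ k * G
      step h k rec agree = result
        where
        tails : tail h * G ≈ tail k * G
        tails = rec (λ n m≤n → begin
          coeff (tail h * G) n                                       ≡⟨ 𝔽.+-identityˡ _ ⟨
          𝔽.0# 𝔽.+ coeff (tail h * G) n                              ≡⟨ 𝔽.+-congʳ (vanish h n m≤n) ⟨
          coeff h 0 𝔽.* coeff G (suc n) 𝔽.+ coeff (tail h * G) n     ≡⟨ coeff-*-suc h G n ⟨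
          coeff (h * G) (suc n)                                      ≡⟨ agree (suc n) (ℕ.m≤n⇒m≤1+n m≤n) ⟩
          coeff (k * G) (suc n)                                      ≡⟨ coeff-*-suc k G n ⟩
          coeff k 0 𝔽.* coeff G (suc n) 𝔽.+ coeff (tail k * G) n     ≡⟨ 𝔽.+-congʳ (vanish k n m≤n) ⟩
          𝔽.0# 𝔽.+ coeff (tail k * G) n                              ≡⟨ 𝔽.+-identityˡ _ ⟩
          coeff (tail k * G) n                                       ∎)
          where
          open ≡-Reasoning
          vanish : ∀ h n → m ℕ.≤ n → coeff h 0 𝔽.* coeff G (suc n) ≡ 𝔽.0#
          vanish h n m≤n = ≡.trans (cong (coeff h 0 𝔽.*_) (coeff-high g (suc n) (ℕ.s≤s m≤n))) (𝔽.zeroʳ _)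

        shifted : ℕ → Poly → 𝔽
        shifted zero    h = 𝔽.0#
        shifted (suc n) h = coeff (tail h * G) n

        expand : ∀ n h → coeff (h * G) n ≡ coeff h 0 𝔽.* coeff G n 𝔽.+ shifted n h
        expand zero    h = ≡.trans (coeff-*-zero h G) (≡.sym (𝔽.+-identityʳ _))
        expand (suc n) h = coeff-*-suc h G n

        shifted-eq : ∀ n → shifted n h ≡ shifted n k
        shifted-eq zero    = refl
        shifted-eq (suc n) = tails n

        heads : coeff h 0 ≡ coeff k 0
        heads = lead-step _ _ _ _ (shifted-eq m)
          (≡.trans (≡.sym (expand m h)) (≡.trans (agree m ℕ.≤-refl) (expand m k)))

        result : h * G ≈ k * G
        result n = ≡.trans (expand n h)
          (≡.trans (cong₂ (λ x y → x 𝔽.* coeff G n 𝔽.+ y) heads (shifted-eq n)) (≡.sym (expand n k)))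

    multiples-unique : ∀ h k → AgreeAbove (h * G) (k * G) → h * G ≈ k * G
    multiples-unique []      []      _ = λ _ → refl
    multiples-unique []      (y ∷ k) = step [] (y ∷ k) (multiples-unique [] k)
    multiples-unique (x ∷ h) []      = step (x ∷ h) [] (multiples-unique h [])
    multiples-unique (x ∷ h) (y ∷ k) = step (x ∷ h) (y ∷ k) (multiples-unique h k)

    divide : ∀ a → ∃[ h ] AgreeAbove a (h * G)
    divide []       = [] , λ _ _ → refl
    divide (x ∷ a) with divide a
    ... | h , agree = t ∷ h , agree′
      where
      open ≡-Reasoning

      -- The coefficient of T^m in x + T (a - h G).
      t = coeff (x ∷ a) m 𝔽.- coeff (𝔽.0# ∷ h * G) m

      agree′ : AgreeAbove (x ∷ a) ((t ∷ h) * G)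
      agree′ n m≤n with ℕ.m≤n⇒m<n∨m≡n m≤n
      ... | inj₁ (ℕ.s≤s {n = n′} m≤n′) = begin
        coeff a n′                                                  ≡⟨ agree n′ m≤n′ ⟩
        coeff (h * G) n′                                            ≡⟨ 𝔽.+-identityˡ _ ⟨
        𝔽.0# 𝔽.+ coeff (h * G) n′                                   ≡⟨ 𝔽.+-congʳ (𝔽.zeroʳ t) ⟨
        t 𝔽.* 𝔽.0# 𝔽.+ coeff (h * G) n′                             ≡⟨ cong (λ z → t 𝔽.* z 𝔽.+ coeff (h * G) n′) (coeff-high g (suc n′) (ℕ.s≤s m≤n′)) ⟨
        t 𝔽.* coeff G (suc n′) 𝔽.+ coeff (h * G) n′                 ≡⟨ coeff-*-suc (t ∷ h) G n′ ⟨
        coeff ((t ∷ h) * G) (suc n′)                                ∎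
      ... | inj₂ refl = begin
        X                                            ≡⟨ 𝔽.+-identityʳ X ⟨
        X 𝔽.+ 𝔽.0#                                   ≡⟨ cong (X 𝔽.+_) (𝔽.-‿inverseˡ Y) ⟨
        X 𝔽.+ (𝔽.- Y 𝔽.+ Y)                          ≡⟨ 𝔽.+-assoc X (𝔽.- Y) Y ⟨
        t 𝔽.+ Y                                      ≡⟨ cong (𝔽._+ Y) (𝔽.*-identityʳ t) ⟨
        t 𝔽.* 𝔽.1# 𝔽.+ Y                             ≡⟨ cong (λ z → t 𝔽.* z 𝔽.+ Y) (coeff-lead g) ⟨
        t 𝔽.* coeff G m 𝔽.+ Y                        ≡⟨ cong (𝔽._+ Y) (coeff-· t G m) ⟨
        coeff (t · G) m 𝔽.+ Y                        ≡⟨ coeff-+ (t · G) (𝔽.0# ∷ h * G) m ⟨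
        coeff ((t ∷ h) * G) m                        ∎
        where
        X = coeff (x ∷ a) m
        Y = coeff (𝔽.0# ∷ h * G) m

  zero? : ∀ a → Dec (∀ n → coeff a n ≡ 𝔽.0#)
  zero? [] = yes (λ _ → refl)
  zero? (x ∷ a) with x ≟ 𝔽.0# | zero? a
  ... | no x≢0  | _       = no (λ z → x≢0 (z 0))
  ... | yes _   | no a≢0  = no (λ z → a≢0 (z ∘ suc))
  ... | yes x≡0 | yes a≡0 = yes λ where
    zero    → x≡0
    (suc n) → a≡0 n

  private
    module 𝔽+ = GroupProperties 𝔽.+-group

    coeff-neg : ∀ a n → coeff (List.map 𝔽.-_ a) n ≡ 𝔽.- coeff a n
    coeff-neg []      n       = ≡.sym 𝔽+.ε⁻¹≈ε
    coeff-neg (x ∷ a) zero    = refl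
    coeff-neg (x ∷ a) (suc n) = coeff-neg a n

    coeff-∸ : ∀ a b n → coeff (a + List.map 𝔽.-_ b) n ≡ coeff a n 𝔽.- coeff b n
    coeff-∸ a b n = ≡.trans (coeff-+ a _ n) (cong (coeff a n 𝔽.+_) (coeff-neg b n))

  infix 4 _≈?_
  _≈?_ : ∀ a b → Dec (a ≈ b)
  a ≈? b = map′ to from (zero? (a + List.map 𝔽.-_ b))
    where
    to : (∀ n → coeff (a + List.map 𝔽.-_ b) n ≡ 𝔽.0#) → a ≈ b
    to z n = 𝔽+.x∙y⁻¹≈ε⇒x≈y _ _ (≡.trans (≡.sym (coeff-∸ a b n)) (z n))
    from : a ≈ b → ∀ n → coeff (a + List.map 𝔽.-_ b) n ≡ 𝔽.0#
    from eq n = ≡.trans (coeff-∸ a b n) (𝔽+.x≈y⇒x∙y⁻¹≈ε (eq n))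

  _≡?_[mod_] : ∀ a b g → Dec (a ≡ b [mod g ])
  a ≡? b [mod g ] with divide g (a + List.map 𝔽.-_ b)
  ... | h , agree = map′ (λ eq → h , eq) from (a ≈? b + h * toPoly g)
    where
    open ≡-Reasoning
    G = toPoly g
    from : a ≡ b [mod g ] → a ≈ b + h * G
    from (k , eq) n = begin
      coeff a n                          ≡⟨ eq n ⟩
      coeff (b + k * G) n                ≡⟨ coeff-+ b (k * G) n ⟩
      coeff b n 𝔽.+ coeff (k * G) n      ≡⟨ cong (coeff b n 𝔽.+_) (multiples-unique g k h above n) ⟩
      coeff b n 𝔽.+ coeff (h * G) n      ≡⟨ coeff-+ b (h * G) n ⟨
      coeff (b + h * G) n                ∎
      where
      above : AgreeAbove g (k * G) (h * G)
      above n m≤n = begin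
        coeff (k * G) n                                            ≡⟨ 𝔽.+-identityˡ _ ⟨
        𝔽.0# 𝔽.+ coeff (k * G) n                                   ≡⟨ 𝔽.+-congʳ (𝔽.-‿inverseˡ (coeff b n)) ⟨
        𝔽.- coeff b n 𝔽.+ coeff b n 𝔽.+ coeff (k * G) n            ≡⟨ 𝔽.+-assoc _ _ _ ⟩
        𝔽.- coeff b n 𝔽.+ (coeff b n 𝔽.+ coeff (k * G) n)          ≡⟨ cong (𝔽.- coeff b n 𝔽.+_) (≡.trans (eq n) (coeff-+ b (k * G) n)) ⟨
        𝔽.- coeff b n 𝔽.+ coeff a n                                ≡⟨ 𝔽.+-comm _ _ ⟩
        coeff a n 𝔽.- coeff b n                                    ≡⟨ coeff-∸ a b n ⟨
        coeff (a + List.map 𝔽.-_ b) n                              ≡⟨ agree n m≤n ⟩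
        coeff (h * G) n                                            ∎

------------------------------------------------------------------------
-- Laurent series in 1/T

module LaurentSeries {f p η} (F : FiniteField f p η) where
  open FiniteField F using () renaming (Carrier to 𝔽)
  open Polynomials F using (Poly; Monic; deg; toPoly; coeff)
  private
    module 𝔽 = CommutativeRing (FiniteField.commutativeRing F)

  -- digit n is the coefficient of T^(top - n).  The digit at 0 may vanish.
  record Laurent : Set f where
    constructor laurent
    field
      top   : ℤ
      digit : ℕ → 𝔽
  open Laurent public

  [T^_]_ : ℤ → Laurent → 𝔽
  [T^ j ] α with top α ℤ.- j
  ... | + n      = digit α n
  ... | -[1+ _ ] = 𝔽.0#

  fromPoly : Poly → Laurent
  fromPoly a = laurent (List.length a ℤ.⊖ 1) (coeff (List.reverse a))

  infixl 7 _*_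
  _*_ : Laurent → Laurent → Laurent
  α * β = laurent (top α ℤ.+ top β)
    (λ n → List.foldr (λ i s → digit α i 𝔽.* digit β (n ℕ.∸ i) 𝔽.+ s) 𝔽.0# (List.upTo (suc n)))

  -- For g = T^m (1 + g₁ T⁻¹ + g₂ T⁻² + …), the digits bₙ, …, b₀ of
  -- 1/g = T^(-m) (b₀ + b₁ T⁻¹ + …): b₀ = 1 and bₙ₊₁ = - ∑_{i ≤ n} gᵢ₊₁ bₙ₋ᵢ.
  inverseDigits : Monic → (n : ℕ) → Vec 𝔽 (suc n)
  inverseDigits g zero    = 𝔽.1# ∷ []
  inverseDigits g (suc n) = 𝔽.- Vec.foldr′ 𝔽._+_ 𝔽.0# (Vec.zipWith 𝔽._*_ gs bs) ∷ bs
    where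
    bs = inverseDigits g n
    gs = Vec.tabulate (λ i → digit (fromPoly (toPoly g)) (suc (toℕ i)))

  1/_ : Monic → Laurent
  1/ g = laurent (ℤ.- (+ deg g)) (λ n → Vec.head (inverseDigits g n))

  infixl 7 _/_
  _/_ : Poly → Monic → Laurent
  a / g = fromPoly a * 1/ g

------------------------------------------------------------------------
-- The series 𝒵 and 𝒟₁

module GeneratingSeries {c ℓ₁ ℓ₂ f p η} (R : CompleteOrderedField c ℓ₁ ℓ₂)
  (π : CompleteOrderedField.Carrier R) (F : FiniteField f p η) where
  open Complex R public
  open FiniteField F public
    using (Tr; residue; units) renaming (Carrier to 𝔽; 0# to 0F; -_ to infix 8 -F_)
  open Polynomials F public
    using (Poly; Monic; deg; toPoly; monics; _·_; _≡?_[mod_]) renaming (_*_ to infixl 7 _*ₚ_)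
  open LaurentSeries F using (Laurent; [T^_]_; _/_)
  private
    module ℝ = Real R

  q : ℂ
  q = fromℕ (FiniteField.q F)

  e_q : 𝔽 → ℂ
  e_q y = exp (ℝ.0# +i ℝ.fromℕ 2 ℝ.* π ℝ.* ℝ.fromℕ (residue (Tr y)) ℝ.* ℝ.fromℕ p ℝ.⁻¹)

  e : Laurent → ℂ
  e α = e_q ([T^ ℤ.-1ℤ ] α)

  -- The sums over all monic f are ordered by degree: the n-th term collects the
  -- f of degree n.
  𝒵 : Poly → Monic → ℂ → ℕ → ℂ
  𝒵 a g u n = ∑[ f ∈ List.filter (λ f → toPoly f ≡? a [mod g ]) (monics n) ] u ^ deg f

  𝒟₁ : Poly → Monic → ℂ → ℕ → ℂ
  𝒟₁ a g u n = ∑[ f ∈ monics n ] e (a *ₚ toPoly f / g) * u ^ deg f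

  infix 4 _Continues_
  _Continues_ : RationalFunction → (ℂ → ℕ → ℂ) → Set (c ⊔ ℓ₁ ⊔ ℓ₂)
  r Continues series = r Continues series OnDisc (ℝ.fromℕ (FiniteField.q F) ℝ.⁻¹)

{-# OPTIONS --safe #-}

-- For f monic of degree n with coefficients fᵢ, the coefficient of T⁻¹ in b f / g is ∑ fᵢ cᵢ,
-- where cᵢ is the coefficient of T⁻¹ in b Tⁱ / g.  Hence ∑ e(b f / g) over these f factors as
-- e_q(cₙ) ∏_{i<n} ∑ₓ e_q(x cᵢ), and each factor of the product is q or 0 according to whether cᵢ
-- vanishes.  Write m = deg g and let r be the remainder of b modulo g.  If r = 0, all cᵢ vanish
-- and 𝒟₁(v; b/g) = 1/(1 - q v).  If r has degree d and leading coefficient ρ, the first nonzero cᵢ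
-- is cₖ = ρ with k = m - 1 - d, and 𝒟₁(v; b/g) = ∑_{n<k} (q v)ⁿ + e_q(ρ) (q v)ᵏ.  On the other
-- side, a residue class modulo g contains q^(n-m) monic polynomials of degree n ≥ m, and in degree
-- n < m only its reduced representative if that is monic of degree n, so that
-- 𝒵(u; a, g) = [ρ = 1] uᵈ + uᵐ/(1 - q u), where the first term is absent if r = 0.  Both sides of
-- the identity are then explicit, and the sums over λ are sums of e_q over the field.
--
-- That e_q is a nontrivial additive character rests on the functional equation of exp, on the
-- trace being a nonzero map to the prime field, and on the minimality of π, which gives
-- exp(2πi/p) ≠ 1.  Continuations are unique because a polynomial has finitely many roots.
module Submission where

open import Defs
open import Algebra.Bundles using (CommutativeMonoid; CommutativeRing; Monoid)
import Algebra.Properties.CommutativeMonoid.Sum as MonoidSum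
import Algebra.Properties.CommutativeSemiring.Binomial as Binomial
import Algebra.Properties.CommutativeSemiring.Exp as CommutativeSemiringExp
import Algebra.Properties.Monoid.Mult as MonoidMult
import Algebra.Properties.Ring as RingProperties
import Algebra.Properties.Semiring.Exp as SemiringExp
import Algebra.Properties.Semiring.Mult as SemiringMult
import Algebra.Solver.Ring as RingSolver
open import Algebra.Solver.Ring.AlmostCommutativeRing
  using (fromCommutativeRing; _-Raw-AlmostCommutative⟶_)
open import Algebra.Structures using (IsCommutativeRing)
open import Data.Fin.Base as Fin using (Fin; zero; suc; toℕ)
open import Data.Fin.Permutation using (permutation)
import Data.Fin.Properties as Fin
open import Data.Integer.Base as ℤ using (ℤ; +_; -[1+_]; _⊖_)
import Data.Integer.Properties as ℤ
open import Data.List.Base as List using (List; []; _∷_)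
import Data.List.Properties as List
open import Data.List.Relation.Unary.All as All using (All; []; _∷_)
import Data.List.Relation.Unary.All.Properties as All
open import Data.List.Relation.Unary.AllPairs using (AllPairs; []; _∷_)
import Data.List.Relation.Unary.AllPairs.Properties as AllPairs
open import Data.List.Relation.Unary.Any using (Any; here)
open import Data.Maybe.Base using (Maybe; just; nothing)
open import Data.Nat.Base as ℕ using (ℕ; zero; suc; NonZero)
open import Data.Nat.Combinatorics
  using (nCn≡1; nCk≡n!/k![n-k]!; k![n∸k]!∣n!) renaming (_C_ to _choose_)
open import Data.Nat.Coprimality using (Coprime; coprime-Bézout; prime⇒coprime)
open import Data.Nat.DivMod using (_%_; _/_; m≡m%n+[m/n]*n; m%n<n; m/n*n≡m)
open import Data.Nat.Divisibility using (_∣_; divides; ∣⇒≤; m∣m*n; m%n≡0⇒n∣m; ∣1⇒≡1)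
open import Data.Nat.GCD using (module Bézout)
open import Data.Nat.Primality using (Prime; euclidsLemma; prime⇒nonZero; prime⇒nonTrivial)
import Data.Nat.Properties as ℕ
open import Data.Product.Base using (_×_; ∃-syntax; _,_; proj₁; proj₂)
open import Data.Sum.Base as Sum using (_⊎_; inj₁; inj₂)
open import Data.Vec.Base as Vec using (Vec; []; _∷_)
import Data.Vec.Properties as Vec
open import Function.Base using (_∘_)
open import Function.Bundles using (_↔_; Inverse)
open import Level using (_⊔_)
open import Relation.Binary.Definitions using (tri<; tri≈; tri>)
open import Relation.Binary.PropositionalEquality as ≡ using (_≡_; _≢_; cong; module ≡-Reasoning)
import Relation.Binary.Reasoning.Setoid as SetoidReasoning
import Relation.Binary.Reasoning.StrictPartialOrder as StrictReasoning
import Relation.Binary.Reflection as Reflection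
open import Relation.Nullary using (¬_; ¬?; Dec; yes; no; contradiction)

-- The shape of the numbers cᵢ comes from one sequence: for m > 0 the coefficient `B j` of T⁻¹ in
-- Tʲ/g is 0 for j < m - 1 and 1 for j = m - 1, and g, with T acting as the shift, annihilates `B`,
-- because g Tⁿ/g is a polynomial. So cᵢ depends on r only, and its first nonzero value is the
-- leading coefficient of r times that 1. Replacing b by λb scales all cᵢ and keeps k. At v = 1/(q
-- u) one has q v = 1/u, and for r ≠ 0 the prefactor is u^(m-1) = uᵏ uᵈ: uᵏ clears the powers of
-- 1/u. In the kernel, e_q(-λ) detects ρ = 1 by orthogonality. Inverses are total and continuations
-- are fractions not in lowest terms. Fractions are therefore compared by cross-multiplication, as
-- polynomials, and divided only where the denominators are known not to vanish. Analysis is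
-- confined to the exponential. Its functional equation needs the part of a product of partial sums
-- outside the triangle to vanish in the limit, for which the real majorants Bᵏ/k! suffice. All
-- character sums are computed over an arbitrary ring with a nontrivial p-th root of unity.

-- Equations in commutative rings, with integer constants

-- Ring expressions with integer constants, independent of the ring in which they
-- are interpreted, so that one syntax serves ℝ, ℂ and 𝔽.
infix  8 :-_
infixl 7 _:*_
infixl 6 _:+_ _:-_

data Expression (n : ℕ) : Set where
  var            : Fin n → Expression n
  con            : ℤ → Expression n
  -- `con (+ 1)` is interpreted as `1# + 0#`; this constructor stands for a literal `1#` in a goal.
  :1             : Expression n
  :-_            : Expression n → Expression n
  _:+_ _:*_ _:-_ : Expression n → Expression n → Expression n

infix 4 _:=_
_:=_ : ∀ {n} → Expression n → Expression n → Expression n × Expression n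
_:=_ = _,_

module IntegerSolver {c ℓ} (R : CommutativeRing c ℓ) where
  open CommutativeRing R
  open RingProperties ring
  open SemiringMult semiring using (×-homo-+; ×1-homo-*) renaming (_×_ to _⊗_)
  open SetoidReasoning setoid

  ⟦_⟧ : ℤ → Carrier
  ⟦ + n ⟧      = n ⊗ 1#
  ⟦ -[1+ n ] ⟧ = - (suc n ⊗ 1#)

  private
    cancel-1 : ∀ x y → x - y ≈ 1# + x - (1# + y)
    cancel-1 x y = begin
      x - y  ≈⟨ +-identityˡ _ ⟨
      0# + (x - y)  ≈⟨ +-congʳ (-‿inverseʳ 1#) ⟨
      1# - 1# + (x - y)  ≈⟨ +-assoc 1# _ _ ⟩
      1# + (- 1# + (x - y))  ≈⟨ +-congˡ (+-assoc _ x _) ⟨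
      1# + (- 1# + x - y)  ≈⟨ +-congˡ (+-congʳ (+-comm _ x)) ⟩
      1# + (x - 1# - y)  ≈⟨ +-congˡ (+-assoc x _ _) ⟩
      1# + (x + (- 1# - y))  ≈⟨ +-congˡ (+-congˡ (-‿+-comm 1# y)) ⟩
      1# + (x - (1# + y))  ≈⟨ +-assoc 1# x _ ⟨
      1# + x - (1# + y)  ∎

    ⊖-homo : ∀ m n → ⟦ m ⊖ n ⟧ ≈ m ⊗ 1# - n ⊗ 1#
    ⊖-homo m       zero    = sym (trans (+-congˡ -0#≈0#) (+-identityʳ _))
    ⊖-homo zero    (suc n) = sym (+-identityˡ _)
    ⊖-homo (suc m) (suc n) = begin
      ⟦ suc m ⊖ suc n ⟧  ≡⟨ cong ⟦_⟧ (ℤ.[1+m]⊖[1+n]≡m⊖n m n) ⟩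
      ⟦ m ⊖ n ⟧  ≈⟨ ⊖-homo m n ⟩
      m ⊗ 1# - n ⊗ 1#  ≈⟨ cancel-1 _ _ ⟩
      suc m ⊗ 1# - suc n ⊗ 1#  ∎

    -‿homo : ∀ i → ⟦ ℤ.- i ⟧ ≈ - ⟦ i ⟧
    -‿homo (+ zero)  = sym -0#≈0#
    -‿homo (+ suc n) = refl
    -‿homo -[1+ n ]  = sym (-‿involutive _)

    +-homo : ∀ i j → ⟦ i ℤ.+ j ⟧ ≈ ⟦ i ⟧ + ⟦ j ⟧
    +-homo (+ m)    (+ n)    = ×-homo-+ 1# m n
    +-homo (+ m)    -[1+ n ] = ⊖-homo m (suc n)
    +-homo -[1+ m ] (+ n)    = trans (⊖-homo n (suc m)) (+-comm _ _)
    +-homo -[1+ m ] -[1+ n ] = begin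
      - (suc (suc (m ℕ.+ n)) ⊗ 1#)  ≡⟨ cong (λ k → - (k ⊗ 1#)) (ℕ.+-suc (suc m) n) ⟨
      - ((suc m ℕ.+ suc n) ⊗ 1#)  ≈⟨ -‿cong (×-homo-+ 1# (suc m) (suc n)) ⟩
      - (suc m ⊗ 1# + suc n ⊗ 1#)  ≈⟨ -‿+-comm _ _ ⟨
      - (suc m ⊗ 1#) + - (suc n ⊗ 1#)  ∎

    +*-homo : ∀ m j → ⟦ + m ℤ.* j ⟧ ≈ ⟦ + m ⟧ * ⟦ j ⟧
    +*-homo m (+ n) = begin
      ⟦ + m ℤ.* + n ⟧  ≡⟨ cong ⟦_⟧ (ℤ.pos-* m n) ⟨
      (m ℕ.* n) ⊗ 1#  ≈⟨ ×1-homo-* m n ⟩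
      m ⊗ 1# * n ⊗ 1#  ∎
    +*-homo m -[1+ n ] = begin
      ⟦ + m ℤ.* ℤ.- (+ suc n) ⟧  ≡⟨ cong ⟦_⟧ (ℤ.neg-distribʳ-* (+ m) (+ suc n)) ⟨
      ⟦ ℤ.- (+ m ℤ.* + suc n) ⟧  ≈⟨ -‿homo (+ m ℤ.* + suc n) ⟩
      - ⟦ + m ℤ.* + suc n ⟧  ≈⟨ -‿cong (+*-homo m (+ suc n)) ⟩
      - (⟦ + m ⟧ * ⟦ + suc n ⟧)  ≈⟨ -‿distribʳ-* _ _ ⟩
      ⟦ + m ⟧ * - ⟦ + suc n ⟧  ∎

    *-homo : ∀ i j → ⟦ i ℤ.* j ⟧ ≈ ⟦ i ⟧ * ⟦ j ⟧
    *-homo (+ m)    j = +*-homo m j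
    *-homo -[1+ m ] j = begin
      ⟦ ℤ.- (+ suc m) ℤ.* j ⟧  ≡⟨ cong ⟦_⟧ (ℤ.neg-distribˡ-* (+ suc m) j) ⟨
      ⟦ ℤ.- (+ suc m ℤ.* j) ⟧  ≈⟨ -‿homo (+ suc m ℤ.* j) ⟩
      - ⟦ + suc m ℤ.* j ⟧  ≈⟨ -‿cong (+*-homo (suc m) j) ⟩
      - (⟦ + suc m ⟧ * ⟦ j ⟧)  ≈⟨ -‿distribˡ-* _ _ ⟩
      - ⟦ + suc m ⟧ * ⟦ j ⟧  ∎

    morphism : CommutativeRing.rawRing ℤ.+-*-commutativeRing -Raw-AlmostCommutative⟶ fromCommutativeRing R
    morphism = record
      { ⟦_⟧    = ⟦_⟧
      ; +-homo = +-homo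
      ; *-homo = *-homo
      ; -‿homo = -‿homo
      ; 0-homo = refl
      ; 1-homo = +-identityʳ 1#
      }

    _≟_ : ∀ i j → Maybe (⟦ i ⟧ ≈ ⟦ j ⟧)
    i ≟ j with i ℤ.≟ j
    ... | yes ≡.refl = just refl
    ... | no _       = nothing

    module Solver = RingSolver (CommutativeRing.rawRing ℤ.+-*-commutativeRing) (fromCommutativeRing R) morphism _≟_

    translate : ∀ {n} → Expression n → Solver.Polynomial n
    translate (var i)  = Solver.var i
    translate (con k)  = Solver.con k
    translate :1       = Solver.con (+ 1)
    translate (:- e)   = Solver.:- translate e
    translate (d :+ e) = translate d Solver.:+ translate e
    translate (d :* e) = translate d Solver.:* translate e
    translate (d :- e) = translate d Solver.:- translate e

    interpret : ∀ {n} → Expression n → Vec Carrier n → Carrier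
    interpret (var i)  ρ = Vec.lookup ρ i
    interpret (con k)  ρ = ⟦ k ⟧
    interpret :1       ρ = 1#
    interpret (:- e)   ρ = - interpret e ρ
    interpret (d :+ e) ρ = interpret d ρ + interpret e ρ
    interpret (d :* e) ρ = interpret d ρ * interpret e ρ
    interpret (d :- e) ρ = interpret d ρ - interpret e ρ

    normalised : ∀ {n} → Expression n → Vec Carrier n → Carrier
    normalised e = Solver.⟦ translate e ⟧↓

    interpret-translate : ∀ {n} (e : Expression n) ρ → Solver.⟦ translate e ⟧ ρ ≈ interpret e ρ
    interpret-translate (var i)  ρ = refl
    interpret-translate (con k)  ρ = refl
    interpret-translate :1       ρ = +-identityʳ 1#
    interpret-translate (:- e)   ρ = -‿cong (interpret-translate e ρ)
    interpret-translate (d :+ e) ρ = +-cong (interpret-translate d ρ) (interpret-translate e ρ)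
    interpret-translate (d :* e) ρ = *-cong (interpret-translate d ρ) (interpret-translate e ρ)
    interpret-translate (d :- e) ρ = +-cong (interpret-translate d ρ) (-‿cong (interpret-translate e ρ))

    correct : ∀ {n} (e : Expression n) ρ → normalised e ρ ≈ interpret e ρ
    correct e ρ = trans (Solver.correct (translate e) ρ) (interpret-translate e ρ)

  open Reflection setoid var interpret normalised correct public using (solve)

-- Polynomials as coefficient lists, and the number of their roots

module ListPolynomials {c ℓ} (R : CommutativeRing c ℓ) where
  open CommutativeRing R
  open RingProperties ring
  open IntegerSolver R
  open SetoidReasoning setoid

  eval : List Carrier → Carrier → Carrier
  eval []       x = 0#
  eval (a ∷ as) x = a + x * eval as x

  eval-zero : ∀ {P} → All (_≈ 0#) P → ∀ x → eval P x ≈ 0#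
  eval-zero []           x = refl
  eval-zero (a≈0 ∷ as≈0) x =
    trans (+-cong a≈0 (trans (*-congˡ (eval-zero as≈0 x)) (zeroʳ x))) (+-identityʳ 0#)

  infixl 6 _⊞_
  _⊞_ : List Carrier → List Carrier → List Carrier
  []       ⊞ bs       = bs
  (a ∷ as) ⊞ []       = a ∷ as
  (a ∷ as) ⊞ (b ∷ bs) = a + b ∷ as ⊞ bs

  eval-⊞ : ∀ as bs x → eval (as ⊞ bs) x ≈ eval as x + eval bs x
  eval-⊞ []       bs       x = sym (+-identityˡ _)
  eval-⊞ (a ∷ as) []       x = sym (+-identityʳ _)
  eval-⊞ (a ∷ as) (b ∷ bs) x = begin
    a + b + x * eval (as ⊞ bs) x  ≈⟨ +-congˡ (*-congˡ (eval-⊞ as bs x)) ⟩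
    a + b + x * (eval as x + eval bs x)  ≈⟨ solve 5 (λ a b x A B → a :+ b :+ x :* (A :+ B) := a :+ x :* A :+ (b :+ x :* B)) refl a b x _ _ ⟩
    a + x * eval as x + (b + x * eval bs x)  ∎

  eval-map : ∀ a bs x → eval (List.map (a *_) bs) x ≈ a * eval bs x
  eval-map a []       x = sym (zeroʳ a)
  eval-map a (b ∷ bs) x = begin
    a * b + x * eval (List.map (a *_) bs) x  ≈⟨ +-congˡ (*-congˡ (eval-map a bs x)) ⟩
    a * b + x * (a * eval bs x)  ≈⟨ solve 4 (λ a b x B → a :* b :+ x :* (a :* B) := a :* (b :+ x :* B)) refl a b x _ ⟩
    a * (b + x * eval bs x)  ∎

  infixl 7 _⊠_
  _⊠_ : List Carrier → List Carrier → List Carrier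
  []       ⊠ bs = []
  (a ∷ as) ⊠ bs = List.map (a *_) bs ⊞ (0# ∷ as ⊠ bs)

  eval-⊠ : ∀ as bs x → eval (as ⊠ bs) x ≈ eval as x * eval bs x
  eval-⊠ []       bs x = sym (zeroˡ _)
  eval-⊠ (a ∷ as) bs x = begin
    eval (List.map (a *_) bs ⊞ (0# ∷ as ⊠ bs)) x  ≈⟨ eval-⊞ (List.map (a *_) bs) (0# ∷ as ⊠ bs) x ⟩
    eval (List.map (a *_) bs) x + (0# + x * eval (as ⊠ bs) x) ≈⟨ +-cong (eval-map a bs x) (+-congˡ (*-congˡ (eval-⊠ as bs x))) ⟩
    a * eval bs x + (0# + x * (eval as x * eval bs x))  ≈⟨ solve 4 (λ a x A B → a :* B :+ (con (+ 0) :+ x :* (A :* B)) := (a :+ x :* A) :* B) refl a x _ _ ⟩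
    (a + x * eval as x) * eval bs x  ∎

  -- Horner's scheme: the values at r of the successive tails of P are the coefficients of the
  -- quotient of X P by X - r. Dividing X P keeps the induction free of a special constant term; for
  -- `P = a ∷ as` the quotient of P - P(r) by X - r is then `synthetic r as`.
  synthetic : Carrier → List Carrier → List Carrier
  synthetic r []       = []
  synthetic r (a ∷ as) = eval (a ∷ as) r ∷ synthetic r as

  length-synthetic : ∀ r P → List.length (synthetic r P) ≡ List.length P
  length-synthetic r []       = ≡.refl
  length-synthetic r (a ∷ as) = cong suc (length-synthetic r as)

  eval-synthetic : ∀ r P x → x * eval P x ≈ r * eval P r + (x - r) * eval (synthetic r P) x
  eval-synthetic r []       x = solve 2 (λ x r → x :* con (+ 0) := r :* con (+ 0) :+ (x :- r) :* con (+ 0)) refl x r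
  eval-synthetic r (a ∷ as) x = begin
    x * (a + x * A)  ≈⟨ *-congˡ (+-congˡ (eval-synthetic r as x)) ⟩
    x * (a + (r * B + (x - r) * C))  ≈⟨ solve 5 (λ x r a B C →
        x :* (a :+ (r :* B :+ (x :- r) :* C)) :=
        r :* (a :+ r :* B) :+ (x :- r) :* (a :+ r :* B :+ x :* C)) refl x r a B C ⟩
    r * (a + r * B) + (x - r) * (a + r * B + x * C)  ∎
    where
    A = eval as x
    B = eval as r
    C = eval (synthetic r as) x

  synthetic-zero : ∀ r {P} → All (_≈ 0#) (synthetic r P) → All (_≈ 0#) P
  synthetic-zero r {[]}     []           = []
  synthetic-zero r {a ∷ as} (v≈0 ∷ vs≈0) with synthetic-zero r vs≈0
  ... | as≈0 = (begin
    a  ≈⟨ +-identityʳ a ⟨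
    a + 0#  ≈⟨ +-congˡ (trans (*-congˡ (eval-zero as≈0 r)) (zeroʳ r)) ⟨
    a + r * eval as r ≈⟨ v≈0 ⟩
    0#  ∎) ∷ as≈0

  module Domain (domain : ∀ x y → x * y ≈ 0# → x ≈ 0# ⊎ y ≈ 0#) where

    -- Dividing by X - r leaves the remaining roots as roots of the quotient, since s - r is nonzero
    -- in a domain. The number of roots is compared with the length of the list and not with a
    -- degree, so trailing zeros do no harm.
    roots⇒zero : ∀ P rs → List.length P ℕ.≤ List.length rs → AllPairs (λ x y → ¬ x ≈ y) rs →
                 All (λ r → eval P r ≈ 0#) rs → All (_≈ 0#) P
    roots⇒zero []       _        _          _              _              = []
    roots⇒zero (a ∷ as) (r ∷ rs) (ℕ.s≤s le) (r∉rs ∷ rs-distinct) (Pr≈0 ∷ Prs≈0) =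
      a≈0 ∷ as≈0
      where
      quotient-roots : ∀ {rs} → All (λ s → ¬ r ≈ s) rs → All (λ s → eval (a ∷ as) s ≈ 0#) rs →
                       All (λ s → eval (synthetic r as) s ≈ 0#) rs
      quotient-roots []               []             = []
      quotient-roots {s ∷ _} (r≉s ∷ r∉) (Ps≈0 ∷ Prs) = root ∷ quotient-roots r∉ Prs
        where
        product≈0 : (s - r) * eval (synthetic r as) s ≈ 0#
        product≈0 = begin
          (s - r) * Q  ≈⟨ solve 4 (λ a X D Q → D :* Q := (a :+ (X :+ D :* Q)) :- (a :+ X)) refl a (r * eval as r) (s - r) Q ⟩
          (a + (r * eval as r + (s - r) * Q)) - (a + r * eval as r) ≈⟨ +-congʳ (+-congˡ (eval-synthetic r as s)) ⟨
          (a + s * eval as s) - (a + r * eval as r)  ≈⟨ +-cong Ps≈0 (-‿cong Pr≈0) ⟩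
          0# - 0#  ≈⟨ -‿inverseʳ 0# ⟩
          0#  ∎
          where Q = eval (synthetic r as) s
        root : eval (synthetic r as) s ≈ 0#
        root with domain (s - r) (eval (synthetic r as) s) product≈0
        ... | inj₂ Q≈0   = Q≈0
        ... | inj₁ s-r≈0 = contradiction (sym (x∙y⁻¹≈ε⇒x≈y s r s-r≈0)) r≉s

      as≈0 : All (_≈ 0#) as
      as≈0 = synthetic-zero r
        (roots⇒zero (synthetic r as) rs
          (ℕ.≤-trans (ℕ.≤-reflexive (length-synthetic r as)) le)
          rs-distinct (quotient-roots r∉rs Prs≈0))

      a≈0 : a ≈ 0#
      a≈0 = begin
        a  ≈⟨ +-identityʳ a ⟨
        a + 0#  ≈⟨ +-congˡ (trans (*-congˡ (eval-zero as≈0 r)) (zeroʳ r)) ⟨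
        a + r * eval as r ≈⟨ Pr≈0 ⟩
        0#  ∎

-- Finite sums and Cauchy products

module CauchyProduct {c ℓ} (R : CommutativeRing c ℓ) where
  open CommutativeRing R
  open IntegerSolver R
  open SemiringMult semiring using (×-homo-+; ×-congˡ) renaming (_×_ to _⊗_)
  open SetoidReasoning setoid

  Σ< : (ℕ → Carrier) → ℕ → Carrier
  Σ< a zero    = 0#
  Σ< a (suc n) = Σ< a n + a n

  Σ<-cong : ∀ {a b} → (∀ n → a n ≈ b n) → ∀ n → Σ< a n ≈ Σ< b n
  Σ<-cong a≈b zero    = refl
  Σ<-cong a≈b (suc n) = +-cong (Σ<-cong a≈b n) (a≈b n)

  Σ<-suc : ∀ a n → Σ< a (suc n) ≈ a 0 + Σ< (a ∘ suc) n
  Σ<-suc a zero    = +-comm 0# (a 0)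
  Σ<-suc a (suc n) = trans (+-congʳ (Σ<-suc a n)) (+-assoc _ _ _)

  Σ<-cong-< : ∀ {a b} n → (∀ k → k ℕ.< n → a k ≈ b k) → Σ< a n ≈ Σ< b n
  Σ<-cong-< zero    a≈b = refl
  Σ<-cong-< (suc n) a≈b = +-cong (Σ<-cong-< n (λ k k<n → a≈b k (ℕ.m<n⇒m<1+n k<n))) (a≈b n (ℕ.n<1+n n))

  Σ<-zero : ∀ {a} n → (∀ k → k ℕ.< n → a k ≈ 0#) → Σ< a n ≈ 0#
  Σ<-zero zero    a≈0 = refl
  Σ<-zero (suc n) a≈0 = trans
    (+-cong (Σ<-zero n (λ k k<n → a≈0 k (ℕ.m<n⇒m<1+n k<n))) (a≈0 n (ℕ.n<1+n n))) (+-identityʳ 0#)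

  Σ<-single : ∀ {a} n d → d ℕ.< n → (∀ k → k ℕ.< n → k ≢ d → a k ≈ 0#) → Σ< a n ≈ a d
  Σ<-single {a} (suc n) d d<1+n a≈0 with ℕ.m≤n⇒m<n∨m≡n (ℕ.≤-pred d<1+n)
  ... | inj₁ d<n = trans
    (+-cong (Σ<-single n d d<n (λ k k<n → a≈0 k (ℕ.m<n⇒m<1+n k<n))) (a≈0 n (ℕ.n<1+n n) (ℕ.<⇒≢ d<n ∘ ≡.sym)))
    (+-identityʳ (a d))
  ... | inj₂ ≡.refl = trans
    (+-congʳ (Σ<-zero n (λ k k<n → a≈0 k (ℕ.m<n⇒m<1+n k<n) (ℕ.<⇒≢ k<n)))) (+-identityˡ (a n))

  -- The Cauchy product `∑ x i * y (n - i)`. The recursion shifts `x` and so avoids subtraction of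
  -- indices.
  conv : (ℕ → Carrier) → (ℕ → Carrier) → ℕ → Carrier
  conv x y zero    = x 0 * y 0
  conv x y (suc n) = x 0 * y (suc n) + conv (x ∘ suc) y n

  Σ<-conv-suc : ∀ x y n → Σ< (conv x y) (suc n) ≈ x 0 * Σ< y (suc n) + Σ< (conv (x ∘ suc) y) n
  Σ<-conv-suc x y zero = solve 2 (λ x y → con (+ 0) :+ x :* y := x :* (con (+ 0) :+ y) :+ con (+ 0)) refl (x 0) (y 0)
  Σ<-conv-suc x y (suc n) = begin
    Σ< (conv x y) (suc n) + (x 0 * y (suc n) + C′)  ≈⟨ +-congʳ (Σ<-conv-suc x y n) ⟩
    x 0 * Y + C + (x 0 * y (suc n) + C′)  ≈⟨ solve 5 (λ x Y C y′ C′ →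
        x :* Y :+ C :+ (x :* y′ :+ C′) := x :* (Y :+ y′) :+ (C :+ C′)) refl (x 0) Y C (y (suc n)) C′ ⟩
    x 0 * (Y + y (suc n)) + (C + C′)  ∎
    where
    Y  = Σ< y (suc n)
    C  = Σ< (conv (x ∘ suc) y) n
    C′ = conv (x ∘ suc) y n

  -- ∑ xᵢ yⱼ over i, j < n with n ≤ i + j.
  corner : (ℕ → Carrier) → (ℕ → Carrier) → ℕ → Carrier
  corner x y zero    = 0#
  corner x y (suc n) = corner (x ∘ suc) y n + Σ< (x ∘ suc) n * y n

  -- The square of index pairs below n is the triangle i + j < n together with the corner.
  Σ<-* : ∀ x y n → Σ< x n * Σ< y n ≈ Σ< (conv x y) n + corner x y n
  Σ<-* x y zero    = solve 0 (con (+ 0) :* con (+ 0) := con (+ 0) :+ con (+ 0)) refl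
  Σ<-* x y (suc n) = begin
    Σ< x (suc n) * Σ< y (suc n)  ≈⟨ *-congʳ (Σ<-suc x n) ⟩
    (x 0 + X) * (Y + y n)  ≈⟨ solve 4 (λ x X Y y →
        (x :+ X) :* (Y :+ y) := x :* (Y :+ y) :+ (X :* Y :+ X :* y)) refl (x 0) X Y (y n) ⟩
    x 0 * (Y + y n) + (X * Y + X * y n)  ≈⟨ +-congˡ (+-congʳ (Σ<-* (x ∘ suc) y n)) ⟩
    x 0 * (Y + y n) + (C + D + X * y n)  ≈⟨ solve 4 (λ A C D E → A :+ (C :+ D :+ E) := A :+ C :+ (D :+ E)) refl _ C D _ ⟩
    x 0 * (Y + y n) + C + (D + X * y n)  ≈⟨ +-congʳ (Σ<-conv-suc x y n) ⟨
    Σ< (conv x y) (suc n) + corner x y (suc n)  ∎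
    where
    X = Σ< (x ∘ suc) n
    Y = Σ< y n
    C = Σ< (conv (x ∘ suc) y) n
    D = corner (x ∘ suc) y n

  ν : ℕ → Carrier
  ν n = n ⊗ 1#

  module _ {z w : Carrier} {y : ℕ → Carrier} (y-suc : ∀ n → ν (suc n) * y (suc n) ≈ w * y n) where

    -- The sum of (s + i + j) xᵢ yⱼ over i + j = n + 1, with the weights s + i and j treated apart.
    weighted-conv-suc : ∀ {x} s → (∀ i → ν (suc (i ℕ.+ s)) * x (suc i) ≈ z * x i) → ∀ n →
      ν (suc n ℕ.+ s) * conv x y (suc n) ≈ ν s * (x 0 * y (suc n)) + (z + w) * conv x y n
    weighted-conv-suc {x} s x-suc zero = begin
      (1# + ν s) * (x 0 * y 1 + x 1 * y 0)
        ≈⟨ solve 6 (λ N x₀ x₁ y₀ y₁ O → (O :+ N) :* (x₀ :* y₁ :+ x₁ :* y₀) :=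
            N :* (x₀ :* y₁) :+ ((O :+ N) :* x₁ :* y₀ :+ x₀ :* ((O :+ con (+ 0)) :* y₁)))
            refl (ν s) (x 0) (x 1) (y 0) (y 1) 1# ⟩
      ν s * (x 0 * y 1) + ((1# + ν s) * x 1 * y 0 + x 0 * (ν 1 * y 1))
        ≈⟨ +-congˡ (+-cong (*-congʳ (x-suc 0)) (*-congˡ (y-suc 0))) ⟩
      ν s * (x 0 * y 1) + (z * x 0 * y 0 + x 0 * (w * y 0))
        ≈⟨ +-congˡ (solve 4 (λ z w x y → z :* x :* y :+ x :* (w :* y) := (z :+ w) :* (x :* y)) refl z w (x 0) (y 0)) ⟩
      ν s * (x 0 * y 1) + (z + w) * (x 0 * y 0) ∎
    weighted-conv-suc {x} s x-suc (suc n) = begin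
      N * (x 0 * y (suc (suc n)) + conv (x ∘ suc) y (suc n))
        ≈⟨ distribˡ N _ _ ⟩
      N * (x 0 * y (suc (suc n))) + N * conv (x ∘ suc) y (suc n)
        ≈⟨ +-cong (*-congʳ (×-homo-+ 1# (suc (suc n)) s)) shifted ⟩
      (ν (suc (suc n)) + ν s) * (x 0 * y (suc (suc n))) + (ν (suc s) * (x 1 * y (suc n)) + (z + w) * C)
        ≈⟨ solve 8 (λ M S x₀ y″ P x₁ y′ Q → (M :+ S) :* (x₀ :* y″) :+ (P :* (x₁ :* y′) :+ Q) :=
            S :* (x₀ :* y″) :+ (x₀ :* (M :* y″) :+ (P :* x₁ :* y′ :+ Q)))
            refl (ν (suc (suc n))) (ν s) (x 0) (y (suc (suc n))) (ν (suc s)) (x 1) (y (suc n)) ((z + w) * C) ⟩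
      ν s * (x 0 * y (suc (suc n))) + (x 0 * (ν (suc (suc n)) * y (suc (suc n))) + (ν (suc s) * x 1 * y (suc n) + (z + w) * C))
        ≈⟨ +-congˡ (+-cong (*-congˡ (y-suc (suc n))) (+-congʳ (*-congʳ (x-suc 0)))) ⟩
      ν s * (x 0 * y (suc (suc n))) + (x 0 * (w * y (suc n)) + (z * x 0 * y (suc n) + (z + w) * C))
        ≈⟨ +-congˡ (solve 5 (λ z w x y C → x :* (w :* y) :+ (z :* x :* y :+ (z :+ w) :* C) :=
            (z :+ w) :* (x :* y :+ C)) refl z w (x 0) (y (suc n)) C) ⟩
      ν s * (x 0 * y (suc (suc n))) + (z + w) * (x 0 * y (suc n) + C) ∎
      where
      N = ν (suc (suc n) ℕ.+ s)
      C = conv (x ∘ suc) y n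
      shifted : N * conv (x ∘ suc) y (suc n) ≈ ν (suc s) * (x 1 * y (suc n)) + (z + w) * C
      shifted = begin
        N * conv (x ∘ suc) y (suc n)  ≡⟨ cong (λ k → ν k * conv (x ∘ suc) y (suc n)) (ℕ.+-suc (suc n) s) ⟨
        ν (suc n ℕ.+ suc s) * conv (x ∘ suc) y (suc n)  ≈⟨ weighted-conv-suc (suc s)
          (λ i → trans (*-congʳ (×-congˡ (cong suc (ℕ.+-suc i s)))) (x-suc (suc i))) n ⟩
        ν (suc s) * (x 1 * y (suc n)) + (z + w) * C  ∎

    -- The recurrence (n + 1) xₙ₊₁ = z xₙ is that of zⁿ/n!, the differential equation f′ = z f read
    -- on coefficients. This is the product rule for it, and with `recurrence-unique` it takes the
    -- place of the binomial theorem.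
    conv-suc : ∀ {x} → (∀ n → ν (suc n) * x (suc n) ≈ z * x n) → ∀ n →
               ν (suc n) * conv x y (suc n) ≈ (z + w) * conv x y n
    conv-suc {x} x-suc n = begin
      ν (suc n) * conv x y (suc n)  ≡⟨ cong (λ k → ν k * conv x y (suc n)) (ℕ.+-identityʳ (suc n)) ⟨
      ν (suc n ℕ.+ 0) * conv x y (suc n)  ≈⟨ weighted-conv-suc 0
        (λ i → trans (*-congʳ (×-congˡ (cong suc (ℕ.+-identityʳ i)))) (x-suc i)) n ⟩
      0# * (x 0 * y (suc n)) + (z + w) * conv x y n  ≈⟨ +-congʳ (zeroˡ _) ⟩
      0# + (z + w) * conv x y n  ≈⟨ +-identityˡ _ ⟩
      (z + w) * conv x y n  ∎

  recurrence-unique : (∀ n {a b} → ν (suc n) * a ≈ ν (suc n) * b → a ≈ b) →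
    ∀ {z} {x y : ℕ → Carrier} → (∀ n → ν (suc n) * x (suc n) ≈ z * x n) → (∀ n → ν (suc n) * y (suc n) ≈ z * y n) →
    x 0 ≈ y 0 → ∀ n → x n ≈ y n
  recurrence-unique cancel         x-suc y-suc x₀≈y₀ zero    = x₀≈y₀
  recurrence-unique cancel {z} {x} {y} x-suc y-suc x₀≈y₀ (suc n) = cancel n (begin
    ν (suc n) * x (suc n)  ≈⟨ x-suc n ⟩
    z * x n  ≈⟨ *-congˡ (recurrence-unique cancel x-suc y-suc x₀≈y₀ n) ⟩
    z * y n  ≈⟨ y-suc n ⟨
    ν (suc n) * y (suc n)  ∎)

-- The field of complex numbers, null sequences and limits

module ComplexField {c ℓ₁ ℓ₂} (R : CompleteOrderedField c ℓ₁ ℓ₂) where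
  open Complex R hiding (module ℂ)
  open ExponentialBounds R
  private
    module ℝ = Real R
    module ℝS = IntegerSolver ℝ.commutativeRing
    module ℝP = RingProperties ℝ.ring
    open ℝ using () renaming (Carrier to ℝ)

  ℂ-isCommutativeRing : IsCommutativeRing _≈_ _+_ _*_ -_ 0# 1#
  ℂ-isCommutativeRing = record
    { isRing = record
      { +-isAbelianGroup = record
        { isGroup = record
          { isMonoid = record
            { isSemigroup = record
              { isMagma = record
                { isEquivalence = record
                  { refl  = ℝ.refl , ℝ.refl
                  ; sym   = λ (p , q) → ℝ.sym p , ℝ.sym q
                  ; trans = λ (p , q) (r , s) → ℝ.trans p r , ℝ.trans q s
                  }
                ; ∙-cong = λ (p , q) (r , s) → ℝ.+-cong p r , ℝ.+-cong q s
                }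
              ; assoc = λ x y z → ℝ.+-assoc _ _ _ , ℝ.+-assoc _ _ _
              }
            ; identity = (λ x → ℝ.+-identityˡ _ , ℝ.+-identityˡ _) , (λ x → ℝ.+-identityʳ _ , ℝ.+-identityʳ _)
            }
          ; inverse = (λ x → ℝ.-‿inverseˡ _ , ℝ.-‿inverseˡ _) , (λ x → ℝ.-‿inverseʳ _ , ℝ.-‿inverseʳ _)
          ; ⁻¹-cong = λ (p , q) → ℝ.-‿cong p , ℝ.-‿cong q
          }
        ; comm = λ x y → ℝ.+-comm _ _ , ℝ.+-comm _ _
        }
      ; *-cong = λ (p , q) (r , s) →
          ℝ.+-cong (ℝ.*-cong p r) (ℝ.-‿cong (ℝ.*-cong q s)) , ℝ.+-cong (ℝ.*-cong p s) (ℝ.*-cong q r)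
      ; *-assoc = λ x y z →
          ℝS.solve 6 (λ a b c d e f → (a :* c :- b :* d) :* e :- (a :* d :+ b :* c) :* f :=
            a :* (c :* e :- d :* f) :- b :* (c :* f :+ d :* e)) ℝ.refl (re x) (im x) (re y) (im y) (re z) (im z) ,
          ℝS.solve 6 (λ a b c d e f → (a :* c :- b :* d) :* f :+ (a :* d :+ b :* c) :* e :=
            a :* (c :* f :+ d :* e) :+ b :* (c :* e :- d :* f)) ℝ.refl (re x) (im x) (re y) (im y) (re z) (im z)
      ; *-identity = *-identityˡ , λ x → ≈-trans (*-comm x 1#) (*-identityˡ x)
      ; distrib = distribˡ , λ x y z → ≈-trans (*-comm (y + z) x)
          (≈-trans (distribˡ x y z) (ℝ.+-cong (proj₁ (*-comm x y)) (proj₁ (*-comm x z)) ,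
                                     ℝ.+-cong (proj₂ (*-comm x y)) (proj₂ (*-comm x z))))
      }
    ; *-comm = *-comm
    }
    where
    ≈-trans : ∀ {x y z} → x ≈ y → y ≈ z → x ≈ z
    ≈-trans (p , q) (r , s) = ℝ.trans p r , ℝ.trans q s
    *-comm : ∀ x y → x * y ≈ y * x
    *-comm x y =
      ℝ.+-cong (ℝ.*-comm _ _) (ℝ.-‿cong (ℝ.*-comm _ _)) ,
      ℝ.trans (ℝ.+-comm _ _) (ℝ.+-cong (ℝ.*-comm _ _) (ℝ.*-comm _ _))
    *-identityˡ : ∀ x → 1# * x ≈ x
    *-identityˡ x =
      ℝ.trans (ℝ.+-cong (ℝ.*-identityˡ _) (ℝ.trans (ℝ.-‿cong (ℝ.zeroˡ _)) ℝP.-0#≈0#)) (ℝ.+-identityʳ _) ,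
      ℝ.trans (ℝ.+-cong (ℝ.*-identityˡ _) (ℝ.zeroˡ _)) (ℝ.+-identityʳ _)
    distribˡ : ∀ x y z → x * (y + z) ≈ x * y + x * z
    distribˡ x y z =
      ℝS.solve 6 (λ a b c d e f → a :* (c :+ e) :- b :* (d :+ f) := (a :* c :- b :* d) :+ (a :* e :- b :* f))
        ℝ.refl (re x) (im x) (re y) (im y) (re z) (im z) ,
      ℝS.solve 6 (λ a b c d e f → a :* (d :+ f) :+ b :* (c :+ e) := (a :* d :+ b :* c) :+ (a :* f :+ b :* e))
        ℝ.refl (re x) (im x) (re y) (im y) (re z) (im z)

  ℂ-commutativeRing : CommutativeRing c ℓ₁
  ℂ-commutativeRing = record { isCommutativeRing = ℂ-isCommutativeRing }

  module ℂ where
    open CommutativeRing ℂ-commutativeRing public hiding (Carrier; _≈_; _+_; _*_; -_; 0#; 1#; _-_; _≉_)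
    open IntegerSolver ℂ-commutativeRing public using (solve)
    open SemiringMult semiring public using () renaming (_×_ to _⊗_)
    open SemiringExp semiring public using (^-congˡ; ^-congʳ; ^-homo-*; ^-assocʳ)
    open CommutativeSemiringExp commutativeSemiring public using (^-distrib-*)
    open RingProperties ring public using (-0#≈0#; x∙y⁻¹≈ε⇒x≈y; x≈y⇒x∙y⁻¹≈ε; -‿distribʳ-*)
    open CauchyProduct ℂ-commutativeRing public
    open ListPolynomials ℂ-commutativeRing public

  infix 4 _≟_
  _≟_ : ∀ z w → Dec (z ≈ w)
  z ≟ w with re z ℝ.≟ re w | im z ℝ.≟ im w
  ... | yes p | yes q = yes (p , q)
  ... | no ¬p | _     = no (¬p ∘ proj₁)
  ... | _     | no ¬q = no (¬q ∘ proj₂)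

  open StrictReasoning ℝ.strictPartialOrder

  0≤x² : ∀ x → ℝ.0# ≤ x ℝ.* x
  0≤x² x with ℝ.compare x ℝ.0#
  ... | tri> _ _ 0<x = *-nonneg (inj₁ 0<x) (inj₁ 0<x)
  ... | tri≈ _ x≈0 _ = inj₂ (ℝ.sym (ℝ.trans (ℝ.*-congʳ x≈0) (ℝ.zeroˡ x)))
  ... | tri< x<0 _ _ = begin
    ℝ.0#  ≤⟨ *-nonneg (inj₁ (x<0⇒0<-x x<0)) (inj₁ (x<0⇒0<-x x<0)) ⟩
    ℝ.- x ℝ.* ℝ.- x  ≈⟨ ℝS.solve 1 (λ x → :- x :* :- x := x :* x) ℝ.refl x ⟩
    x ℝ.* x  ∎

  0<x² : ∀ {x} → ¬ (x ℝ.≈ ℝ.0#) → ℝ.0# ℝ.< x ℝ.* x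
  0<x² {x} x≉0 with ℝ.compare x ℝ.0#
  ... | tri> _ _ 0<x = ℝ.*-pos 0<x 0<x
  ... | tri≈ _ x≈0 _ = contradiction x≈0 x≉0
  ... | tri< x<0 _ _ = begin-strict
    ℝ.0#  <⟨ ℝ.*-pos (x<0⇒0<-x x<0) (x<0⇒0<-x x<0) ⟩
    ℝ.- x ℝ.* ℝ.- x  ≈⟨ ℝS.solve 1 (λ x → :- x :* :- x := x :* x) ℝ.refl x ⟩
    x ℝ.* x  ∎

  x≤x+y : ∀ {x y} → ℝ.0# ≤ y → x ≤ x ℝ.+ y
  x≤x+y {x} {y} 0≤y = begin
    x  ≈⟨ ℝ.+-identityʳ x ⟨
    x ℝ.+ ℝ.0#  ≤⟨ +-monoʳ-≤ x 0≤y ⟩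
    x ℝ.+ y  ∎

  x²-mono-< : ∀ {x y} → ℝ.0# ≤ x → x ℝ.< y → x ℝ.* x ℝ.< y ℝ.* y
  x²-mono-< {x} {y} 0≤x x<y = begin-strict
    x ℝ.* x  ≤⟨ *-monoʳ-≤ 0≤x (inj₁ x<y) ⟩
    x ℝ.* y  ≈⟨ ℝ.*-comm x y ⟩
    y ℝ.* x  <⟨ *-monoʳ-< (begin-strict ℝ.0# ≤⟨ 0≤x ⟩ x <⟨ x<y ⟩ y ∎) x<y ⟩
    y ℝ.* y  ∎

  0≤∣z∣² : ∀ z → ℝ.0# ≤ ∣ z ∣²
  0≤∣z∣² z = ≤-trans (0≤x² (re z)) (x≤x+y (0≤x² (im z)))

  ∣∣²-cong : ∀ {z w} → z ≈ w → ∣ z ∣² ℝ.≈ ∣ w ∣²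
  ∣∣²-cong (p , q) = ℝ.+-cong (ℝ.*-cong p p) (ℝ.*-cong q q)

  ∣∣²-* : ∀ z w → ∣ z * w ∣² ℝ.≈ ∣ z ∣² ℝ.* ∣ w ∣²
  ∣∣²-* z w = ℝS.solve 4 (λ a b c d →
    (a :* c :- b :* d) :* (a :* c :- b :* d) :+ (a :* d :+ b :* c) :* (a :* d :+ b :* c) :=
    (a :* a :+ b :* b) :* (c :* c :+ d :* d)) ℝ.refl (re z) (im z) (re w) (im w)

  -- By the parallelogram law.
  ∣∣²-+ : ∀ z w → ∣ z + w ∣² ≤ (∣ z ∣² ℝ.+ ∣ w ∣²) ℝ.+ (∣ z ∣² ℝ.+ ∣ w ∣²)
  ∣∣²-+ z w = begin
    ∣ z + w ∣²  ≤⟨ x≤x+y (0≤∣z∣² (z - w)) ⟩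
    ∣ z + w ∣² ℝ.+ ∣ z - w ∣²  ≈⟨ ℝS.solve 4 (λ a b c d →
      (a :+ c) :* (a :+ c) :+ (b :+ d) :* (b :+ d) :+ ((a :- c) :* (a :- c) :+ (b :- d) :* (b :- d)) :=
      (a :* a :+ b :* b :+ (c :* c :+ d :* d)) :+ (a :* a :+ b :* b :+ (c :* c :+ d :* d)))
      ℝ.refl (re z) (im z) (re w) (im w) ⟩
    (∣ z ∣² ℝ.+ ∣ w ∣²) ℝ.+ (∣ z ∣² ℝ.+ ∣ w ∣²)  ∎

  z≉0⇒0<∣z∣² : ∀ {z} → z ≉ 0# → ℝ.0# ℝ.< ∣ z ∣²
  z≉0⇒0<∣z∣² {z} z≉0 with re z ℝ.≟ ℝ.0# | im z ℝ.≟ ℝ.0#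
  ... | yes p | yes q = contradiction (p , q) z≉0
  ... | no ¬p | _     = begin-strict
    ℝ.0#  <⟨ 0<x² ¬p ⟩
    re z ℝ.* re z  ≤⟨ x≤x+y (0≤x² (im z)) ⟩
    ∣ z ∣²  ∎
  ... | _     | no ¬q = begin-strict
    ℝ.0#  <⟨ 0<x² ¬q ⟩
    im z ℝ.* im z  ≤⟨ x≤x+y (0≤x² (re z)) ⟩
    im z ℝ.* im z ℝ.+ re z ℝ.* re z ≈⟨ ℝ.+-comm _ _ ⟩
    ∣ z ∣²  ∎

  ⁻¹-inverseʳ : ∀ {z} → z ≉ 0# → z * z ⁻¹ ≈ 1#
  ⁻¹-inverseʳ {z} z≉0 =
    (begin-equality
      re z ℝ.* (re z ℝ.* i) ℝ.- im z ℝ.* (ℝ.- im z ℝ.* i) ≈⟨ ℝS.solve 3 (λ a b i →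
        a :* (a :* i) :- b :* (:- b :* i) := (a :* a :+ b :* b) :* i) ℝ.refl (re z) (im z) i ⟩
      ∣ z ∣² ℝ.* i  ≈⟨ *-inverseʳ (pos⇒≉0 (z≉0⇒0<∣z∣² z≉0)) ⟩
      ℝ.1#  ∎) ,
    ℝS.solve 3 (λ a b i → a :* (:- b :* i) :+ b :* (a :* i) := con (+ 0)) ℝ.refl (re z) (im z) i
    where i = ∣ z ∣² ℝ.⁻¹

  private
    module ℂR = SetoidReasoning ℂ.setoid

  *-cancelˡ : ∀ {z x y} → z ≉ 0# → z * x ≈ z * y → x ≈ y
  *-cancelˡ {z} {x} {y} z≉0 zx≈zy = ℂR.begin
    x  ℂR.≈⟨ expand x ⟨
    z ⁻¹ * (z * x) ℂR.≈⟨ ℂ.*-congˡ {z ⁻¹} zx≈zy ⟩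
    z ⁻¹ * (z * y) ℂR.≈⟨ expand y ⟩
    y  ℂR.∎
    where
    expand : ∀ x → z ⁻¹ * (z * x) ≈ x
    expand x = ℂR.begin
      z ⁻¹ * (z * x) ℂR.≈⟨ ℂ.solve 3 (λ i z x → i :* (z :* x) := (z :* i) :* x) ℂ.refl (z ⁻¹) z x ⟩
      z * z ⁻¹ * x  ℂR.≈⟨ ℂ.*-congʳ {x} (⁻¹-inverseʳ z≉0) ⟩
      1# * x  ℂR.≈⟨ ℂ.*-identityˡ x ⟩
      x  ℂR.∎

  domain : ∀ x y → x * y ≈ 0# → x ≈ 0# ⊎ y ≈ 0#
  domain x y xy≈0 with x ≟ 0#
  ... | yes x≈0 = inj₁ x≈0
  ... | no  x≉0 = inj₂ (*-cancelˡ {x} {y} {0#} x≉0 (ℂ.trans xy≈0 (ℂ.sym (ℂ.zeroʳ x))))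

  *-≉0 : ∀ {x y} → x ≉ 0# → y ≉ 0# → x * y ≉ 0#
  *-≉0 {x} {y} x≉0 y≉0 xy≈0 with domain x y xy≈0
  ... | inj₁ x≈0 = x≉0 x≈0
  ... | inj₂ y≈0 = y≉0 y≈0

  1≉0 : 1# ≉ 0#
  1≉0 (1≈0 , _) = ℝ.irrefl (ℝ.sym 1≈0) ℝ.0<1

  ⁻¹-unique : ∀ {x y} → x * y ≈ 1# → y ≈ x ⁻¹
  ⁻¹-unique {x} {y} xy≈1 = *-cancelˡ {x} {y} {x ⁻¹} x≉0 (ℂ.trans xy≈1 (ℂ.sym (⁻¹-inverseʳ x≉0)))
    where
    x≉0 : x ≉ 0#
    x≉0 x≈0 = 1≉0 (ℂ.trans (ℂ.sym xy≈1) (ℂ.trans (ℂ.*-congʳ {y} x≈0) (ℂ.zeroˡ y)))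

  fromℝ-* : ∀ x y → fromℝ (x ℝ.* y) ≈ fromℝ x * fromℝ y
  fromℝ-* x y =
    ℝS.solve 3 (λ x y z → x :* y := x :* y :- con (+ 0) :* con (+ 0)) ℝ.refl x y ℝ.0# ,
    ℝS.solve 2 (λ x y → con (+ 0) := x :* con (+ 0) :+ con (+ 0) :* y) ℝ.refl x y

  fromℝ-cong : ∀ {x y} → x ℝ.≈ y → fromℝ x ≈ fromℝ y
  fromℝ-cong x≈y = x≈y , ℝ.refl

  fromℕ≈ν : ∀ n → fromℕ n ≈ ℂ.ν n
  fromℕ≈ν zero    = ℂ.refl {0#}
  fromℕ≈ν (suc n) = ℝ.+-congˡ (proj₁ (fromℕ≈ν n)) , ℝ.trans (ℝ.sym (ℝ.+-identityˡ _)) (ℝ.+-congˡ (proj₂ (fromℕ≈ν n)))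

  fromℕ≉0 : ∀ n .{{_ : NonZero n}} → fromℕ n ≉ 0#
  fromℕ≉0 n (n≈0 , _) = pos⇒≉0 (0<fromℕ n) n≈0

  -- Measured by `∣_∣²`, which is multiplicative and obeys the parallelogram law, so that no square
  -- root has to be taken.
  Null : (ℕ → ℂ) → Set (c ⊔ ℓ₂)
  Null s = ∀ ε → ℝ.0# ℝ.< ε → ∃[ N ] ∀ n → N ℕ.≤ n → ∣ s n ∣² ℝ.< ε

  EventuallyBounded : (ℕ → ℂ) → Set ℓ₂
  EventuallyBounded s = ∃[ M ] ∃[ N ] ∀ n → N ℕ.≤ n → ∣ s n ∣² ℝ.< ℝ.fromℕ M

  part : ∀ k .{{_ : NonZero k}} ε → ℝ.0# ℝ.< ε → ∃[ δ ] ℝ.0# ℝ.< δ × ℝ.fromℕ k ℝ.* δ ℝ.≈ ε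
  part k ε 0<ε = ℝ.fromℕ k ℝ.⁻¹ ℝ.* ε , ℝ.*-pos (⁻¹-pos (0<fromℕ k)) 0<ε , (begin-equality
    ℝ.fromℕ k ℝ.* (ℝ.fromℕ k ℝ.⁻¹ ℝ.* ε)  ≈⟨ ℝ.*-assoc _ _ _ ⟨
    ℝ.fromℕ k ℝ.* ℝ.fromℕ k ℝ.⁻¹ ℝ.* ε  ≈⟨ ℝ.*-congʳ (*-inverseʳ (pos⇒≉0 (0<fromℕ k))) ⟩
    ℝ.1# ℝ.* ε  ≈⟨ ℝ.*-identityˡ ε ⟩
    ε  ∎)

  +-mono-< : ∀ {w x y z} → w ℝ.< x → y ℝ.< z → w ℝ.+ y ℝ.< x ℝ.+ z
  +-mono-< {w} {x} {y} {z} w<x y<z = begin-strict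
    w ℝ.+ y  <⟨ ℝ.+-monoˡ-< w y<z ⟩
    w ℝ.+ z  ≈⟨ ℝ.+-comm w z ⟩
    z ℝ.+ w  <⟨ ℝ.+-monoˡ-< z w<x ⟩
    z ℝ.+ x  ≈⟨ ℝ.+-comm z x ⟩
    x ℝ.+ z  ∎

  Null-cong : ∀ {s t} → (∀ n → s n ≈ t n) → Null s → Null t
  Null-cong s≈t s-null ε 0<ε with s-null ε 0<ε
  ... | N , small = N , λ n N≤n → ℝ.<-respˡ-≈ (∣∣²-cong (s≈t n)) (small n N≤n)

  Null-+ : ∀ {s t} → Null s → Null t → Null (λ n → s n + t n)
  -- The bound for `∣ s n + t n ∣²` is 2 `∣ s n ∣²` + 2 `∣ t n ∣²`, hence a quarter of ε for each
  -- square.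
  Null-+ {s} {t} s-null t-null ε 0<ε with part 4 ε 0<ε
  ... | δ , 0<δ , 4δ≈ε with s-null δ 0<δ | t-null δ 0<δ
  ...   | M , s-small | N , t-small = M ℕ.+ N , λ n M+N≤n → begin-strict
    ∣ s n + t n ∣²  ≤⟨ ∣∣²-+ (s n) (t n) ⟩
    (∣ s n ∣² ℝ.+ ∣ t n ∣²) ℝ.+ (∣ s n ∣² ℝ.+ ∣ t n ∣²)  <⟨ double (+-mono-< (s-small n (ℕ.m+n≤o⇒m≤o M M+N≤n)) (t-small n (ℕ.m+n≤o⇒n≤o M M+N≤n))) ⟩
    (δ ℝ.+ δ) ℝ.+ (δ ℝ.+ δ)  ≈⟨ ℝS.solve 2 (λ δ o → (δ :+ δ) :+ (δ :+ δ) := con (+ 4) :* δ) ℝ.refl δ ℝ.1# ⟩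
    ℝ.fromℕ 4 ℝ.* δ  ≈⟨ 4δ≈ε ⟩
    ε  ∎
    where
    double : ∀ {x y} → x ℝ.< y → x ℝ.+ x ℝ.< y ℝ.+ y
    double x<y = +-mono-< x<y x<y

  Null-*-bounded : ∀ {s t} → Null s → EventuallyBounded t → Null (λ n → t n * s n)
  Null-*-bounded {s} {t} s-null (M , N , t-bounded) ε 0<ε with part (suc M) ε 0<ε
  ... | δ , 0<δ , Mδ≈ε with s-null δ 0<δ
  ...   | K , s-small = N ℕ.+ K , λ n N+K≤n → begin-strict
    ∣ t n * s n ∣²  ≈⟨ ∣∣²-* (t n) (s n) ⟩
    ∣ t n ∣² ℝ.* ∣ s n ∣²  ≤⟨ *-monoˡ-≤ (0≤∣z∣² (s n)) (≤-trans (inj₁ (t-bounded n (ℕ.m+n≤o⇒m≤o N N+K≤n))) (fromℕ-mono (ℕ.n≤1+n M))) ⟩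
    ℝ.fromℕ (suc M) ℝ.* ∣ s n ∣²  <⟨ *-monoʳ-< (0<fromℕ (suc M)) (s-small n (ℕ.m+n≤o⇒n≤o N N+K≤n)) ⟩
    ℝ.fromℕ (suc M) ℝ.* δ  ≈⟨ Mδ≈ε ⟩
    ε  ∎

  bounded-const : ∀ z → EventuallyBounded (λ _ → z)
  bounded-const z with ℝ.archimedean ∣ z ∣²
  ... | M , z<M = M , 0 , λ _ _ → z<M

  Null-neg : ∀ {s} → Null s → Null (λ n → - s n)
  Null-neg {s} s-null = Null-cong (λ n → ℂ.solve 1 (λ z → :- con (+ 1) :* z := :- z) ℂ.refl (s n))
    (Null-*-bounded {s} s-null (bounded-const (- ℂ.ν 1)))

  Null-const : ∀ {z} → Null (λ _ → z) → z ≈ 0#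
  Null-const {z} null with z ≟ 0#
  ... | yes z≈0 = z≈0
  ... | no  z≉0 with null ∣ z ∣² (z≉0⇒0<∣z∣² z≉0)
  ...   | N , small = contradiction (small N ℕ.≤-refl) (ℝ.irrefl ℝ.refl)

  infix 4 _⟶_
  _⟶_ : (ℕ → ℂ) → ℂ → Set (c ⊔ ℓ₂)
  s ⟶ l = Null (λ n → s n - l)

  ⟶-bounded : ∀ {s l} → s ⟶ l → EventuallyBounded s
  ⟶-bounded {s} {l} s⟶l with ℝ.archimedean ((ℝ.1# ℝ.+ ∣ l ∣²) ℝ.+ (ℝ.1# ℝ.+ ∣ l ∣²)) | s⟶l ℝ.1# ℝ.0<1
  ... | M , lt | N , small = M , N , λ n N≤n → begin-strict
    ∣ s n ∣²  ≈⟨ ∣∣²-cong (ℂ.solve 2 (λ s l → s := (s :- l) :+ l) ℂ.refl (s n) l) ⟩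
    ∣ s n - l + l ∣²  ≤⟨ ∣∣²-+ (s n - l) l ⟩
    (∣ s n - l ∣² ℝ.+ ∣ l ∣²) ℝ.+ (∣ s n - l ∣² ℝ.+ ∣ l ∣²)
                                          ≤⟨ +-mono-≤ (+-monoˡ-≤ _ (inj₁ (small n N≤n))) (+-monoˡ-≤ _ (inj₁ (small n N≤n))) ⟩
    (ℝ.1# ℝ.+ ∣ l ∣²) ℝ.+ (ℝ.1# ℝ.+ ∣ l ∣²) <⟨ lt ⟩
    ℝ.fromℕ M  ∎

  ⟶-* : ∀ {s t a b} → s ⟶ a → t ⟶ b → (λ n → s n * t n) ⟶ a * b
  ⟶-* {s} {t} {a} {b} s⟶a t⟶b = Null-cong
    (λ n → ℂ.solve 4 (λ s t a b → s :* (t :- b) :+ b :* (s :- a) := s :* t :- a :* b) ℂ.refl (s n) (t n) a b)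
    (Null-+ (Null-*-bounded {λ n → t n - b} {s} t⟶b (⟶-bounded s⟶a))
            (Null-*-bounded {λ n → s n - a} {λ _ → b} s⟶a (bounded-const b)))

  ⟶-unique : ∀ {s t a b} → (λ n → s n - t n) ⟶ 0# → s ⟶ a → t ⟶ b → a ≈ b
  ⟶-unique {s} {t} {a} {b} s-t⟶0 s⟶a t⟶b = ℂ.x∙y⁻¹≈ε⇒x≈y a b (Null-const (Null-cong
    (λ n → ℂ.solve 4 (λ s t a b → (t :- b) :+ ((s :- t :- con (+ 0)) :- (s :- a)) := a :- b) ℂ.refl (s n) (t n) a b)
    (Null-+ t⟶b (Null-+ s-t⟶0 (Null-neg {λ n → s n - a} s⟶a)))))

  Null-eventually : ∀ {s} N → (∀ n → N ℕ.≤ n → s n ≈ 0#) → Null s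
  Null-eventually {s} N s≈0 ε 0<ε = N , λ n N≤n → begin-strict
    ∣ s n ∣²  ≈⟨ ∣∣²-cong (s≈0 n N≤n) ⟩
    ∣ 0# ∣²  ≈⟨ ℝS.solve 0 (con (+ 0) :* con (+ 0) :+ con (+ 0) :* con (+ 0) := con (+ 0)) ℝ.refl ⟩
    ℝ.0#  <⟨ 0<ε ⟩
    ε  ∎

  ⟶-eventually : ∀ {s l} N → (∀ n → N ℕ.≤ n → s n ≈ l) → s ⟶ l
  ⟶-eventually N s≈l = Null-eventually N (λ n N≤n → ℂ.x≈y⇒x∙y⁻¹≈ε (s≈l n N≤n))

  ⟶-unique-≈ : ∀ {s t a b} → (∀ n → s n ≈ t n) → s ⟶ a → t ⟶ b → a ≈ b
  ⟶-unique-≈ {s} {t} s≈t = ⟶-unique {s} {t} (⟶-eventually {λ n → s n - t n} {0#} 0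
    (λ n _ → ℂ.x≈y⇒x∙y⁻¹≈ε (s≈t n)))

  -- Mediates between `Null`, which compares `∣_∣²` with ε, and bounds of moduli or of components by
  -- δ. Two squares leave room for the real and the imaginary part. The witness is 1/(n + 2) with n
  -- > 1/ε, for which 2δ² ≤ δ < ε.
  squeeze : ∀ ε → ℝ.0# ℝ.< ε → ∃[ δ ] ℝ.0# ℝ.< δ × δ ℝ.* δ ℝ.+ δ ℝ.* δ ℝ.< ε
  squeeze ε 0<ε with ℝ.archimedean (ε ℝ.⁻¹)
  ... | n , ε⁻¹<n = δ , 0<δ , *-cancelˡ-< 0<k (begin-strict
    k ℝ.* (δ ℝ.* δ ℝ.+ δ ℝ.* δ)  ≈⟨ ℝS.solve 2 (λ k δ → k :* (δ :* δ :+ δ :* δ) := k :* δ :* (con (+ 2) :* δ)) ℝ.refl k δ ⟩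
    k ℝ.* δ ℝ.* (ℝ.fromℕ 2 ℝ.* δ)  ≈⟨ ℝ.*-congʳ kδ≈1 ⟩
    ℝ.1# ℝ.* (ℝ.fromℕ 2 ℝ.* δ)  ≈⟨ ℝ.*-identityˡ _ ⟩
    ℝ.fromℕ 2 ℝ.* δ  ≤⟨ *-monoˡ-≤ (inj₁ 0<δ) (fromℕ-mono (ℕ.m≤m+n 2 n)) ⟩
    k ℝ.* δ  ≈⟨ kδ≈1 ⟩
    ℝ.1#  ≈⟨ *-inverseʳ (pos⇒≉0 0<ε) ⟨
    ε ℝ.* ε ℝ.⁻¹  <⟨ *-monoʳ-< 0<ε ε⁻¹<n ⟩
    ε ℝ.* ℝ.fromℕ n  ≤⟨ *-monoʳ-≤ (inj₁ 0<ε) (fromℕ-mono (ℕ.m≤n+m n 2)) ⟩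
    ε ℝ.* k  ≈⟨ ℝ.*-comm ε k ⟩
    k ℝ.* ε  ∎)
    where
    k = ℝ.fromℕ (2 ℕ.+ n)
    δ = k ℝ.⁻¹
    0<k : ℝ.0# ℝ.< k
    0<k = 0<fromℕ (2 ℕ.+ n)
    0<δ : ℝ.0# ℝ.< δ
    0<δ = ⁻¹-pos 0<k
    kδ≈1 : k ℝ.* δ ℝ.≈ ℝ.1#
    kδ≈1 = *-inverseʳ (pos⇒≉0 0<k)

  HasSum⇒⟶ : ∀ {a s} → HasSum a s → partialSum a ⟶ s
  HasSum⇒⟶ {a} {s} sum ε 0<ε =
    let δ , 0<δ , 2δ²<ε = squeeze ε 0<ε
        N , small = sum δ 0<δ
    in N , λ n N≤n → begin-strict
      ∣ partialSum a n - s ∣²  <⟨ small n N≤n ⟩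
      δ ℝ.* δ  ≤⟨ x≤x+y (0≤x² δ) ⟩
      δ ℝ.* δ ℝ.+ δ ℝ.* δ  <⟨ 2δ²<ε ⟩
      ε  ∎

  ⟶⇒HasSum : ∀ {a s} → partialSum a ⟶ s → HasSum a s
  ⟶⇒HasSum sum ε 0<ε = sum (ε ℝ.* ε) (ℝ.*-pos 0<ε 0<ε)

  Null-bounded : ∀ {s} → (∀ ε → ℝ.0# ℝ.< ε → ∃[ N ] ∀ n → N ℕ.≤ n → Bounded ε (re (s n)) × Bounded ε (im (s n))) →
                 Null s
  Null-bounded {s} bounds ε 0<ε =
    let δ , 0<δ , 2δ²<ε = squeeze ε 0<ε
        N , small = bounds δ 0<δ
    in N , λ n N≤n → begin-strict
      ∣ s n ∣²  ≤⟨ +-mono-≤ (square-≤ 0<δ (proj₁ (small n N≤n))) (square-≤ 0<δ (proj₂ (small n N≤n))) ⟩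
      δ ℝ.* δ ℝ.+ δ ℝ.* δ  <⟨ 2δ²<ε ⟩
      ε  ∎
    where
    square-≤ : ∀ {δ x} → ℝ.0# ℝ.< δ → Bounded δ x → x ℝ.* x ≤ δ ℝ.* δ
    square-≤ 0<δ b = Bounded.upper (Bounded-* (inj₁ 0<δ) b b)

-- The exponential function and the root of unity exp(2πi/p)

module ExponentialFunction {c ℓ₁ ℓ₂} (R : CompleteOrderedField c ℓ₁ ℓ₂) where
  open Complex R hiding (module ℂ)
  open ExponentialBounds R
  open ComplexField R
  private
    module ℝ = Real R
    module ℝS = IntegerSolver ℝ.commutativeRing
    module ℝC = CauchyProduct ℝ.commutativeRing
    module ℝP = RingProperties ℝ.ring
    open ℝ using () renaming (Carrier to ℝ)
    module ℂR = SetoidReasoning ℂ.setoid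
  open StrictReasoning ℝ.strictPartialOrder

  partialSum≈Σ< : ∀ a n → partialSum a n ≈ ℂ.Σ< a n
  partialSum≈Σ< a zero    = ℂ.refl {0#}
  partialSum≈Σ< a (suc n) = ℂ.+-congʳ {a n} (partialSum≈Σ< a n)

  ∑≈Σ< : ∀ a n → ℝ.∑ a n ℝ.≈ ℝC.Σ< a n
  ∑≈Σ< a zero    = ℝ.refl
  ∑≈Σ< a (suc n) = ℝ.+-congʳ (∑≈Σ< a n)

  Bounded-close : ∀ {ε x y} → ℝ.∣ x - y ∣< ε → Bounded ε (x ℝ.- y)
  Bounded-close {ε} {x} {y} (p , q) = inj₁ p , (begin
    ℝ.- (x ℝ.- y)  ≈⟨ ℝS.solve 2 (λ x y → :- (x :- y) := y :- x) ℝ.refl x y ⟩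
    y ℝ.- x  <⟨ q ⟩
    ε  ∎)

  private
    re-partialSum : ∀ a n → ℝ.∑ (re ∘ a) n ≡ re (partialSum a n)
    re-partialSum a zero    = ≡.refl
    re-partialSum a (suc n) = cong (ℝ._+ re (a n)) (re-partialSum a n)

    im-partialSum : ∀ a n → ℝ.∑ (im ∘ a) n ≡ im (partialSum a n)
    im-partialSum a zero    = ≡.refl
    im-partialSum a (suc n) = cong (ℝ._+ im (a n)) (im-partialSum a n)

  opaque
    unfolding exp

    -- The only place where `exp` is unfolded; everything below knows it as the limit of its series.
    exp-sum : ∀ z → partialSum (expTerm z) ⟶ exp z
    exp-sum z = Null-bounded λ ε 0<ε →
      let M , re-close = proj₂ re-limit ε 0<ε
          N , im-close = proj₂ im-limit ε 0<ε
      in M ℕ.+ N , λ n M+N≤n →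
        Bounded-resp (ℝ.+-congʳ (ℝ.reflexive (re-partialSum (expTerm z) n))) (Bounded-close (re-close n (ℕ.m+n≤o⇒m≤o M M+N≤n))) ,
        Bounded-resp (ℝ.+-congʳ (ℝ.reflexive (im-partialSum (expTerm z) n))) (Bounded-close (im-close n (ℕ.m+n≤o⇒n≤o M M+N≤n)))
      where open ExpConvergence z

  -- `Dominated.y B k` is Bᵏ/k!, so the majorant of the components is again an exponential series,
  -- and majorants multiply like exponentials.
  dominated : ∀ z → ∃[ B ] ∀ k →
    Bounded (Dominated.y B k) (re (expTerm z k)) × Bounded (Dominated.y B k) (im (expTerm z k))
  dominated z = m ℕ.+ m , λ k → re-term-bound k , im-term-bound k
    where
    open ExpConvergence z
    m = proj₁ (bound (re z)) ℕ.+ proj₁ (bound (im z))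

  0!⁻¹≈1 : !⁻¹ 0 ℝ.≈ ℝ.1#
  0!⁻¹≈1 = begin-equality
    !⁻¹ 0  ≈⟨ ℝ.*-identityˡ _ ⟨
    ℝ.1# ℝ.* !⁻¹ 0  ≈⟨ ℝ.*-congʳ (ℝ.+-identityʳ ℝ.1#) ⟨
    ℝ.fromℕ 1 ℝ.* !⁻¹ 0  ≈⟨ *-inverseʳ (pos⇒≉0 (0<fromℕ 1)) ⟩
    ℝ.1#  ∎

  expTerm-suc : ∀ z k → ℂ.ν (suc k) * expTerm z (suc k) ≈ z * expTerm z k
  expTerm-suc z k = ℂR.begin
    ℂ.ν (suc k) * (fromℝ (!⁻¹ (suc k)) * (z * z ^ k))
      ℂR.≈⟨ ℂ.solve 4 (λ n i z w → n :* (i :* (z :* w)) := (n :* i) :* (z :* w)) ℂ.refl (ℂ.ν (suc k)) (fromℝ (!⁻¹ (suc k))) z (z ^ k) ⟩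
    ℂ.ν (suc k) * fromℝ (!⁻¹ (suc k)) * (z * z ^ k)
      ℂR.≈⟨ ℂ.*-congʳ {z * z ^ k} scaled ⟩
    fromℝ (!⁻¹ k) * (z * z ^ k)
      ℂR.≈⟨ ℂ.solve 3 (λ i z w → i :* (z :* w) := z :* (i :* w)) ℂ.refl (fromℝ (!⁻¹ k)) z (z ^ k) ⟩
    z * expTerm z k ℂR.∎
    where
    scaled : ℂ.ν (suc k) * fromℝ (!⁻¹ (suc k)) ≈ fromℝ (!⁻¹ k)
    scaled = ℂR.begin
      ℂ.ν (suc k) * fromℝ (!⁻¹ (suc k))  ℂR.≈⟨ ℂ.*-congʳ {fromℝ (!⁻¹ (suc k))} (fromℕ≈ν (suc k)) ⟨
      fromℕ (suc k) * fromℝ (!⁻¹ (suc k))  ℂR.≈⟨ fromℝ-* _ _ ⟨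
      fromℝ (ℝ.fromℕ (suc k) ℝ.* !⁻¹ (suc k)) ℂR.≈⟨ fromℝ-cong (!⁻¹-suc k) ⟩
      fromℝ (!⁻¹ k)  ℂR.∎

  expTerm-zero : ∀ z → expTerm z 0 ≈ 1#
  expTerm-zero z = ℂR.begin
    fromℝ (!⁻¹ 0) * 1#  ℂR.≈⟨ ℂ.*-identityʳ (fromℝ (!⁻¹ 0)) ⟩
    fromℝ (!⁻¹ 0)  ℂR.≈⟨ fromℝ-cong 0!⁻¹≈1 ⟩
    1#  ℂR.∎

  ν-cancel : ∀ n {a b} → ℂ.ν (suc n) * a ≈ ℂ.ν (suc n) * b → a ≈ b
  ν-cancel n {a} {b} = *-cancelˡ {ℂ.ν (suc n)} {a} {b}
    (λ ν≈0 → fromℕ≉0 (suc n) (ℂ.trans (fromℕ≈ν (suc n)) ν≈0))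

  conv-expTerm : ∀ z w k → ℂ.conv (expTerm z) (expTerm w) k ≈ expTerm (z + w) k
  conv-expTerm z w = ℂ.recurrence-unique ν-cancel {z + w} {ℂ.conv (expTerm z) (expTerm w)} {expTerm (z + w)}
    (ℂ.conv-suc {z} {w} {expTerm w} (expTerm-suc w) {expTerm z} (expTerm-suc z))
    (expTerm-suc (z + w))
    (ℂR.begin
      expTerm z 0 * expTerm w 0 ℂR.≈⟨ ℂ.*-cong (expTerm-zero z) (expTerm-zero w) ⟩
      1# * 1#  ℂR.≈⟨ ℂ.*-identityˡ 1# ⟩
      1#  ℂR.≈⟨ expTerm-zero (z + w) ⟨
      expTerm (z + w) 0  ℂR.∎)

  private
    y : ℕ → ℕ → ℝ
    y = Dominated.y

    y-suc : ∀ B k → ℝC.ν (suc k) ℝ.* y B (suc k) ℝ.≈ ℝ.fromℕ B ℝ.* y B k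
    y-suc B k = begin-equality
      n ℝ.* (i ℝ.* (b ℝ.* b^k))  ≈⟨ ℝS.solve 4 (λ n i b c → n :* (i :* (b :* c)) := (n :* i) :* (b :* c)) ℝ.refl n i b b^k ⟩
      n ℝ.* i ℝ.* (b ℝ.* b^k)  ≈⟨ ℝ.*-congʳ (!⁻¹-suc k) ⟩
      !⁻¹ k ℝ.* (b ℝ.* b^k)  ≈⟨ ℝS.solve 3 (λ i b c → i :* (b :* c) := b :* (i :* c)) ℝ.refl (!⁻¹ k) b b^k ⟩
      b ℝ.* y B k  ∎
      where
      n = ℝ.fromℕ (suc k)
      i = !⁻¹ (suc k)
      b = ℝ.fromℕ B
      b^k = b ℝ.^ k

    y-zero : ∀ B → y B 0 ℝ.≈ ℝ.1#
    y-zero B = ℝ.trans (ℝ.*-identityʳ _) 0!⁻¹≈1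

    conv-y : ∀ A B k → ℝC.conv (y A) (y B) k ℝ.≈ y (A ℕ.+ B) k
    conv-y A B = ℝC.recurrence-unique
      (λ n → *-cancelˡ-≈ (0<fromℕ (suc n)))
      (λ k → ℝ.trans (ℝC.conv-suc (y-suc B) (y-suc A) k) (ℝ.*-congʳ (ℝ.sym (fromℕ-+ A B))))
      (y-suc (A ℕ.+ B))
      (ℝ.trans (ℝ.*-cong (y-zero A) (y-zero B)) (ℝ.trans (ℝ.*-identityˡ ℝ.1#) (ℝ.sym (y-zero (A ℕ.+ B)))))

  NonNegative : (ℕ → ℝ) → Set (ℓ₁ ⊔ ℓ₂)
  NonNegative a = ∀ n → ℝ.0# ≤ a n

  0≤Σ< : ∀ {a} → NonNegative a → NonNegative (ℝC.Σ< a)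
  0≤Σ< 0≤a zero    = ≤-refl
  0≤Σ< 0≤a (suc n) = ≤-trans (0≤Σ< 0≤a n) (x≤x+y (0≤a n))

  Σ<-mono : ∀ {a} → NonNegative a → ∀ m n → ℝC.Σ< a n ≤ ℝC.Σ< a (m ℕ.+ n)
  Σ<-mono 0≤a zero    n = ≤-refl
  Σ<-mono 0≤a (suc m) n = ≤-trans (Σ<-mono 0≤a m n) (x≤x+y (0≤a (m ℕ.+ n)))

  0≤conv : ∀ {a b} → NonNegative a → NonNegative b → NonNegative (ℝC.conv a b)
  0≤conv         0≤a 0≤b zero    = *-nonneg (0≤a 0) (0≤b 0)
  0≤conv {a} {b} 0≤a 0≤b (suc n) = ≤-trans (*-nonneg (0≤a 0) (0≤b (suc n))) (x≤x+y (0≤conv {a ∘ suc} {b} (0≤a ∘ suc) 0≤b n))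

  Σ<-*-≤ : ∀ {a b} → NonNegative a → NonNegative b → ∀ m n →
           ℝC.Σ< a m ℝ.* ℝC.Σ< b n ≤ ℝC.Σ< (ℝC.conv a b) (m ℕ.+ n)
  Σ<-*-≤ {a} {b} 0≤a 0≤b zero n = begin
    ℝ.0# ℝ.* ℝC.Σ< b n  ≈⟨ ℝ.zeroˡ _ ⟩
    ℝ.0#  ≤⟨ 0≤Σ< (0≤conv 0≤a 0≤b) n ⟩
    ℝC.Σ< (ℝC.conv a b) n  ∎
  Σ<-*-≤ {a} {b} 0≤a 0≤b (suc m) n = begin
    ℝC.Σ< a (suc m) ℝ.* B  ≈⟨ ℝ.*-congʳ (ℝC.Σ<-suc a m) ⟩
    (a 0 ℝ.+ A) ℝ.* B  ≈⟨ ℝ.distribʳ B (a 0) A ⟩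
    a 0 ℝ.* B ℝ.+ A ℝ.* B  ≤⟨ +-mono-≤ (*-monoʳ-≤ (0≤a 0) (Σ<-mono 0≤b (suc m) n)) (Σ<-*-≤ (0≤a ∘ suc) 0≤b m n) ⟩
    a 0 ℝ.* ℝC.Σ< b (suc m ℕ.+ n) ℝ.+ ℝC.Σ< (ℝC.conv (a ∘ suc) b) (m ℕ.+ n)
                                               ≈⟨ ℝC.Σ<-conv-suc a b (m ℕ.+ n) ⟨
    ℝC.Σ< (ℝC.conv a b) (suc m ℕ.+ n)  ∎
    where
    A = ℝC.Σ< (a ∘ suc) m
    B = ℝC.Σ< b n

  -- For nonnegative terms the square of side n lies in the triangle of side 2n, so the corner is at
  -- most the difference of two partial sums of the Cauchy product.
  corner-≤ : ∀ {a b} → NonNegative a → NonNegative b → ∀ n →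
             ℝC.corner a b n ≤ ℝC.Σ< (ℝC.conv a b) (n ℕ.+ n) ℝ.- ℝC.Σ< (ℝC.conv a b) n
  corner-≤ {a} {b} 0≤a 0≤b n = begin
    D  ≈⟨ ℝS.solve 2 (λ C D → D := C :+ D :- C) ℝ.refl C D ⟩
    C ℝ.+ D ℝ.- C  ≈⟨ ℝ.+-congʳ (ℝC.Σ<-* a b n) ⟨
    ℝC.Σ< a n ℝ.* ℝC.Σ< b n ℝ.- C  ≤⟨ +-monoˡ-≤ (ℝ.- C) (Σ<-*-≤ 0≤a 0≤b n n) ⟩
    ℝC.Σ< (ℝC.conv a b) (n ℕ.+ n) ℝ.- C  ∎
    where
    C = ℝC.Σ< (ℝC.conv a b) n
    D = ℝC.corner a b n

  infix 4 _≼_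
  _≼_ : ℂ → ℝ → Set (ℓ₁ ⊔ ℓ₂)
  z ≼ a = Bounded a (re z) × Bounded a (im z)

  ≼-+ : ∀ {z w a b} → z ≼ a → w ≼ b → z + w ≼ a ℝ.+ b
  ≼-+ (p , q) (r , s) = Bounded-+ p r , Bounded-+ q s

  ≼-* : ∀ {z w a b} → ℝ.0# ≤ b → z ≼ a → w ≼ b → z * w ≼ a ℝ.* b ℝ.+ a ℝ.* b
  ≼-* 0≤b (p , q) (r , s) =
    Bounded-+ (Bounded-* 0≤b p r) (Bounded-neg (Bounded-* 0≤b q s)) ,
    Bounded-+ (Bounded-* 0≤b p s) (Bounded-* 0≤b q r)

  ≼-≤ : ∀ {z a b} → a ≤ b → z ≼ a → z ≼ b
  ≼-≤ a≤b (p , q) = Bounded-≤ a≤b p , Bounded-≤ a≤b q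

  0≼0 : 0# ≼ ℝ.0#
  0≼0 = 0-bounded , 0-bounded
    where
    0-bounded : Bounded ℝ.0# ℝ.0#
    0-bounded = ≤-refl , inj₂ ℝP.-0#≈0#

  ≼-Σ< : ∀ {x a} → (∀ k → x k ≼ a k) → ∀ n → ℂ.Σ< x n ≼ ℝC.Σ< a n
  ≼-Σ< x≼a zero    = 0≼0
  ≼-Σ< {x} {a} x≼a (suc n) = ≼-+ {ℂ.Σ< x n} {x n} (≼-Σ< {x} {a} x≼a n) (x≼a n)

  -- Each component of a complex product consists of two real products, whence the corner of the
  -- majorants counts twice.
  ≼-corner : ∀ {x y a b} → NonNegative b → (∀ k → x k ≼ a k) → (∀ k → y k ≼ b k) → ∀ n →
             ℂ.corner x y n ≼ ℝC.corner a b n ℝ.+ ℝC.corner a b n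
  ≼-corner 0≤b x≼a y≼b zero = ≼-≤ {0#} (inj₂ (ℝ.sym (ℝ.+-identityʳ ℝ.0#))) 0≼0
  ≼-corner {x} {y} {a} {b} 0≤b x≼a y≼b (suc n) = ≼-≤ {ℂ.corner x y (suc n)}
    (inj₂ (ℝS.solve 2 (λ D P → D :+ D :+ (P :+ P) := D :+ P :+ (D :+ P)) ℝ.refl
      (ℝC.corner (a ∘ suc) b n) (ℝC.Σ< (a ∘ suc) n ℝ.* b n)))
    (≼-+ {ℂ.corner (x ∘ suc) y n} {ℂ.Σ< (x ∘ suc) n * y n}
      (≼-corner {x ∘ suc} {y} {a ∘ suc} {b} 0≤b (x≼a ∘ suc) y≼b n)
      (≼-* {ℂ.Σ< (x ∘ suc) n} {y n} (0≤b n) (≼-Σ< {x ∘ suc} {a ∘ suc} (x≼a ∘ suc) n) (y≼b n)))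

  -- corner x y n ≤ E (2n) - E n for the partial sums E of the exponential series of a
  -- sum of two majorants, and these are Cauchy.
  corner-null : ∀ z w → Null (ℂ.corner (expTerm z) (expTerm w))
  corner-null z w with dominated z | dominated w
  ... | A , z≼ | B , w≼ = Null-bounded λ ε 0<ε → small ε 0<ε
    where
    0≤y : ∀ B → NonNegative (y B)
    0≤y B = Dominated.0≤y B
    self-bounded : ∀ B k → Bounded (y B k) (y B k)
    self-bounded B k = ≤-refl , (begin
      ℝ.- y B k  ≈⟨ ℝ.+-identityʳ _ ⟨
      ℝ.- y B k ℝ.+ ℝ.0#  ≤⟨ +-monoʳ-≤ _ (0≤y B k) ⟩
      ℝ.- y B k ℝ.+ y B k  ≈⟨ ℝ.-‿inverseˡ _ ⟩
      ℝ.0#  ≤⟨ 0≤y B k ⟩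
      y B k  ∎)
    E : ℕ → ℝ
    E = ℝ.∑ (y (A ℕ.+ B))
    conv≈E : ∀ n → ℝC.Σ< (ℝC.conv (y A) (y B)) n ℝ.≈ E n
    conv≈E n = ℝ.trans (ℝC.Σ<-cong (conv-y A B) n) (ℝ.sym (∑≈Σ< (y (A ℕ.+ B)) n))
    D : ℕ → ℝ
    D = ℝC.corner (y A) (y B)
    D≤E-E : ∀ n → D n ≤ E (n ℕ.+ n) ℝ.- E n
    D≤E-E n = ≤-trans (corner-≤ (0≤y A) (0≤y B) n) (inj₂ (ℝ.+-cong (conv≈E (n ℕ.+ n)) (ℝ.-‿cong (conv≈E n))))
    small : ∀ ε → ℝ.0# ℝ.< ε → ∃[ N ] ∀ n → N ℕ.≤ n → ℂ.corner (expTerm z) (expTerm w) n ≼ ε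
    small ε 0<ε =
      let δ , 0<δ , 2δ≈ε = part 2 ε 0<ε
          N , close = Dominated.cauchy (A ℕ.+ B) (y (A ℕ.+ B)) (self-bounded (A ℕ.+ B)) δ 0<δ
          D≤δ = λ n N≤n → ≤-trans (D≤E-E n) (inj₁ (proj₁ (close (n ℕ.+ n) n (ℕ.≤-trans N≤n (ℕ.m≤m+n n n)) N≤n)))
      in N , λ n N≤n → ≼-≤ {ℂ.corner (expTerm z) (expTerm w) n} (begin
        D n ℝ.+ D n  ≤⟨ +-mono-≤ (D≤δ n N≤n) (D≤δ n N≤n) ⟩
        δ ℝ.+ δ  ≈⟨ ℝS.solve 1 (λ δ → δ :+ δ := con (+ 2) :* δ) ℝ.refl δ ⟩
        ℝ.fromℕ 2 ℝ.* δ  ≈⟨ 2δ≈ε ⟩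
        ε  ∎) (≼-corner {expTerm z} {expTerm w} (0≤y B) z≼ w≼ n)

  exp-homo : ∀ z w → exp (z + w) ≈ exp z * exp w
  exp-homo z w = ℂ.sym (⟶-unique {λ n → partialSum x n * partialSum y′ n} {partialSum (expTerm (z + w))}
    (Null-cong difference (corner-null z w))
    (⟶-* {partialSum x} {partialSum y′} (exp-sum z) (exp-sum w))
    (exp-sum (z + w)))
    where
    x = expTerm z
    y′ = expTerm w
    difference : ∀ n → ℂ.corner x y′ n ≈ partialSum x n * partialSum y′ n - partialSum (expTerm (z + w)) n - 0#
    difference n = ℂR.begin
      D  ℂR.≈⟨ ℂ.solve 2 (λ C D → D := C :+ D :- C :- con (+ 0)) ℂ.refl C D ⟩
      C + D - C - 0#  ℂR.≈⟨ ℂ.+-congʳ { - 0#} (ℂ.+-cong (ℂ.sym product) (ℂ.-‿cong (ℂ.sym sum))) ⟩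
      partialSum x n * partialSum y′ n - partialSum (expTerm (z + w)) n - 0# ℂR.∎
      where
      C = ℂ.Σ< (ℂ.conv x y′) n
      D = ℂ.corner x y′ n
      product : partialSum x n * partialSum y′ n ≈ C + D
      product = ℂ.trans (ℂ.*-cong (partialSum≈Σ< x n) (partialSum≈Σ< y′ n)) (ℂ.Σ<-* x y′ n)
      sum : partialSum (expTerm (z + w)) n ≈ C
      sum = ℂ.trans (partialSum≈Σ< (expTerm (z + w)) n) (ℂ.Σ<-cong (ℂ.sym ∘ conv-expTerm z w) n)

  partialSum-cong : ∀ {a b} → (∀ n → a n ≈ b n) → ∀ n → partialSum a n ≈ partialSum b n
  partialSum-cong         a≈b zero    = ℂ.refl {0#}
  partialSum-cong {a} {b} a≈b (suc n) = ℂ.+-cong (partialSum-cong {a} {b} a≈b n) (a≈b n)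

  exp-cong : ∀ {z w} → z ≈ w → exp z ≈ exp w
  exp-cong {z} {w} z≈w = ⟶-unique-≈ {partialSum (expTerm z)} {partialSum (expTerm w)}
    (partialSum-cong {expTerm z} {expTerm w} (λ k → ℂ.*-congˡ {fromℝ (!⁻¹ k)} (ℂ.^-congˡ k z≈w)))
    (exp-sum z) (exp-sum w)

  exp-0 : exp 0# ≈ 1#
  exp-0 = ⟶-unique-≈ {partialSum (expTerm 0#)} {partialSum (expTerm 0#)} (λ n → ℂ.refl {partialSum (expTerm 0#) n})
    (exp-sum 0#) (⟶-eventually {partialSum (expTerm 0#)} {1#} 1 (λ where (suc n) _ → partialSum≈1 n))
    where
    partialSum≈1 : ∀ n → partialSum (expTerm 0#) (suc n) ≈ 1#
    partialSum≈1 zero    = ℂ.trans (ℂ.+-identityˡ (expTerm 0# 0)) (expTerm-zero 0#)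
    partialSum≈1 (suc n) = ℂR.begin
      partialSum (expTerm 0#) (suc n) + expTerm 0# (suc n)
        ℂR.≈⟨ ℂ.+-cong (partialSum≈1 n) (ℂ.trans (ℂ.*-congˡ {fromℝ (!⁻¹ (suc n))} (ℂ.zeroˡ (0# ^ n))) (ℂ.zeroʳ (fromℝ (!⁻¹ (suc n))))) ⟩
      1# + 0#  ℂR.≈⟨ ℂ.+-identityʳ 1# ⟩
      1#  ℂR.∎

  conj : ℂ → ℂ
  conj z = re z +i ℝ.- im z

  ∣conj∣² : ∀ z → ∣ conj z ∣² ℝ.≈ ∣ z ∣²
  ∣conj∣² z = ℝS.solve 2 (λ a b → a :* a :+ :- b :* :- b := a :* a :+ b :* b) ℝ.refl (re z) (im z)

  conj-+ : ∀ z w → conj (z + w) ≈ conj z + conj w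
  conj-+ z w = ℝ.refl , ℝ.sym (ℝP.-‿+-comm (im z) (im w))

  conj-* : ∀ z w → conj (z * w) ≈ conj z * conj w
  conj-* z w =
    ℝS.solve 4 (λ a b c d → a :* c :- b :* d := a :* c :- :- b :* :- d) ℝ.refl (re z) (im z) (re w) (im w) ,
    ℝS.solve 4 (λ a b c d → :- (a :* d :+ b :* c) := a :* :- d :+ :- b :* c) ℝ.refl (re z) (im z) (re w) (im w)

  conj-real : ∀ x → conj (fromℝ x) ≈ fromℝ x
  conj-real x = ℝ.refl , ℝP.-0#≈0#

  conj-^ : ∀ z n → conj (z ^ n) ≈ conj z ^ n
  conj-^ z zero    = conj-real ℝ.1#
  conj-^ z (suc n) = ℂ.trans (conj-* z (z ^ n)) (ℂ.*-congˡ {conj z} (conj-^ z n))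

  exp-conj : ∀ z → exp (conj z) ≈ conj (exp z)
  exp-conj z = ⟶-unique-≈ {partialSum (expTerm (conj z))} {λ n → conj (partialSum (expTerm z) n)}
    partialSum-conj (exp-sum (conj z)) conj-sum
    where
    expTerm-conj : ∀ k → expTerm (conj z) k ≈ conj (expTerm z k)
    expTerm-conj k = ℂ.sym (ℂ.trans (conj-* (fromℝ (!⁻¹ k)) (z ^ k)) (ℂ.*-cong (conj-real (!⁻¹ k)) (conj-^ z k)))
    partialSum-conj : ∀ n → partialSum (expTerm (conj z)) n ≈ conj (partialSum (expTerm z) n)
    partialSum-conj zero    = ℂ.sym (conj-real ℝ.0#)
    partialSum-conj (suc n) = ℂ.trans (ℂ.+-cong (partialSum-conj n) (expTerm-conj n))
      (ℂ.sym (conj-+ (partialSum (expTerm z) n) (expTerm z n)))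
    conj-sum : (λ n → conj (partialSum (expTerm z) n)) ⟶ conj (exp z)
    conj-sum ε 0<ε =
      let N , small = exp-sum z ε 0<ε
      in N , λ n N≤n → ℝ.<-respˡ-≈
        (ℝ.trans (ℝ.sym (∣conj∣² (partialSum (expTerm z) n - exp z)))
                 (∣∣²-cong (conj-+ (partialSum (expTerm z) n) (- exp z))))
        (small n N≤n)

  cis : ℝ → ℂ
  cis t = exp (ℝ.0# +i t)

  cis-cong : ∀ {s t} → s ℝ.≈ t → cis s ≈ cis t
  cis-cong s≈t = exp-cong (ℝ.refl , s≈t)

  cis-+ : ∀ s t → cis (s ℝ.+ t) ≈ cis s * cis t
  cis-+ s t = ℂ.trans (exp-cong (ℝ.sym (ℝ.+-identityˡ ℝ.0#) , ℝ.refl)) (exp-homo (ℝ.0# +i s) (ℝ.0# +i t))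

  ∣cis∣² : ∀ t → ∣ cis t ∣² ℝ.≈ ℝ.1#
  ∣cis∣² t = begin-equality
    ∣ cis t ∣²  ≈⟨ ℝS.solve 2 (λ a b → a :* a :+ b :* b := a :* a :- b :* :- b) ℝ.refl (re (cis t)) (im (cis t)) ⟩
    -- `conj (ℝ.0# +i t)` unfolds to `ℝ.0# +i ℝ.- t`, so that `exp-conj` identifies `conj (cis t)`
    -- with `cis (ℝ.- t)`.
    re (cis t * conj (cis t))  ≈⟨ proj₁ (ℂ.*-congˡ {cis t} (exp-conj (ℝ.0# +i t))) ⟨
    re (cis t * cis (ℝ.- t))  ≈⟨ proj₁ (cis-+ t (ℝ.- t)) ⟨
    re (cis (t ℝ.- t))  ≈⟨ proj₁ (cis-cong (ℝ.-‿inverseʳ t)) ⟩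
    re (cis ℝ.0#)  ≈⟨ proj₁ exp-0 ⟩
    ℝ.1#  ∎

  -- Twice the square of the sine is `∣ cis t ∣²` minus the real part of `cis t * cis t`, that is, 1
  -- - 1.
  cis-double≈1⇒sin≈0 : ∀ t → cis t * cis t ≈ 1# → sin t ℝ.≈ ℝ.0#
  cis-double≈1⇒sin≈0 t (re≈1 , _) with sin t ℝ.≟ ℝ.0#
  ... | yes s≈0 = s≈0
  ... | no  s≉0 = contradiction (ℝ.sym 2s²≈0) (λ 0≈2s² → ℝ.irrefl 0≈2s² (begin-strict
    ℝ.0#  <⟨ 0<x² s≉0 ⟩
    sin t ℝ.* sin t  ≤⟨ x≤x+y (0≤x² (sin t)) ⟩
    sin t ℝ.* sin t ℝ.+ sin t ℝ.* sin t ∎))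
    where
    2s²≈0 : sin t ℝ.* sin t ℝ.+ sin t ℝ.* sin t ℝ.≈ ℝ.0#
    2s²≈0 = begin-equality
      sin t ℝ.* sin t ℝ.+ sin t ℝ.* sin t  ≈⟨ ℝS.solve 2 (λ c s → s :* s :+ s :* s := (c :* c :+ s :* s) :- (c :* c :- s :* s)) ℝ.refl (re (cis t)) (sin t) ⟩
      ∣ cis t ∣² ℝ.- re (cis t * cis t)  ≈⟨ ℝ.+-cong (∣cis∣² t) (ℝ.-‿cong re≈1) ⟩
      ℝ.1# ℝ.- ℝ.1#  ≈⟨ ℝ.-‿inverseʳ ℝ.1# ⟩
      ℝ.0#  ∎

  sin≈0⇒cis-double≈1 : ∀ t → sin t ℝ.≈ ℝ.0# → cis t * cis t ≈ 1#
  sin≈0⇒cis-double≈1 t s≈0 =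
    (begin-equality
      C ℝ.* C ℝ.- s ℝ.* s  ≈⟨ ℝS.solve 2 (λ c s → c :* c :- s :* s := c :* c :+ s :* s :- con (+ 2) :* s :* s) ℝ.refl C s ⟩
      ∣ cis t ∣² ℝ.- ℝ.fromℕ 2 ℝ.* s ℝ.* s ≈⟨ ℝ.+-cong (∣cis∣² t) (ℝ.-‿cong (ℝ.trans (ℝ.*-congˡ s≈0) (ℝ.zeroʳ _))) ⟩
      ℝ.1# ℝ.- ℝ.0#  ≈⟨ ℝS.solve 0 (:1 :- con (+ 0) := :1) ℝ.refl ⟩
      ℝ.1#  ∎) ,
    (begin-equality
      C ℝ.* s ℝ.+ s ℝ.* C  ≈⟨ ℝ.+-cong (ℝ.*-congˡ s≈0) (ℝ.*-congʳ s≈0) ⟩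
      C ℝ.* ℝ.0# ℝ.+ ℝ.0# ℝ.* C  ≈⟨ ℝS.solve 1 (λ c → c :* con (+ 0) :+ con (+ 0) :* c := con (+ 0)) ℝ.refl C ⟩
      ℝ.0#  ∎)
    where
    C = re (cis t)
    s = sin t

  module RootOfUnity (π : ℝ) (isPi : IsPi π) (p : ℕ) (1<p : 1 ℕ.< p) where
    private
      instance
        p≢0 : NonZero p
        p≢0 = ℕ.>-nonZero (ℕ.<-trans (ℕ.s≤s ℕ.z≤n) 1<p)

      i = ℝ.fromℕ p ℝ.⁻¹
      θ = π ℝ.* i

      p*i≈1 : ℝ.fromℕ p ℝ.* i ℝ.≈ ℝ.1#
      p*i≈1 = *-inverseʳ (pos⇒≉0 (0<fromℕ p))

      0<i : ℝ.0# ℝ.< i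
      0<i = ⁻¹-pos (0<fromℕ p)

    -- This is exp(2πi/p), written as a square so that the sine at the half angle π/p decides
    -- whether it equals 1.
    ζ : ℂ
    ζ = cis θ * cis θ

    cis-multiple : ∀ k → cis (ℝ.fromℕ 2 ℝ.* π ℝ.* ℝ.fromℕ k ℝ.* i) ≈ ζ ^ k
    cis-multiple zero    = ℂ.trans
      (cis-cong (ℝS.solve 2 (λ π i → con (+ 2) :* π :* con (+ 0) :* i := con (+ 0)) ℝ.refl π i)) exp-0
    cis-multiple (suc k) = ℂR.begin
      cis (ℝ.fromℕ 2 ℝ.* π ℝ.* ℝ.fromℕ (suc k) ℝ.* i)  ℂR.≈⟨ cis-cong (ℝS.solve 3 (λ π k i →
        con (+ 2) :* π :* (:1 :+ k) :* i := π :* i :+ π :* i :+ con (+ 2) :* π :* k :* i) ℝ.refl π (ℝ.fromℕ k) i) ⟩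
      cis (θ ℝ.+ θ ℝ.+ rest)  ℂR.≈⟨ cis-+ (θ ℝ.+ θ) rest ⟩
      cis (θ ℝ.+ θ) * cis rest  ℂR.≈⟨ ℂ.*-cong (cis-+ θ θ) (cis-multiple k) ⟩
      ζ * ζ ^ k  ℂR.∎
      where rest = ℝ.fromℕ 2 ℝ.* π ℝ.* ℝ.fromℕ k ℝ.* i

    ζ^p≈1 : ζ ^ p ≈ 1#
    ζ^p≈1 = ℂR.begin
      ζ ^ p  ℂR.≈⟨ cis-multiple p ⟨
      cis (ℝ.fromℕ 2 ℝ.* π ℝ.* ℝ.fromℕ p ℝ.* i)  ℂR.≈⟨ cis-cong full-turn ⟩
      cis (π ℝ.+ π)  ℂR.≈⟨ cis-+ π π ⟩
      cis π * cis π  ℂR.≈⟨ sin≈0⇒cis-double≈1 π (proj₁ (proj₂ isPi)) ⟩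
      1#  ℂR.∎
      where
      full-turn : ℝ.fromℕ 2 ℝ.* π ℝ.* ℝ.fromℕ p ℝ.* i ℝ.≈ π ℝ.+ π
      full-turn = begin-equality
        ℝ.fromℕ 2 ℝ.* π ℝ.* ℝ.fromℕ p ℝ.* i  ≈⟨ ℝ.*-assoc _ _ _ ⟩
        ℝ.fromℕ 2 ℝ.* π ℝ.* (ℝ.fromℕ p ℝ.* i)  ≈⟨ ℝ.*-congˡ p*i≈1 ⟩
        ℝ.fromℕ 2 ℝ.* π ℝ.* ℝ.1#  ≈⟨ ℝS.solve 1 (λ π → con (+ 2) :* π :* :1 := π :+ π) ℝ.refl π ⟩
        π ℝ.+ π  ∎

    -- 0 < π/p < π, where the sine does not vanish.
    ζ≉1 : ζ ≉ 1#
    ζ≉1 ζ≈1 = proj₂ (proj₂ isPi) θ (ℝ.*-pos 0<π 0<i) θ<π (cis-double≈1⇒sin≈0 θ ζ≈1)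
      where
      0<π = proj₁ isPi
      θ<π : θ ℝ.< π
      θ<π = *-cancelˡ-< (0<fromℕ p) (begin-strict
        ℝ.fromℕ p ℝ.* (π ℝ.* i)  ≈⟨ ℝS.solve 3 (λ p π i → p :* (π :* i) := π :* (p :* i)) ℝ.refl (ℝ.fromℕ p) π i ⟩
        π ℝ.* (ℝ.fromℕ p ℝ.* i)  ≈⟨ ℝ.*-congˡ p*i≈1 ⟩
        π ℝ.* ℝ.1#  ≈⟨ ℝ.*-identityʳ π ⟩
        π  ≈⟨ ℝ.+-identityʳ π ⟨
        π ℝ.+ ℝ.0#  <⟨ ℝ.+-monoˡ-< π 0<π ⟩
        π ℝ.+ π  ≈⟨ ℝS.solve 1 (λ π → π :+ π := con (+ 2) :* π) ℝ.refl π ⟩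
        ℝ.fromℕ 2 ℝ.* π  ≤⟨ *-monoˡ-≤ (inj₁ 0<π) (fromℕ-mono 1<p) ⟩
        ℝ.fromℕ p ℝ.* π  ∎)

-- Power series on a disc and uniqueness of their continuations

module PowerSeries {c ℓ₁ ℓ₂} (R : CompleteOrderedField c ℓ₁ ℓ₂) where
  open Complex R hiding (module ℂ)
  open ExponentialBounds R
  open ComplexField R
  open ExponentialFunction R using (partialSum-cong; partialSum≈Σ<)
  private
    module ℝ = Real R
    module ℝS = IntegerSolver ℝ.commutativeRing
    open ℝ using () renaming (Carrier to ℝ)
    module ℂR = SetoidReasoning ℂ.setoid
  open StrictReasoning ℝ.strictPartialOrder
  open ℂ.Domain domain

  evaluate≡eval : ∀ P u → evaluate P u ≡ ℂ.eval P u
  evaluate≡eval []       u = ≡.refl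
  evaluate≡eval (a ∷ as) u = cong (λ v → a + u * v) (evaluate≡eval as u)

  evaluate≈eval : ∀ P u → evaluate P u ≈ ℂ.eval P u
  evaluate≈eval P u = ℂ.reflexive (evaluate≡eval P u)

  -- Bernoulli's inequality for 1/x.
  ^-bernoulli : ∀ x → ℝ.0# ≤ x → ∀ n → x ℝ.^ n ℝ.* (ℝ.1# ℝ.+ ℝ.fromℕ n ℝ.* (ℝ.1# ℝ.- x)) ≤ ℝ.1#
  ^-bernoulli x 0≤x zero    = inj₂ (ℝS.solve 1 (λ x → :1 :* (:1 :+ con (+ 0) :* (:1 :- x)) := :1) ℝ.refl x)
  ^-bernoulli x 0≤x (suc n) = begin
    x ℝ.* x^n ℝ.* (ℝ.1# ℝ.+ (ℝ.1# ℝ.+ N) ℝ.* h)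
      ≤⟨ x≤x+y (*-nonneg (0≤x^ n) (*-nonneg (0≤fromℕ (suc n)) (0≤x² h))) ⟩
    x ℝ.* x^n ℝ.* (ℝ.1# ℝ.+ (ℝ.1# ℝ.+ N) ℝ.* h) ℝ.+ x^n ℝ.* ((ℝ.1# ℝ.+ N) ℝ.* (h ℝ.* h))
      ≈⟨ ℝS.solve 3 (λ x p N → x :* p :* (:1 :+ (:1 :+ N) :* (:1 :- x)) :+ p :* ((:1 :+ N) :* ((:1 :- x) :* (:1 :- x))) :=
          p :* (:1 :+ N :* (:1 :- x))) ℝ.refl x x^n N ⟩
    x^n ℝ.* (ℝ.1# ℝ.+ N ℝ.* h)
      ≤⟨ ^-bernoulli x 0≤x n ⟩
    ℝ.1# ∎
    where
    h = ℝ.1# ℝ.- x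
    N = ℝ.fromℕ n
    x^n = x ℝ.^ n
    0≤x^ : ∀ n → ℝ.0# ≤ x ℝ.^ n
    0≤x^ zero    = inj₁ ℝ.0<1
    0≤x^ (suc n) = *-nonneg 0≤x (0≤x^ n)

  ^-small : ∀ x → ℝ.0# ≤ x → x ℝ.< ℝ.1# → ∀ ε → ℝ.0# ℝ.< ε → ∃[ N ] ∀ n → N ℕ.≤ n → x ℝ.^ n ℝ.< ε
  ^-small x 0≤x x<1 ε 0<ε = N , λ n N≤n → *-cancelˡ-< (0<1+nh n) (begin-strict
    (ℝ.1# ℝ.+ ℝ.fromℕ n ℝ.* h) ℝ.* x ℝ.^ n  ≈⟨ ℝ.*-comm _ _ ⟩
    x ℝ.^ n ℝ.* (ℝ.1# ℝ.+ ℝ.fromℕ n ℝ.* h)  ≤⟨ ^-bernoulli x 0≤x n ⟩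
    ℝ.1#  ≈⟨ *-inverseʳ (pos⇒≉0 0<hε) ⟨
    h ℝ.* ε ℝ.* (h ℝ.* ε) ℝ.⁻¹  <⟨ *-monoʳ-< 0<hε (proj₂ (ℝ.archimedean ((h ℝ.* ε) ℝ.⁻¹))) ⟩
    h ℝ.* ε ℝ.* ℝ.fromℕ N  ≤⟨ *-monoʳ-≤ (inj₁ 0<hε) (fromℕ-mono N≤n) ⟩
    h ℝ.* ε ℝ.* ℝ.fromℕ n  ≤⟨ x≤x+y (inj₁ 0<ε) ⟩
    h ℝ.* ε ℝ.* ℝ.fromℕ n ℝ.+ ε  ≈⟨ ℝS.solve 3 (λ h ε n → h :* ε :* n :+ ε := (:1 :+ n :* h) :* ε) ℝ.refl h ε (ℝ.fromℕ n) ⟩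
    (ℝ.1# ℝ.+ ℝ.fromℕ n ℝ.* h) ℝ.* ε  ∎)
    where
    h = ℝ.1# ℝ.- x
    0<h : ℝ.0# ℝ.< h
    0<h = x<y⇒0<y-x x<1
    0<hε : ℝ.0# ℝ.< h ℝ.* ε
    0<hε = ℝ.*-pos 0<h 0<ε
    N = proj₁ (ℝ.archimedean ((h ℝ.* ε) ℝ.⁻¹))
    0<1+nh : ∀ n → ℝ.0# ℝ.< ℝ.1# ℝ.+ ℝ.fromℕ n ℝ.* h
    0<1+nh n = begin-strict
      ℝ.0#  <⟨ ℝ.0<1 ⟩
      ℝ.1#  ≤⟨ x≤x+y (*-nonneg (0≤fromℕ n) (inj₁ 0<h)) ⟩
      ℝ.1# ℝ.+ ℝ.fromℕ n ℝ.* h  ∎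

  ∣^∣² : ∀ z n → ∣ z ^ n ∣² ℝ.≈ ∣ z ∣² ℝ.^ n
  ∣^∣² z zero    = ℝS.solve 0 (:1 :* :1 :+ con (+ 0) :* con (+ 0) := :1) ℝ.refl
  ∣^∣² z (suc n) = ℝ.trans (∣∣²-* z (z ^ n)) (ℝ.*-congˡ (∣^∣² z n))

  ^-null : ∀ {z} → ∣ z ∣² ℝ.< ℝ.1# → Null (z ^_)
  ^-null {z} ∣z∣²<1 ε 0<ε =
    let N , small = ^-small ∣ z ∣² (0≤∣z∣² z) ∣z∣²<1 ε 0<ε
    in N , λ n N≤n → ℝ.<-respˡ-≈ (ℝ.sym (∣^∣² z n)) (small n N≤n)

  Null-shift : ∀ {s} K → Null (λ n → s (n ℕ.+ K)) → Null s
  Null-shift {s} K null ε 0<ε =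
    let N , small = null ε 0<ε
    in N ℕ.+ K , λ n N+K≤n → ≡.subst (λ k → ∣ s k ∣² ℝ.< ε) (ℕ.m∸n+n≡m (ℕ.m+n≤o⇒n≤o N N+K≤n))
         (small (n ℕ.∸ K) (ℕ.m+n≤o⇒m≤o∸n N N+K≤n))

  HasSum-finite : ∀ {a} K → (∀ n → a (n ℕ.+ K) ≈ 0#) → HasSum a (partialSum a K)
  HasSum-finite {a} K a≈0 = ⟶⇒HasSum {a} (Null-shift {λ n → partialSum a n - partialSum a K} K
    (⟶-eventually {λ n → partialSum a (n ℕ.+ K)} {partialSum a K} 0 (λ n _ → constant n)))
    where
    constant : ∀ n → partialSum a (n ℕ.+ K) ≈ partialSum a K
    constant zero    = ℂ.refl {partialSum a K}
    constant (suc n) = ℂ.trans (ℂ.+-cong (constant n) (a≈0 n)) (ℂ.+-identityʳ (partialSum a K))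

  1-z≉0 : ∀ {z} → ∣ z ∣² ℝ.< ℝ.1# → 1# - z ≉ 0#
  1-z≉0 {z} ∣z∣²<1 1-z≈0 = ℝ.irrefl (begin-equality
    ∣ z ∣²  ≈⟨ ∣∣²-cong (ℂ.x∙y⁻¹≈ε⇒x≈y 1# z 1-z≈0) ⟨
    ∣ 1# ∣²  ≈⟨ ℝS.solve 0 (:1 :* :1 :+ con (+ 0) :* con (+ 0) := :1) ℝ.refl ⟩
    ℝ.1#  ∎) ∣z∣²<1

  HasSum-geometric : ∀ {a s z} K → ∣ z ∣² ℝ.< ℝ.1# → (∀ n → a (n ℕ.+ K) ≈ s * z ^ n) →
                     HasSum a (partialSum a K + s * (1# - z) ⁻¹)
  HasSum-geometric {a} {s} {z} K ∣z∣²<1 a≈sz^n = ⟶⇒HasSum {a} (Null-shift {λ n → partialSum a n - (P + s * i)} K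
    (Null-cong (λ n → ℂ.sym (remainder n))
      (Null-*-bounded {z ^_} {λ _ → - (s * i)} (^-null ∣z∣²<1) (bounded-const (- (s * i))))))
    where
    P = partialSum a K
    i = (1# - z) ⁻¹
    1-z-inverse : (1# - z) * i ≈ 1#
    1-z-inverse = ⁻¹-inverseʳ {1# - z} (1-z≉0 ∣z∣²<1)
    remainder : ∀ n → partialSum a (n ℕ.+ K) - (P + s * i) ≈ - (s * i) * z ^ n
    remainder zero    = ℂ.solve 3 (λ P s i → P :- (P :+ s :* i) := :- (s :* i) :* :1) ℂ.refl P s i
    remainder (suc n) = ℂR.begin
      partialSum a (n ℕ.+ K) + a (n ℕ.+ K) - (P + s * i)
        ℂR.≈⟨ ℂ.solve 3 (λ Q A L → Q :+ A :- L := Q :- L :+ A) ℂ.refl (partialSum a (n ℕ.+ K)) (a (n ℕ.+ K)) (P + s * i) ⟩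
      partialSum a (n ℕ.+ K) - (P + s * i) + a (n ℕ.+ K)
        ℂR.≈⟨ ℂ.+-cong (remainder n) (a≈sz^n n) ⟩
      - (s * i) * w + s * w
        ℂR.≈⟨ ℂ.solve 3 (λ s i w → :- (s :* i) :* w :+ s :* w := :- (s :* i) :* w :+ s :* w :* :1) ℂ.refl s i w ⟩
      - (s * i) * w + s * w * 1#
        ℂR.≈⟨ ℂ.+-congˡ { - (s * i) * w} (ℂ.*-congˡ {s * w} 1-z-inverse) ⟨
      - (s * i) * w + s * w * ((1# - z) * i)
        ℂR.≈⟨ ℂ.solve 4 (λ s i w z → :- (s :* i) :* w :+ s :* w :* ((:1 :- z) :* i) := :- (s :* i) :* (z :* w)) ℂ.refl s i w z ⟩
      - (s * i) * (z * w) ℂR.∎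
      where w = z ^ n

  HasSum-unique : ∀ {a s t} → HasSum a s → HasSum a t → s ≈ t
  HasSum-unique {a} p q = ⟶-unique-≈ {partialSum a} {partialSum a} (λ n → ℂ.refl {partialSum a n})
    (HasSum⇒⟶ {a} p) (HasSum⇒⟶ {a} q)

  HasSum-cong : ∀ {a s t} → s ≈ t → HasSum a s → HasSum a t
  HasSum-cong {a} {s} {t} s≈t sum = ⟶⇒HasSum {a} (Null-cong
    (λ n → ℂ.+-congˡ {partialSum a n} (ℂ.-‿cong s≈t)) (HasSum⇒⟶ {a} sum))

  ⁻¹-antitone : ∀ {x y} → ℝ.0# ℝ.< x → x ℝ.< y → y ℝ.⁻¹ ℝ.< x ℝ.⁻¹
  ⁻¹-antitone {x} {y} 0<x x<y = *-cancelˡ-< (ℝ.*-pos 0<x 0<y) (begin-strict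
    x ℝ.* y ℝ.* y ℝ.⁻¹  ≈⟨ ℝ.*-assoc x y _ ⟩
    x ℝ.* (y ℝ.* y ℝ.⁻¹)  ≈⟨ ℝ.*-congˡ (*-inverseʳ (pos⇒≉0 0<y)) ⟩
    x ℝ.* ℝ.1#  ≈⟨ ℝ.*-identityʳ x ⟩
    x  <⟨ x<y ⟩
    y  ≈⟨ ℝ.*-identityʳ y ⟨
    y ℝ.* ℝ.1#  ≈⟨ ℝ.*-congˡ (*-inverseʳ (pos⇒≉0 0<x)) ⟨
    y ℝ.* (x ℝ.* x ℝ.⁻¹)  ≈⟨ ℝS.solve 3 (λ x y i → y :* (x :* i) := x :* y :* i) ℝ.refl x y (x ℝ.⁻¹) ⟩
    x ℝ.* y ℝ.* x ℝ.⁻¹  ∎)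
    where
    0<y : ℝ.0# ℝ.< y
    0<y = ℝ.<-trans 0<x x<y

  fromℕ-mono-< : ∀ {m n} → m ℕ.< n → ℝ.fromℕ m ℝ.< ℝ.fromℕ n
  fromℕ-mono-< {m} {n} m<n = begin-strict
    ℝ.fromℕ m  <⟨ ℝ.<-respʳ-≈ (ℝ.+-comm _ _) (ℝ.<-respˡ-≈ (ℝ.+-identityʳ _) (ℝ.+-monoˡ-< (ℝ.fromℕ m) ℝ.0<1)) ⟩
    ℝ.fromℕ (suc m)  ≤⟨ fromℕ-mono m<n ⟩
    ℝ.fromℕ n  ∎

  module OnDisc (q : ℕ) .{{_ : NonZero q}} where

    private
      ρ = ℝ.fromℕ q ℝ.⁻¹
      Q = fromℕ q

      -- The numbers 1/(q + 1), 1/(q + 2), ... supply arbitrarily many distinct points of the disc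
      -- of radius 1/q.
      point : ℕ → ℂ
      point k = fromℝ (ℝ.fromℕ (suc k ℕ.+ q) ℝ.⁻¹)

      point-in-disc : ∀ k → ∣ point k ∣< ρ
      point-in-disc k = begin-strict
        x ℝ.* x ℝ.+ ℝ.0# ℝ.* ℝ.0#  ≈⟨ ℝS.solve 1 (λ x → x :* x :+ con (+ 0) :* con (+ 0) := x :* x) ℝ.refl x ⟩
        x ℝ.* x  <⟨ x²-mono-< (inj₁ (⁻¹-pos (0<fromℕ (suc k ℕ.+ q)))) (⁻¹-antitone (0<fromℕ q) (fromℕ-mono-< (ℕ.s≤s (ℕ.m≤n+m q k)))) ⟩
        ρ ℝ.* ρ  ∎
        where x = ℝ.fromℕ (suc k ℕ.+ q) ℝ.⁻¹

      points-distinct : ∀ {i j} → i ℕ.< j → point i ≉ point j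
      points-distinct {i} {j} i<j (eq , _) = ℝ.irrefl (ℝ.sym eq)
        (⁻¹-antitone (0<fromℕ (suc i ℕ.+ q)) (fromℕ-mono-< (ℕ.s≤s (ℕ.+-monoˡ-< q i<j))))

    zero-on-disc⇒zero : ∀ P → (∀ u → ∣ u ∣< ρ → ℂ.eval P u ≈ 0#) → ∀ u → ℂ.eval P u ≈ 0#
    zero-on-disc⇒zero P P≈0 = ℂ.eval-zero (roots⇒zero P (List.applyUpTo point n)
      (ℕ.≤-reflexive (≡.sym (List.length-applyUpTo point n)))
      (AllPairs.applyUpTo⁺₁ point n (λ i<j _ → points-distinct i<j))
      (All.applyUpTo⁺₂ point n (λ k → P≈0 (point k) (point-in-disc k))))
      where n = List.length P

    ∣Qu∣²<1 : ∀ u → ∣ u ∣< ρ → ∣ Q * u ∣² ℝ.< ℝ.1#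
    ∣Qu∣²<1 u u<ρ = begin-strict
      ∣ Q * u ∣²  ≈⟨ ∣∣²-* Q u ⟩
      ∣ Q ∣² ℝ.* ∣ u ∣²  ≈⟨ ℝ.*-congʳ (ℝS.solve 1 (λ x → x :* x :+ con (+ 0) :* con (+ 0) := x :* x) ℝ.refl x) ⟩
      x ℝ.* x ℝ.* ∣ u ∣²  <⟨ *-monoʳ-< (ℝ.*-pos 0<x 0<x) u<ρ ⟩
      x ℝ.* x ℝ.* (ρ ℝ.* ρ)  ≈⟨ ℝS.solve 2 (λ x r → x :* x :* (r :* r) := x :* r :* (x :* r)) ℝ.refl x ρ ⟩
      x ℝ.* ρ ℝ.* (x ℝ.* ρ)  ≈⟨ ℝ.*-cong xρ≈1 xρ≈1 ⟩
      ℝ.1# ℝ.* ℝ.1#  ≈⟨ ℝ.*-identityˡ ℝ.1# ⟩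
      ℝ.1#  ∎
      where
      x = ℝ.fromℕ q
      0<x : ℝ.0# ℝ.< x
      0<x = 0<fromℕ q
      xρ≈1 : x ℝ.* ρ ℝ.≈ ℝ.1#
      xρ≈1 = *-inverseʳ (pos⇒≉0 0<x)

    record Quotient (a : ℂ → ℕ → ℂ) (N E : List ℂ) : Set (c ⊔ ℓ₁ ⊔ ℓ₂) where
      field
        nonzero : ∀ u → ∣ u ∣< ρ → ℂ.eval E u ≉ 0#
        sum     : ∀ u → ∣ u ∣< ρ → HasSum (a u) (ℂ.eval N u * ℂ.eval E u ⁻¹)

    module _ {a : ℂ → ℕ → ℂ} {N E : List ℂ} (quotient : Quotient a N E) where
      open Quotient quotient

      quotient-continues : Any (_≉ 0#) E → ∃[ r ] r Continues a OnDisc ρ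
      quotient-continues E≉0 = record { numerator = N ; denominator = E ; denominator≉0 = E≉0 } , λ u u<ρ →
        (λ E≈0 → nonzero u u<ρ (ℂ.trans (ℂ.sym (evaluate≈eval E u)) E≈0)) ,
        ≡.subst (HasSum (a u)) (≡.sym (≡.cong₂ (λ n e → n * e ⁻¹) (evaluate≡eval N u) (evaluate≡eval E u))) (sum u u<ρ)

      -- On the disc both fractions are sums of the same series, so the difference of the cross
      -- products vanishes there and hence everywhere. Products, unlike quotients, keep their
      -- meaning at the zeros of a denominator, where the total inverse would give a dummy value.
      cross-multiplied : ∀ r → r Continues a OnDisc ρ → ∀ u →
        evaluate (numerator r) u * ℂ.eval E u ≈ ℂ.eval N u * evaluate (denominator r) u
      cross-multiplied r continues u = ℂ.trans (ℂ.*-congʳ {ℂ.eval E u} (evaluate≈eval A u))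
        (ℂ.trans (ℂ.x∙y⁻¹≈ε⇒x≈y _ _ (ℂ.trans (ℂ.sym (eval-difference u)) (zero-on-disc⇒zero difference vanishes u)))
                 (ℂ.*-congˡ {ℂ.eval N u} (ℂ.sym (evaluate≈eval B u))))
        where
        A = numerator r
        B = denominator r
        difference : List ℂ
        difference = A ℂ.⊠ E ℂ.⊞ List.map (- 1# *_) (N ℂ.⊠ B)
        eval-difference : ∀ u → ℂ.eval difference u ≈ ℂ.eval A u * ℂ.eval E u - ℂ.eval N u * ℂ.eval B u
        eval-difference u = ℂ.trans (ℂ.eval-⊞ (A ℂ.⊠ E) _ u) (ℂ.+-cong (ℂ.eval-⊠ A E u)
          (ℂ.trans (ℂ.eval-map (- 1#) (N ℂ.⊠ B) u)
            (ℂ.trans (ℂ.*-congˡ { - 1#} (ℂ.eval-⊠ N B u)) (ℂ.solve 1 (λ x → :- :1 :* x := :- x) ℂ.refl (ℂ.eval N u * ℂ.eval B u)))))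
        vanishes : ∀ u → ∣ u ∣< ρ → ℂ.eval difference u ≈ 0#
        vanishes u u<ρ = ℂ.trans (eval-difference u) (ℂ.x≈y⇒x∙y⁻¹≈ε equal)
          where
          α = ℂ.eval A u
          β = ℂ.eval B u
          ν = ℂ.eval N u
          ε = ℂ.eval E u
          β≉0 : β ≉ 0#
          β≉0 β≈0 = proj₁ (continues u u<ρ) (ℂ.trans (evaluate≈eval B u) β≈0)
          same-value : α * β ⁻¹ ≈ ν * ε ⁻¹
          same-value = HasSum-unique {a u}
            (≡.subst (HasSum (a u)) (≡.cong₂ (λ n e → n * e ⁻¹) (evaluate≡eval A u) (evaluate≡eval B u)) (proj₂ (continues u u<ρ)))
            (sum u u<ρ)
          equal : α * ε ≈ ν * β
          equal = ℂR.begin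
            α * ε  ℂR.≈⟨ ℂ.solve 2 (λ α ε → α :* ε := α :* ε :* :1) ℂ.refl α ε ⟩
            α * ε * 1#  ℂR.≈⟨ ℂ.*-congˡ {α * ε} (⁻¹-inverseʳ β≉0) ⟨
            α * ε * (β * β ⁻¹)  ℂR.≈⟨ ℂ.solve 4 (λ α ε β i → α :* ε :* (β :* i) := α :* i :* (ε :* β)) ℂ.refl α ε β (β ⁻¹) ⟩
            α * β ⁻¹ * (ε * β)  ℂR.≈⟨ ℂ.*-congʳ {ε * β} same-value ⟩
            ν * ε ⁻¹ * (ε * β)  ℂR.≈⟨ ℂ.solve 4 (λ ν i ε β → ν :* i :* (ε :* β) := ν :* β :* (ε :* i)) ℂ.refl ν (ε ⁻¹) ε β ⟩
            ν * β * (ε * ε ⁻¹)  ℂR.≈⟨ ℂ.*-congˡ {ν * β} (⁻¹-inverseʳ (nonzero u u<ρ)) ⟩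
            ν * β * 1#  ℂR.≈⟨ ℂ.*-identityʳ (ν * β) ⟩
            ν * β  ℂR.∎

      value : ∀ r → r Continues a OnDisc ρ → ∀ u → r RegularAt u → ℂ.eval E u ≉ 0# →
              r ⟨ u ⟩ ≈ ℂ.eval N u * ℂ.eval E u ⁻¹
      value r continues u regular ε≉0 = ℂR.begin
        α * β ⁻¹  ℂR.≈⟨ ℂ.*-identityʳ (α * β ⁻¹) ⟨
        α * β ⁻¹ * 1#  ℂR.≈⟨ ℂ.*-congˡ {α * β ⁻¹} (⁻¹-inverseʳ ε≉0) ⟨
        α * β ⁻¹ * (ε * ε ⁻¹)  ℂR.≈⟨ ℂ.solve 4 (λ α i ε j → α :* i :* (ε :* j) := α :* ε :* (i :* j)) ℂ.refl α (β ⁻¹) ε (ε ⁻¹) ⟩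
        α * ε * (β ⁻¹ * ε ⁻¹)  ℂR.≈⟨ ℂ.*-congʳ {β ⁻¹ * ε ⁻¹} (cross-multiplied r continues u) ⟩
        ν * β * (β ⁻¹ * ε ⁻¹)  ℂR.≈⟨ ℂ.solve 4 (λ ν β i j → ν :* β :* (i :* j) := ν :* j :* (β :* i)) ℂ.refl ν β (β ⁻¹) (ε ⁻¹) ⟩
        ν * ε ⁻¹ * (β * β ⁻¹)  ℂR.≈⟨ ℂ.*-congˡ {ν * ε ⁻¹} (⁻¹-inverseʳ regular) ⟩
        ν * ε ⁻¹ * 1#  ℂR.≈⟨ ℂ.*-identityʳ (ν * ε ⁻¹) ⟩
        ν * ε ⁻¹  ℂR.∎
        where
        α = evaluate (numerator r) u
        β = evaluate (denominator r) u
        ν = ℂ.eval N u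
        ε = ℂ.eval E u

    series : (ℕ → ℂ) → ℂ → ℕ → ℂ
    series C u n = C n * u ^ n

    eval-applyUpTo : ∀ C K u → ℂ.eval (List.applyUpTo C K) u ≈ partialSum (series C u) K
    eval-applyUpTo C zero    u = ℂ.refl {0#}
    eval-applyUpTo C (suc K) u = ℂR.begin
      C 0 + u * ℂ.eval (List.applyUpTo (C ∘ suc) K) u  ℂR.≈⟨ ℂ.+-congˡ {C 0} (ℂ.*-congˡ {u} (eval-applyUpTo (C ∘ suc) K u)) ⟩
      C 0 + u * partialSum (series (C ∘ suc) u) K  ℂR.≈⟨ ℂ.+-cong (ℂ.sym (ℂ.*-identityʳ (C 0))) (shift K) ⟩
      C 0 * 1# + ℂ.Σ< (series C u ∘ suc) K  ℂR.≈⟨ ℂ.Σ<-suc (series C u) K ⟨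
      ℂ.Σ< (series C u) (suc K)  ℂR.≈⟨ Σ<≈partialSum (suc K) ⟩
      partialSum (series C u) (suc K)  ℂR.∎
      where
      Σ<≈partialSum : ∀ n → ℂ.Σ< (series C u) n ≈ partialSum (series C u) n
      Σ<≈partialSum n = ℂ.sym (partialSum≈Σ< (series C u) n)
      shift : ∀ n → u * partialSum (series (C ∘ suc) u) n ≈ ℂ.Σ< (series C u ∘ suc) n
      shift zero    = ℂ.zeroʳ u
      shift (suc n) = ℂR.begin
        u * (partialSum (series (C ∘ suc) u) n + C (suc n) * u ^ n)
          ℂR.≈⟨ ℂ.solve 4 (λ u S c w → u :* (S :+ c :* w) := u :* S :+ c :* (u :* w)) ℂ.refl u (partialSum (series (C ∘ suc) u) n) (C (suc n)) (u ^ n) ⟩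
        u * partialSum (series (C ∘ suc) u) n + C (suc n) * u ^ suc n
          ℂR.≈⟨ ℂ.+-congʳ {C (suc n) * u ^ suc n} (shift n) ⟩
        ℂ.Σ< (series C u ∘ suc) (suc n) ℂR.∎

    module Finite {a : ℂ → ℕ → ℂ} {C : ℕ → ℂ} (K : ℕ)
      (a≈series : ∀ u n → a u n ≈ series C u n) (C≈0 : ∀ n → C (n ℕ.+ K) ≈ 0#) where

      private
        unit : ∀ u → ℂ.eval (1# ∷ []) u ≈ 1#
        unit u = ℂ.trans (ℂ.+-congˡ {1#} (ℂ.zeroʳ u)) (ℂ.+-identityʳ 1#)

        unit≉0 : ∀ u → ℂ.eval (1# ∷ []) u ≉ 0#
        unit≉0 u E≈0 = 1≉0 (ℂ.trans (ℂ.sym (unit u)) E≈0)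

        simplify : ∀ u → ℂ.eval (List.applyUpTo C K) u * ℂ.eval (1# ∷ []) u ⁻¹ ≈ partialSum (series C u) K
        simplify u = ℂ.trans (ℂ.*-cong (eval-applyUpTo C K u) (ℂ.sym (⁻¹-unique (ℂ.trans (ℂ.*-identityʳ _) (unit u)))))
          (ℂ.*-identityʳ (partialSum (series C u) K))

        quotient : Quotient a (List.applyUpTo C K) (1# ∷ [])
        quotient = record
          { nonzero = λ u _ → unit≉0 u
          ; sum     = λ u _ → HasSum-cong {a u}
              (ℂ.trans (partialSum-cong (a≈series u) K) (ℂ.sym (simplify u)))
              (HasSum-finite {a u} K (λ n → ℂ.trans (a≈series u (n ℕ.+ K))
                (ℂ.trans (ℂ.*-congʳ {u ^ (n ℕ.+ K)} (C≈0 n)) (ℂ.zeroˡ (u ^ (n ℕ.+ K))))))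
          }

      continuation : ∃[ r ] r Continues a OnDisc ρ
      continuation = quotient-continues quotient (here 1≉0)

      continuation-value : ∀ r → r Continues a OnDisc ρ → ∀ u → r RegularAt u → r ⟨ u ⟩ ≈ partialSum (series C u) K
      continuation-value r continues u regular = ℂ.trans (value quotient r continues u regular (unit≉0 u)) (simplify u)

    module Geometric {a : ℂ → ℕ → ℂ} {C : ℕ → ℂ} {s : ℂ} (K : ℕ)
      (a≈series : ∀ u n → a u n ≈ series C u n) (C≈sQ^n : ∀ n → C (n ℕ.+ K) ≈ s * Q ^ n) where

      private
        E N : List ℂ
        E = 1# ∷ - Q ∷ []
        -- The sum is ∑ Cₙ uⁿ over n < K plus s uᴷ/(1 - Q u); this is its numerator over the
        -- denominator `E`.
        N = List.applyUpTo C K ℂ.⊠ E ℂ.⊞ (List.replicate K 0# List.++ s ∷ [])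

        eval-E : ∀ u → ℂ.eval E u ≈ 1# - Q * u
        eval-E u = ℂ.solve 2 (λ Q u → :1 :+ u :* (:- Q :+ u :* con (+ 0)) := :1 :- Q :* u) ℂ.refl Q u

        eval-monomial : ∀ K u → ℂ.eval (List.replicate K 0# List.++ s ∷ []) u ≈ s * u ^ K
        eval-monomial zero    u = ℂ.solve 2 (λ s u → s :+ u :* con (+ 0) := s :* :1) ℂ.refl s u
        eval-monomial (suc K) u = ℂ.trans
          (ℂ.+-congˡ {0#} (ℂ.*-congˡ {u} (eval-monomial K u)))
          (ℂ.solve 3 (λ s u w → con (+ 0) :+ u :* (s :* w) := s :* (u :* w)) ℂ.refl s u (u ^ K))

        eval-N : ∀ u → ℂ.eval N u ≈ partialSum (series C u) K * (1# - Q * u) + s * u ^ K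
        eval-N u = ℂ.trans (ℂ.eval-⊞ (List.applyUpTo C K ℂ.⊠ E) _ u) (ℂ.+-cong
          (ℂ.trans (ℂ.eval-⊠ (List.applyUpTo C K) E u) (ℂ.*-cong (eval-applyUpTo C K u) (eval-E u)))
          (eval-monomial K u))

        simplify : ∀ u → 1# - Q * u ≉ 0# →
          ℂ.eval N u * ℂ.eval E u ⁻¹ ≈ partialSum (series C u) K + s * u ^ K * (1# - Q * u) ⁻¹
        simplify u X≉0 = ℂR.begin
          ℂ.eval N u * ℂ.eval E u ⁻¹  ℂR.≈⟨ ℂ.*-cong (eval-N u) (ℂ.sym (⁻¹-unique (ℂ.trans (ℂ.*-congʳ {i} (eval-E u)) Xi≈1))) ⟩
          (P * X + S) * i  ℂR.≈⟨ ℂ.solve 4 (λ P X S i → (P :* X :+ S) :* i := P :* (X :* i) :+ S :* i) ℂ.refl P X S i ⟩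
          P * (X * i) + S * i  ℂR.≈⟨ ℂ.+-congʳ {S * i} (ℂ.trans (ℂ.*-congˡ {P} Xi≈1) (ℂ.*-identityʳ P)) ⟩
          P + S * i  ℂR.∎
          where
          X = 1# - Q * u
          i = X ⁻¹
          P = partialSum (series C u) K
          S = s * u ^ K
          Xi≈1 : X * i ≈ 1#
          Xi≈1 = ⁻¹-inverseʳ X≉0

        tail-term : ∀ u n → a u (n ℕ.+ K) ≈ s * u ^ K * (Q * u) ^ n
        tail-term u n = ℂR.begin
          a u (n ℕ.+ K)  ℂR.≈⟨ a≈series u (n ℕ.+ K) ⟩
          C (n ℕ.+ K) * u ^ (n ℕ.+ K)  ℂR.≈⟨ ℂ.*-cong (C≈sQ^n n) (ℂ.^-homo-* u n K) ⟩
          s * Q ^ n * (u ^ n * u ^ K)  ℂR.≈⟨ ℂ.solve 4 (λ s x y z → s :* x :* (y :* z) := s :* z :* (x :* y)) ℂ.refl s (Q ^ n) (u ^ n) (u ^ K) ⟩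
          s * u ^ K * (Q ^ n * u ^ n)  ℂR.≈⟨ ℂ.*-congˡ {s * u ^ K} (ℂ.^-distrib-* Q u n) ⟨
          s * u ^ K * (Q * u) ^ n  ℂR.∎

        quotient : Quotient a N E
        quotient = record
          { nonzero = λ u u<ρ E≈0 → 1-z≉0 (∣Qu∣²<1 u u<ρ) (ℂ.trans (ℂ.sym (eval-E u)) E≈0)
          ; sum     = λ u u<ρ → HasSum-cong {a u}
              (ℂ.trans (ℂ.+-congʳ {s * u ^ K * (1# - Q * u) ⁻¹} (partialSum-cong (a≈series u) K))
                       (ℂ.sym (simplify u (1-z≉0 (∣Qu∣²<1 u u<ρ)))))
              (HasSum-geometric {a u} K (∣Qu∣²<1 u u<ρ) (tail-term u))
          }

      continuation : ∃[ r ] r Continues a OnDisc ρ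
      continuation = quotient-continues quotient (here 1≉0)

      continuation-value : ∀ r → r Continues a OnDisc ρ → ∀ u → r RegularAt u → 1# - Q * u ≉ 0# →
        r ⟨ u ⟩ ≈ partialSum (series C u) K + s * u ^ K * (1# - Q * u) ⁻¹
      continuation-value r continues u regular X≉0 = ℂ.trans
        (value quotient r continues u regular (λ E≈0 → X≉0 (ℂ.trans (ℂ.sym (eval-E u)) E≈0)))
        (simplify u X≉0)

      -- Where 1 - Q u vanishes, the numerator `N` takes the value s uᴷ, which is nonzero because Q
      -- u = 1 forces u ≠ 0. The pole is therefore genuine, and the denominator of any other
      -- continuation must vanish there too.
      pole : s ≉ 0# → ∀ r → r Continues a OnDisc ρ → ∀ u → r RegularAt u → 1# - Q * u ≉ 0#
      pole s≉0 r continues u regular X≈0 = *-≉0 {s * u ^ K} {evaluate (denominator r) u}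
        (*-≉0 {s} {u ^ K} s≉0 (^-≉0 K)) regular (ℂR.begin
        s * u ^ K * β  ℂR.≈⟨ ℂ.solve 3 (λ P S β → S :* β := (P :* con (+ 0) :+ S) :* β) ℂ.refl P (s * u ^ K) β ⟩
        (P * 0# + s * u ^ K) * β  ℂR.≈⟨ ℂ.*-congʳ {β} (ℂ.+-congʳ {s * u ^ K} (ℂ.*-congˡ {P} X≈0)) ⟨
        (P * (1# - Q * u) + s * u ^ K) * β ℂR.≈⟨ ℂ.*-congʳ {β} (eval-N u) ⟨
        ℂ.eval N u * β  ℂR.≈⟨ cross-multiplied quotient r continues u ⟨
        α * ℂ.eval E u  ℂR.≈⟨ ℂ.*-congˡ {α} (ℂ.trans (eval-E u) X≈0) ⟩
        α * 0#  ℂR.≈⟨ ℂ.zeroʳ α ⟩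
        0#  ℂR.∎)
        where
        P = partialSum (series C u) K
        α = evaluate (numerator r) u
        β = evaluate (denominator r) u
        u≉0 : u ≉ 0#
        u≉0 u≈0 = 1≉0 (ℂR.begin
          1#  ℂR.≈⟨ ℂ.x∙y⁻¹≈ε⇒x≈y 1# (Q * u) X≈0 ⟩
          Q * u  ℂR.≈⟨ ℂ.*-congˡ {Q} u≈0 ⟩
          Q * 0#  ℂR.≈⟨ ℂ.zeroʳ Q ⟩
          0#  ℂR.∎)
        ^-≉0 : ∀ n → u ^ n ≉ 0#
        ^-≉0 zero    = 1≉0
        ^-≉0 (suc n) = *-≉0 {u} {u ^ n} u≉0 (^-≉0 n)

-- Arithmetic modulo a prime

module PrimeBinomial {p : ℕ} (p-prime : Prime p) where

  prime∤! : ∀ k → k ℕ.< p → ¬ p ∣ k ℕ.!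
  prime∤! zero    _     p∣1 = contradiction (∣1⇒≡1 p∣1) (ℕ.nonTrivial⇒≢1 {{prime⇒nonTrivial p-prime}})
  prime∤! (suc k) 1+k<p p∣! with euclidsLemma (suc k) (k ℕ.!) p-prime p∣!
  ... | inj₁ p∣1+k = ℕ.<⇒≱ 1+k<p (∣⇒≤ p∣1+k)
  ... | inj₂ p∣k!  = prime∤! k (ℕ.<-trans (ℕ.n<1+n k) 1+k<p) p∣k!

  n∣n! : ∀ {n} → NonZero n → n ∣ n ℕ.!
  n∣n! {suc n} _ = m∣m*n (n ℕ.!)

  -- The prime divides p!, which is the binomial coefficient times k! (p - k)!, and it divides
  -- neither of these factorials.
  prime∣binomial : ∀ {k} → 0 ℕ.< k → k ℕ.< p → p ∣ p choose k
  prime∣binomial {k} 0<k k<p with euclidsLemma (p choose k) (k ℕ.! ℕ.* (p ℕ.∸ k) ℕ.!) p-prime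
    (≡.subst (p ∣_) (≡.sym factorised) (n∣n! (prime⇒nonZero p-prime)))
    where
    instance _ = k ℕ.!* (p ℕ.∸ k) !≢0
    factorised : (p choose k) ℕ.* (k ℕ.! ℕ.* (p ℕ.∸ k) ℕ.!) ≡ p ℕ.!
    factorised = ≡.trans (cong (λ b → b ℕ.* (k ℕ.! ℕ.* (p ℕ.∸ k) ℕ.!)) (nCk≡n!/k![n-k]! (ℕ.<⇒≤ k<p))) (m/n*n≡m (k![n∸k]!∣n! (ℕ.<⇒≤ k<p)))
  ... | inj₁ p∣C = p∣C
  ... | inj₂ p∣! with euclidsLemma (k ℕ.!) ((p ℕ.∸ k) ℕ.!) p-prime p∣!
  ...   | inj₁ p∣k!     = contradiction p∣k! (prime∤! k k<p)
  ...   | inj₂ p∣[p-k]! = contradiction p∣[p-k]! (prime∤! (p ℕ.∸ k) (ℕ.∸-monoʳ-< 0<k (ℕ.<⇒≤ k<p)))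

module CoprimeExponents {c ℓ} (M : Monoid c ℓ) where
  open Monoid M
  open MonoidMult M using (×-congʳ; ×-assocˡ) renaming (_×_ to _⊗_)
  open SetoidReasoning setoid

  multiple-trivial : ∀ {x} n → n ⊗ x ≈ ε → ∀ k → (k ℕ.* n) ⊗ x ≈ ε
  multiple-trivial {x} n nx≈ε k = begin
    (k ℕ.* n) ⊗ x  ≈⟨ ×-assocˡ x k n ⟨
    k ⊗ (n ⊗ x)  ≈⟨ ×-congʳ k nx≈ε ⟩
    k ⊗ ε  ≈⟨ trivial k ⟩
    ε  ∎
    where
    trivial : ∀ k → k ⊗ ε ≈ ε
    trivial zero    = refl
    trivial (suc k) = trans (identityˡ _) (trivial k)

  -- Bézout's identity in the form 1 + b n = a m, or with m and n exchanged, works in a monoid,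
  -- without inverses. It is applied additively to 1 in 𝔽 and multiplicatively to the root of unity.
  coprime-trivial : ∀ {x m n} → Coprime m n → m ⊗ x ≈ ε → n ⊗ x ≈ ε → x ≈ ε
  coprime-trivial {x} {m} {n} m⊥n mx≈ε nx≈ε with coprime-Bézout m⊥n
  ... | Bézout.+- a b eq = begin
    x  ≈⟨ identityʳ x ⟨
    x ∙ ε  ≈⟨ ∙-congˡ (multiple-trivial n nx≈ε b) ⟨
    x ∙ (b ℕ.* n) ⊗ x  ≡⟨ cong (_⊗ x) eq ⟩
    (a ℕ.* m) ⊗ x  ≈⟨ multiple-trivial m mx≈ε a ⟩
    ε  ∎
  ... | Bézout.-+ a b eq = begin
    x  ≈⟨ identityʳ x ⟨
    x ∙ ε  ≈⟨ ∙-congˡ (multiple-trivial m mx≈ε a) ⟨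
    x ∙ (a ℕ.* m) ⊗ x  ≡⟨ cong (_⊗ x) eq ⟩
    (b ℕ.* n) ⊗ x  ≈⟨ multiple-trivial n nx≈ε b ⟩
    ε  ∎

module FiniteSums {c ℓ} (M : CommutativeMonoid c ℓ) where
  open CommutativeMonoid M
  open MonoidSum M using (sum; sum-cong-≋; sum-replicate-zero)

  sum-single : ∀ {n} (t : Fin n → Carrier) i → (∀ j → j ≢ i → t j ≈ ε) → sum t ≈ t i
  sum-single {suc n} t zero    t≈ε = trans
    (∙-congˡ (trans (sum-cong-≋ (λ j → t≈ε (suc j) (λ ()))) (sum-replicate-zero n)))
    (identityʳ (t zero))
  sum-single {suc n} t (suc i) t≈ε = trans
    (∙-cong (t≈ε zero (λ ())) (sum-single (t ∘ suc) i (λ j j≢i → t≈ε (suc j) (j≢i ∘ Fin.suc-injective))))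
    (identityˡ (t (suc i)))

-- Finite fields: characteristic, Frobenius map, prime field and trace

module FiniteFieldTheory {f p η} (F : FiniteField f p η) where
  open FiniteField F using (_·_; Carrier; 0#; 1#; 0≢1; enumeration; q; _≟_; Tr; residue; elements; commutativeRing; inverse)
    renaming (prime to p-prime)
  module 𝔽 = CommutativeRing commutativeRing
  open 𝔽 using (_+_; _*_; -_; _-_)
  private
    module 𝔽S = IntegerSolver commutativeRing
    module 𝔽P = RingProperties 𝔽.ring
    open SemiringMult 𝔽.semiring using (×-homo-+; ×1-homo-*; ×-assoc-*) renaming (_×_ to _⊗_)
    open SemiringExp 𝔽.semiring using (_^_; ^-assocʳ)
    open Inverse enumeration using (to; from; strictlyInverseˡ; strictlyInverseʳ)
    open CauchyProduct commutativeRing using (Σ<; Σ<-suc)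
    open ListPolynomials commutativeRing
  open ≡-Reasoning

  instance
    p-nonZero : NonZero p
    p-nonZero = prime⇒nonZero p-prime

    q-nonZero : NonZero q
    q-nonZero = ℕ.m^n≢0 p η

  1<p : 1 ℕ.< p
  1<p = ℕ.nonTrivial⇒n>1 p {{prime⇒nonTrivial p-prime}}

  *-cancelˡ : ∀ {x y z} → x ≢ 0# → x * y ≡ x * z → y ≡ z
  *-cancelˡ {x} {y} {z} x≢0 xy≡xz = begin
    y  ≡⟨ expand y ⟨
    i * (x * y)  ≡⟨ cong (i *_) xy≡xz ⟩
    i * (x * z)  ≡⟨ expand z ⟩
    z  ∎
    where
    i = proj₁ (inverse x x≢0)
    expand : ∀ y → i * (x * y) ≡ y
    expand y = begin
      i * (x * y)  ≡⟨ 𝔽S.solve 3 (λ i x y → i :* (x :* y) := x :* i :* y) ≡.refl i x y ⟩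
      x * i * y  ≡⟨ cong (_* y) (proj₂ (inverse x x≢0)) ⟩
      1# * y  ≡⟨ 𝔽.*-identityˡ y ⟩
      y  ∎

  domain : ∀ x y → x * y ≡ 0# → x ≡ 0# ⊎ y ≡ 0#
  domain x y xy≡0 with x ≟ 0#
  ... | yes x≡0 = inj₁ x≡0
  ... | no  x≢0 = inj₂ (*-cancelˡ x≢0 (≡.trans xy≡0 (≡.sym (𝔽.zeroʳ x))))

  open Domain domain

  bijection : (σ τ : Carrier → Carrier) → (∀ x → σ (τ x) ≡ x) → (∀ x → τ (σ x) ≡ x) → Carrier ↔ Carrier
  bijection σ τ στ τσ = record
    { to = σ ; from = τ ; to-cong = cong σ ; from-cong = cong τ
    ; inverse = (λ { ≡.refl → στ _ }) , (λ { ≡.refl → τσ _ })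
    }

  translation : Carrier → Carrier ↔ Carrier
  translation y = bijection (_+ y) (_- y)
    (λ x → 𝔽S.solve 2 (λ x y → x :- y :+ y := x) ≡.refl x y)
    (λ x → 𝔽S.solve 2 (λ x y → x :+ y :- y := x) ≡.refl x y)

  scaling : ∀ {y} → y ≢ 0# → Carrier ↔ Carrier
  scaling {y} y≢0 = bijection (y *_) (i *_)
    (λ x → ≡.trans (≡.sym (𝔽.*-assoc y i x)) (≡.trans (cong (_* x) y*i≡1) (𝔽.*-identityˡ x)))
    (λ x → ≡.trans (≡.sym (𝔽.*-assoc i y x)) (≡.trans (cong (_* x) (≡.trans (𝔽.*-comm i y) y*i≡1)) (𝔽.*-identityˡ x)))
    where
    i = proj₁ (inverse y y≢0)
    y*i≡1 : y * i ≡ 1#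
    y*i≡1 = proj₂ (inverse y y≢0)

  module SumOver {c ℓ} (M : CommutativeMonoid c ℓ) where
    private
      module M = CommutativeMonoid M
    open MonoidSum M using (sum; sum-cong-≋; sum-permute; ∑-distrib-+; sum-replicate)
    open MonoidMult M.monoid using () renaming (_×_ to _⊛_)
    open FiniteSums M

    total : (Carrier → M.Carrier) → M.Carrier
    total g = sum (λ i → g (to i))

    total-cong : ∀ {g h} → (∀ x → g x M.≈ h x) → total g M.≈ total h
    total-cong g≈h = sum-cong-≋ (λ i → g≈h (to i))

    total-∙ : ∀ g h → total (λ x → g x M.∙ h x) M.≈ total g M.∙ total h
    total-∙ g h = ∑-distrib-+ (λ i → g (to i)) (λ i → h (to i))

    total-const : ∀ x → total (λ _ → x) M.≈ q ⊛ x
    total-const x = sum-replicate q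

    total-bijection : ∀ (σ : Carrier ↔ Carrier) g → total g M.≈ total (g ∘ Inverse.to σ)
    total-bijection σ g = M.trans
      (sum-permute (λ i → g (to i)) (permutation (λ i → from (Inverse.to σ (to i))) (λ i → from (Inverse.from σ (to i)))
        (λ i → ≡.trans (cong (from ∘ Inverse.to σ) (strictlyInverseˡ _)) (≡.trans (cong from (Inverse.strictlyInverseˡ σ _)) (strictlyInverseʳ i)))
        (λ i → ≡.trans (cong (from ∘ Inverse.from σ) (strictlyInverseˡ _)) (≡.trans (cong from (Inverse.strictlyInverseʳ σ _)) (strictlyInverseʳ i)))))
      (sum-cong-≋ {q} (λ i → M.reflexive (cong g (strictlyInverseˡ (Inverse.to σ (to i))))))

    total-single : ∀ g x → (∀ y → y ≢ x → g y M.≈ M.ε) → total g M.≈ g x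
    total-single g x g≈ε = M.trans
      (sum-single (λ i → g (to i)) (from x) (λ j j≢ → g≈ε (to j) (λ eq → j≢ (≡.trans (≡.sym (strictlyInverseʳ j)) (cong from eq)))))
      (M.reflexive (cong g (strictlyInverseˡ x)))

  -- Translation by x permutes the field, so the sum of all elements absorbs q x.
  q×≡0 : ∀ x → q ⊗ x ≡ 0#
  q×≡0 x = 𝔽P.+-cancelˡ (total (λ y → y)) _ _ (begin
    total (λ y → y) + q ⊗ x  ≡⟨ 𝔽.+-congˡ (total-const x) ⟨
    total (λ y → y) + total (λ _ → x)  ≡⟨ total-∙ (λ y → y) (λ _ → x) ⟨
    total (λ y → y + x)  ≡⟨ total-bijection (translation x) (λ y → y) ⟨
    total (λ y → y)  ≡⟨ 𝔽.+-identityʳ _ ⟨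
    total (λ y → y) + 0#  ∎)
    where open SumOver 𝔽.+-commutativeMonoid

  -- The multiple of 1 by pⁿ is the n-th power of the multiple by p, and a field has no zero
  -- divisors.
  p×1≡0 : p ⊗ 1# ≡ 0#
  p×1≡0 = root η (q×≡0 1#)
    where
    root : ∀ n → (p ℕ.^ n) ⊗ 1# ≡ 0# → p ⊗ 1# ≡ 0#
    root zero    1≡0 = contradiction (≡.trans (≡.sym 1≡0) (𝔽.+-identityʳ 1#)) 0≢1
    root (suc n) eq with domain _ _ (≡.trans (≡.sym (×1-homo-* p (p ℕ.^ n))) eq)
    ... | inj₁ p≡0  = p≡0
    ... | inj₂ pⁿ≡0 = root n pⁿ≡0

  p×≡0 : ∀ x → p ⊗ x ≡ 0#
  p×≡0 x = begin
    p ⊗ x  ≡⟨ cong (p ⊗_) (𝔽.*-identityˡ x) ⟨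
    p ⊗ (1# * x)  ≡⟨ ×-assoc-* p 1# x ⟨
    (p ⊗ 1#) * x  ≡⟨ cong (_* x) p×1≡0 ⟩
    0# * x  ≡⟨ 𝔽.zeroˡ x ⟩
    0#  ∎

  small×1≢0 : ∀ {k} → 0 ℕ.< k → k ℕ.< p → k ⊗ 1# ≢ 0#
  small×1≢0 {k} 0<k k<p k×1≡0 = 0≢1 (≡.sym
    (CoprimeExponents.coprime-trivial 𝔽.+-monoid (prime⇒coprime p-prime {{ℕ.>-nonZero 0<k}} k<p) p×1≡0 k×1≡0))

  multiples-distinct : ∀ {i j} → i ℕ.< j → j ℕ.< p → i ⊗ 1# ≢ j ⊗ 1#
  multiples-distinct {i} {j} i<j j<p eq = small×1≢0 (ℕ.m<n⇒0<n∸m i<j) (ℕ.≤-<-trans (ℕ.m∸n≤m j i) j<p)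
    (𝔽P.+-cancelˡ (i ⊗ 1#) _ _ (begin
      i ⊗ 1# + (j ℕ.∸ i) ⊗ 1#  ≡⟨ ×-homo-+ 1# i (j ℕ.∸ i) ⟨
      (i ℕ.+ (j ℕ.∸ i)) ⊗ 1#  ≡⟨ cong (_⊗ 1#) (ℕ.m+[n∸m]≡n (ℕ.<⇒≤ i<j)) ⟩
      j ⊗ 1#  ≡⟨ eq ⟨
      i ⊗ 1#  ≡⟨ 𝔽.+-identityʳ _ ⟨
      i ⊗ 1# + 0#  ∎))

  n×1≡0⇒p∣n : ∀ n → n ⊗ 1# ≡ 0# → p ∣ n
  n×1≡0⇒p∣n n n×1≡0 with n % p ℕ.≟ 0
  ... | yes n%p≡0 = m%n≡0⇒n∣m n p n%p≡0
  ... | no  n%p≢0 = contradiction r×1≡0 (small×1≢0 (ℕ.n≢0⇒n>0 n%p≢0) (m%n<n n p))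
    where
    r×1≡0 : (n % p) ⊗ 1# ≡ 0#
    r×1≡0 = begin
      (n % p) ⊗ 1#  ≡⟨ 𝔽.+-identityʳ _ ⟨
      (n % p) ⊗ 1# + 0#  ≡⟨ 𝔽.+-congˡ (CoprimeExponents.multiple-trivial 𝔽.+-monoid p p×1≡0 (n / p)) ⟨
      (n % p) ⊗ 1# + (n / p ℕ.* p) ⊗ 1#  ≡⟨ ×-homo-+ 1# (n % p) (n / p ℕ.* p) ⟨
      (n % p ℕ.+ n / p ℕ.* p) ⊗ 1#  ≡⟨ cong (_⊗ 1#) (m≡m%n+[m/n]*n n p) ⟨
      n ⊗ 1#  ≡⟨ n×1≡0 ⟩
      0#  ∎

  0^n≡0 : ∀ n .{{_ : NonZero n}} → 0# ^ n ≡ 0#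
  0^n≡0 (suc n) = 𝔽.zeroˡ _

  -- Multiplication by y permutes the nonzero elements; zero is replaced by one so
  -- that the products run over the whole field.
  x^q≡x : ∀ y → y ^ q ≡ y
  x^q≡x y with y ≟ 0#
  ... | yes ≡.refl = 0^n≡0 q
  ... | no y≢0 = begin
    y ^ q  ≡⟨ total-const y ⟨
    total (λ _ → y)  ≡⟨ total-cong split-y ⟨
    total (λ x → δ x * ψ x)  ≡⟨ total-∙ δ ψ ⟩
    total δ * total ψ  ≡⟨ ≡.cong₂ _*_ total-δ total-ψ ⟩
    y * 1#  ≡⟨ 𝔽.*-identityʳ y ⟩
    y  ∎
    where
    open SumOver 𝔽.*-commutativeMonoid
    choose : ∀ {a} {A : Set a} → Dec A → Carrier → Carrier → Carrier
    choose (yes _) u v = u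
    choose (no _)  u v = v
    -- The constant y is split as `δ x * ψ x`: `δ` carries it at zero and `ψ` at all other elements.
    -- The product of `δ` over the field is y, so it remains to see that the product of `ψ` is 1;
    -- `φ` is the product of nonzero elements that scaling by y permutes.
    φ ψ δ : Carrier → Carrier
    φ x = choose (x ≟ 0#) 1# x
    ψ x = choose (x ≟ 0#) 1# y
    δ x = choose (x ≟ 0#) y 1#
    split-y : ∀ x → δ x * ψ x ≡ y
    split-y x with x ≟ 0#
    ... | yes _ = 𝔽.*-identityʳ y
    ... | no _  = 𝔽.*-identityˡ y
    total-δ : total δ ≡ y
    total-δ = ≡.trans (total-single δ 0# off-zero) at-zero
      where
      off-zero : ∀ x → x ≢ 0# → δ x ≡ 1#
      off-zero x x≢0 with x ≟ 0#
      ... | yes x≡0 = contradiction x≡0 x≢0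
      ... | no _    = ≡.refl
      at-zero : δ 0# ≡ y
      at-zero with 0# ≟ 0#
      ... | yes _   = ≡.refl
      ... | no  0≢0 = contradiction ≡.refl 0≢0
    φ-scale : ∀ x → φ (y * x) ≡ ψ x * φ x
    φ-scale x with x ≟ 0# | y * x ≟ 0#
    ... | yes _   | yes _    = ≡.sym (𝔽.*-identityʳ 1#)
    ... | no _    | no _     = ≡.refl
    ... | yes x≡0 | no yx≢0  = contradiction (≡.trans (cong (y *_) x≡0) (𝔽.zeroʳ y)) yx≢0
    ... | no x≢0  | yes yx≡0 with domain y x yx≡0
    ...   | inj₁ y≡0 = contradiction y≡0 y≢0
    ...   | inj₂ x≡0 = contradiction x≡0 x≢0
    φ≢0 : ∀ x → φ x ≢ 0#
    φ≢0 x with x ≟ 0#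
    ... | yes _  = 0≢1 ∘ ≡.sym
    ... | no x≢0 = x≢0
    open MonoidSum 𝔽.*-commutativeMonoid using (sum)
    product≢0 : ∀ {n} (t : Fin n → Carrier) → (∀ i → t i ≢ 0#) → sum t ≢ 0#
    product≢0 {zero}  t t≢0 1≡0 = 0≢1 (≡.sym 1≡0)
    product≢0 {suc n} t t≢0 eq with domain _ _ eq
    ... | inj₁ t₀≡0 = t≢0 zero t₀≡0
    ... | inj₂ ts≡0 = product≢0 (t ∘ suc) (t≢0 ∘ suc) ts≡0
    total-ψ : total ψ ≡ 1#
    total-ψ = *-cancelˡ (product≢0 (φ ∘ to) (φ≢0 ∘ to)) (begin
      total φ * total ψ  ≡⟨ 𝔽.*-comm _ _ ⟩
      total ψ * total φ  ≡⟨ total-∙ ψ φ ⟨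
      total (λ x → ψ x * φ x)  ≡⟨ total-cong φ-scale ⟨
      total (λ x → φ (y * x))  ≡⟨ total-bijection (scaling y≢0) φ ⟨
      total φ  ≡⟨ 𝔽.*-identityʳ _ ⟨
      total φ * 1#  ∎)

  frobenius : ∀ x y → (x + y) ^ p ≡ x ^ p + y ^ p
  frobenius x y = ≡.trans (Binomial.theorem 𝔽.commutativeSemiring p x y) (expansion p ≡.refl)
    where
    open MonoidSum 𝔽.+-commutativeMonoid using (sum; sum-cong-≋; sum-replicate-zero; sum-init-last)
    open PrimeBinomial p-prime
    term : ∀ n → Fin (suc n) → Carrier
    term n k = (n choose toℕ k) ⊗ (x ^ toℕ k * y ^ (n ℕ.∸ toℕ k))
    divisible×≡0 : ∀ {n} z → p ∣ n → n ⊗ z ≡ 0#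
    divisible×≡0 z (divides k ≡.refl) = CoprimeExponents.multiple-trivial 𝔽.+-monoid p (p×≡0 z) k
    -- A variable equal to p can be matched as a successor, which splits off the two extreme terms.
    expansion : ∀ n → n ≡ p → sum (term n) ≡ x ^ n + y ^ n
    expansion zero    0≡p = contradiction (≡.sym 0≡p) (ℕ.≢-nonZero⁻¹ p)
    expansion (suc n) ≡.refl = begin
      term (suc n) zero + sum (λ k → term (suc n) (suc k))
        ≡⟨ cong₂ _+_ first (sum-init-last (λ k → term (suc n) (suc k))) ⟩
      y ^ suc n + (sum (λ k → term (suc n) (suc (Fin.inject₁ k))) + term (suc n) (suc (Fin.fromℕ n)))
        ≡⟨ 𝔽.+-congˡ (cong₂ _+_ middle last) ⟩
      y ^ suc n + (0# + x ^ suc n)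
        ≡⟨ 𝔽S.solve 2 (λ x y → y :+ (con (+ 0) :+ x) := x :+ y) ≡.refl (x ^ suc n) (y ^ suc n) ⟩
      x ^ suc n + y ^ suc n ∎
      where
      open ≡ using (cong₂)
      first : term (suc n) zero ≡ y ^ suc n
      first = ≡.trans (𝔽.+-identityʳ _) (𝔽.*-identityˡ _)
      last : term (suc n) (suc (Fin.fromℕ n)) ≡ x ^ suc n
      last = begin
        term (suc n) (Fin.fromℕ (suc n))  ≡⟨ cong (λ k → (suc n choose k) ⊗ (x ^ k * y ^ (suc n ℕ.∸ k))) (Fin.toℕ-fromℕ (suc n)) ⟩
        (suc n choose suc n) ⊗ (x ^ suc n * y ^ (n ℕ.∸ n))  ≡⟨ ≡.cong₂ (λ b k → b ⊗ (x ^ suc n * y ^ k)) (nCn≡1 (suc n)) (ℕ.n∸n≡0 n) ⟩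
        1 ⊗ (x ^ suc n * 1#)  ≡⟨ 𝔽.+-identityʳ _ ⟩
        x ^ suc n * 1#  ≡⟨ 𝔽.*-identityʳ _ ⟩
        x ^ suc n  ∎
      middle : sum (λ k → term (suc n) (suc (Fin.inject₁ k))) ≡ 0#
      middle = ≡.trans (sum-cong-≋ (λ k → divisible×≡0 _ (prime∣binomial (ℕ.s≤s ℕ.z≤n)
        (ℕ.s≤s (≡.subst (ℕ._< n) (≡.sym (Fin.toℕ-inject₁ k)) (Fin.toℕ<n k)))))) (sum-replicate-zero n)

  x^1≡x : ∀ x → x ^ 1 ≡ x
  x^1≡x = 𝔽.*-identityʳ

  frobenius-^ : ∀ i x y → (x + y) ^ (p ℕ.^ i) ≡ x ^ (p ℕ.^ i) + y ^ (p ℕ.^ i)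
  frobenius-^ zero    x y = ≡.trans (x^1≡x (x + y)) (≡.sym (≡.cong₂ _+_ (x^1≡x x) (x^1≡x y)))
  frobenius-^ (suc i) x y = begin
    (x + y) ^ (p ℕ.* p ℕ.^ i)  ≡⟨ ^-assocʳ (x + y) p (p ℕ.^ i) ⟨
    ((x + y) ^ p) ^ (p ℕ.^ i)  ≡⟨ cong (_^ (p ℕ.^ i)) (frobenius x y) ⟩
    (x ^ p + y ^ p) ^ (p ℕ.^ i)  ≡⟨ frobenius-^ i (x ^ p) (y ^ p) ⟩
    (x ^ p) ^ (p ℕ.^ i) + (y ^ p) ^ (p ℕ.^ i)  ≡⟨ ≡.cong₂ _+_ (^-assocʳ x p (p ℕ.^ i)) (^-assocʳ y p (p ℕ.^ i)) ⟩
    x ^ (p ℕ.* p ℕ.^ i) + y ^ (p ℕ.* p ℕ.^ i)  ∎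

  trace : ℕ → Carrier → Carrier
  trace n y = Σ< (λ i → y ^ (p ℕ.^ i)) n

  Tr≡trace : ∀ y → Tr y ≡ trace η y
  Tr≡trace y = upTo-sum (λ i → i) η
    where
    upTo-sum : ∀ (g : ℕ → ℕ) n →
      List.foldr (λ i s → y ^ (p ℕ.^ i) + s) 0# (List.applyUpTo g n) ≡ Σ< (λ i → y ^ (p ℕ.^ g i)) n
    upTo-sum g zero    = ≡.refl
    upTo-sum g (suc n) = ≡.trans (𝔽.+-congˡ (upTo-sum (g ∘ suc) n)) (≡.sym (Σ<-suc (λ i → y ^ (p ℕ.^ g i)) n))

  trace-+ : ∀ n x y → trace n (x + y) ≡ trace n x + trace n y
  trace-+ zero    x y = ≡.sym (𝔽.+-identityʳ 0#)
  trace-+ (suc n) x y = ≡.trans (≡.cong₂ _+_ (trace-+ n x y) (frobenius-^ n x y))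
    (𝔽S.solve 4 (λ a b c d → a :+ b :+ (c :+ d) := a :+ c :+ (b :+ d)) ≡.refl (trace n x) (trace n y) (x ^ (p ℕ.^ n)) (y ^ (p ℕ.^ n)))

  Tr-+ : ∀ x y → Tr (x + y) ≡ Tr x + Tr y
  Tr-+ x y = begin
    Tr (x + y)  ≡⟨ Tr≡trace (x + y) ⟩
    trace η (x + y)  ≡⟨ trace-+ η x y ⟩
    trace η x + trace η y  ≡⟨ ≡.cong₂ _+_ (Tr≡trace x) (Tr≡trace y) ⟨
    Tr x + Tr y  ∎

  trace-^p : ∀ n y → trace n y ^ p ≡ Σ< (λ i → y ^ (p ℕ.^ suc i)) n
  trace-^p zero    y = 0^n≡0 p
  trace-^p (suc n) y = begin
    (trace n y + y ^ (p ℕ.^ n)) ^ p  ≡⟨ frobenius _ _ ⟩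
    trace n y ^ p + (y ^ (p ℕ.^ n)) ^ p  ≡⟨ ≡.cong₂ _+_ (trace-^p n y) (^-assocʳ y (p ℕ.^ n) p) ⟩
    _ + y ^ (p ℕ.^ n ℕ.* p)  ≡⟨ cong (λ k → Σ< (λ i → y ^ (p ℕ.^ suc i)) n + y ^ k) (ℕ.*-comm (p ℕ.^ n) p) ⟩
    Σ< (λ i → y ^ (p ℕ.^ suc i)) n + y ^ (p ℕ.^ suc n) ∎

  -- Raising to the power p permutes the conjugates of y cyclically.
  Tr-^p : ∀ y → Tr y ^ p ≡ Tr y
  Tr-^p y = begin
    Tr y ^ p  ≡⟨ cong (_^ p) (Tr≡trace y) ⟩
    trace η y ^ p  ≡⟨ trace-^p η y ⟩
    Σ< (conjugate ∘ suc) η  ≡⟨ 𝔽P.+-cancelˡ (conjugate 0) _ _ rotated ⟩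
    trace η y  ≡⟨ Tr≡trace y ⟨
    Tr y  ∎
    where
    conjugate : ℕ → Carrier
    conjugate i = y ^ (p ℕ.^ i)
    rotated : conjugate 0 + Σ< (conjugate ∘ suc) η ≡ conjugate 0 + Σ< conjugate η
    rotated = begin
      conjugate 0 + Σ< (conjugate ∘ suc) η  ≡⟨ Σ<-suc conjugate η ⟨
      Σ< conjugate η + conjugate η  ≡⟨ 𝔽.+-congˡ (≡.trans (x^q≡x y) (≡.sym (x^1≡x y))) ⟩
      Σ< conjugate η + conjugate 0  ≡⟨ 𝔽.+-comm _ _ ⟩
      conjugate 0 + Σ< conjugate η  ∎

  monomial : ℕ → List Carrier
  monomial n = List.replicate n 0# List.++ 1# ∷ []

  eval-monomial : ∀ n x → eval (monomial n) x ≡ x ^ n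
  eval-monomial zero    x = ≡.trans (𝔽.+-congˡ (𝔽.zeroʳ x)) (𝔽.+-identityʳ 1#)
  eval-monomial (suc n) x = ≡.trans (𝔽.+-identityˡ _) (𝔽.*-congˡ (eval-monomial n x))

  length-⊞-monomial : ∀ as n → List.length as ℕ.≤ n → List.length (as ⊞ monomial n) ≡ suc n
  length-⊞-monomial []       zero    _        = ≡.refl
  length-⊞-monomial []       (suc n) _        = cong suc (length-⊞-monomial [] n ℕ.z≤n)
  length-⊞-monomial (a ∷ as) (suc n) (ℕ.s≤s l) = cong suc (length-⊞-monomial as n l)

  ⊞-monomial≢0 : ∀ as n → List.length as ℕ.≤ n → ¬ All (_≡ 0#) (as ⊞ monomial n)
  ⊞-monomial≢0 []       zero    _         (1≡0 ∷ _) = 0≢1 (≡.sym 1≡0)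
  ⊞-monomial≢0 []       (suc n) _         (_ ∷ zs)  = ⊞-monomial≢0 [] n ℕ.z≤n zs
  ⊞-monomial≢0 (a ∷ as) (suc n) (ℕ.s≤s l) (_ ∷ zs)  = ⊞-monomial≢0 as n l zs

  -- The p elements k · 1 already exhaust the roots of X^p - X.
  prime-field : ∀ x → x ^ p ≡ x → ∃[ k ] toℕ {p} k ⊗ 1# ≡ x
  prime-field x x^p≡x with Fin.any? {n = p} (λ k → toℕ k ⊗ 1# ≟ x)
  ... | yes found = found
  ... | no absent = contradiction (roots⇒zero P roots length-P distinct all-roots) (⊞-monomial≢0 (0# ∷ - 1# ∷ []) p 1<p)
    where
    P roots : List Carrier
    P = (0# ∷ - 1# ∷ []) ⊞ monomial p
    roots = x ∷ List.applyUpTo (_⊗ 1#) p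
    length-P : List.length P ℕ.≤ List.length roots
    length-P = ℕ.≤-reflexive (≡.trans (length-⊞-monomial (0# ∷ - 1# ∷ []) p 1<p)
      (cong suc (≡.sym (List.length-applyUpTo (_⊗ 1#) p))))
    distinct : AllPairs _≢_ roots
    distinct = All.applyUpTo⁺₁ (_⊗ 1#) p (λ {i} i<p x≡i → absent (Fin.fromℕ< i<p ,
        ≡.trans (cong (_⊗ 1#) (Fin.toℕ-fromℕ< i<p)) (≡.sym x≡i)))
      ∷ AllPairs.applyUpTo⁺₁ (_⊗ 1#) p multiples-distinct
    eval-P : ∀ y → y ^ p ≡ y → eval P y ≡ 0#
    eval-P y y^p≡y = begin
      eval P y  ≡⟨ eval-⊞ (0# ∷ - 1# ∷ []) (monomial p) y ⟩
      0# + y * (- 1# + y * 0#) + eval (monomial p) y  ≡⟨ 𝔽.+-congˡ (≡.trans (eval-monomial p y) y^p≡y) ⟩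
      0# + y * (- 1# + y * 0#) + y  ≡⟨ 𝔽S.solve 1 (λ y → con (+ 0) :+ y :* (:- :1 :+ y :* con (+ 0)) :+ y := con (+ 0)) ≡.refl y ⟩
      0#  ∎
    multiple-^p : ∀ k → (k ⊗ 1#) ^ p ≡ k ⊗ 1#
    multiple-^p zero    = 0^n≡0 p
    multiple-^p (suc k) = ≡.trans (frobenius 1# (k ⊗ 1#)) (≡.cong₂ _+_ (1^n≡1 p) (multiple-^p k))
      where
      1^n≡1 : ∀ n → 1# ^ n ≡ 1#
      1^n≡1 zero    = ≡.refl
      1^n≡1 (suc n) = ≡.trans (𝔽.*-identityˡ _) (1^n≡1 n)
    all-roots : All (λ r → eval P r ≡ 0#) roots
    all-roots = eval-P x x^p≡x ∷ All.applyUpTo⁺₂ (_⊗ 1#) p (λ k → eval-P (k ⊗ 1#) (multiple-^p k))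

  -- Fixed points of the Frobenius map lie in the prime field, so the dummy branch of `residue` is
  -- not reached.
  residue-multiple : ∀ x → x ^ p ≡ x → residue x ⊗ 1# ≡ x
  residue-multiple x x^p≡x with Fin.any? {n = p} (λ k → toℕ k · 1# ≟ x)
  ... | yes (_ , k≡x) = k≡x
  ... | no absent     = contradiction (prime-field x x^p≡x) absent

  residue-Tr : ∀ y → residue (Tr y) ⊗ 1# ≡ Tr y
  residue-Tr y = residue-multiple (Tr y) (Tr-^p y)

  residue<p : ∀ x → residue x ℕ.< p
  residue<p x with Fin.any? {n = p} (λ k → toℕ k · 1# ≟ x)
  ... | yes (k , _) = Fin.toℕ<n k
  ... | no _        = ℕ.<-trans (ℕ.s≤s ℕ.z≤n) 1<p

  trace-polynomial : ℕ → List Carrier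
  trace-polynomial zero    = []
  trace-polynomial (suc n) = trace-polynomial n ⊞ monomial (p ℕ.^ n)

  length-trace-polynomial : ∀ n → List.length (trace-polynomial n) ℕ.≤ p ℕ.^ n
  length-trace-polynomial zero    = ℕ.z≤n
  length-trace-polynomial (suc n) = ℕ.≤-trans
    (ℕ.≤-reflexive (length-⊞-monomial (trace-polynomial n) (p ℕ.^ n) (length-trace-polynomial n)))
    (ℕ.^-monoʳ-< p 1<p (ℕ.n<1+n n))

  eval-trace-polynomial : ∀ n y → eval (trace-polynomial n) y ≡ trace n y
  eval-trace-polynomial zero    y = ≡.refl
  eval-trace-polynomial (suc n) y = ≡.trans (eval-⊞ (trace-polynomial n) (monomial (p ℕ.^ n)) y)
    (≡.cong₂ _+_ (eval-trace-polynomial n y) (eval-monomial (p ℕ.^ n) y))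

  -- A nonzero polynomial of degree q/p cannot vanish on all q elements.
  Tr≢0 : ¬ (∀ y → Tr y ≡ 0#)
  Tr≢0 Tr≡0 = trace≢0 η ≡.refl
    where
    trace≢0 : ∀ n → n ≢ η
    -- For η = 0 the field would have q = 1, and the q-fold multiple of 1 vanishes.
    trace≢0 zero    0≡η = 0≢1 (begin
      0#  ≡⟨ q×≡0 1# ⟨
      q ⊗ 1#  ≡⟨ cong (λ n → (p ℕ.^ n) ⊗ 1#) 0≡η ⟨
      1# + 0#  ≡⟨ 𝔽.+-identityʳ 1# ⟩
      1#  ∎)
    trace≢0 (suc n) 1+n≡η = ⊞-monomial≢0 (trace-polynomial n) (p ℕ.^ n) (length-trace-polynomial n)
      (roots⇒zero (trace-polynomial (suc n)) (List.tabulate to)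
        (ℕ.≤-trans (length-trace-polynomial (suc n)) (ℕ.≤-reflexive (≡.trans (cong (p ℕ.^_) 1+n≡η) (≡.sym (List.length-tabulate to)))))
        (AllPairs.tabulate⁺ (λ i≢j eq → i≢j (≡.trans (≡.sym (strictlyInverseʳ _)) (≡.trans (cong from eq) (strictlyInverseʳ _)))))
        (All.tabulate⁺ (λ i → begin
          eval (trace-polynomial (suc n)) (to i)  ≡⟨ eval-trace-polynomial (suc n) (to i) ⟩
          trace (suc n) (to i)  ≡⟨ cong (λ m → trace m (to i)) 1+n≡η ⟩
          trace η (to i)  ≡⟨ Tr≡trace (to i) ⟨
          Tr (to i)  ≡⟨ Tr≡0 (to i) ⟩
          0#  ∎)))

-- Sums over lists and over the elements of a finite field

module ListSums {c ℓ} (K : CommutativeRing c ℓ) where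
  open CommutativeRing K
  open IntegerSolver K
  open MonoidSum +-commutativeMonoid using (sum)

  -- For K = ℂ this unfolds to the sum used in the definitions of 𝒵 and 𝒟₁.
  ∑ : ∀ {a} {A : Set a} → List A → (A → Carrier) → Carrier
  ∑ xs g = List.foldr (λ x s → g x + s) 0# xs

  -- The Iverson bracket with values in K; it turns filters and counts into sums.
  [_] : ∀ {a} {A : Set a} → Dec A → Carrier
  [ yes _ ] = 1#
  [ no _ ]  = 0#

  []-yes : ∀ {a} {A : Set a} (d : Dec A) → A → [ d ] ≈ 1#
  []-yes (yes _) _ = refl
  []-yes (no ¬a) a = contradiction a ¬a

  []-no : ∀ {a} {A : Set a} (d : Dec A) → ¬ A → [ d ] ≈ 0#
  []-no (yes a) ¬a = contradiction a ¬a
  []-no (no _)  _  = refl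

  []-cong : ∀ {a b} {A : Set a} {B : Set b} (d : Dec A) (e : Dec B) → (A → B) → (B → A) → [ d ] ≈ [ e ]
  []-cong (yes a) e to from = sym ([]-yes e (to a))
  []-cong (no ¬a) e to from = sym ([]-no e (¬a ∘ from))

  []-× : ∀ {a b c} {A : Set a} {B : Set b} {C : Set c} (d : Dec A) (e : Dec B) (f : Dec C) →
         (C → A × B) → (A → B → C) → [ f ] ≈ [ d ] * [ e ]
  []-× (yes a) (yes b) f to from = trans ([]-yes f (from a b)) (sym (*-identityˡ 1#))
  []-× (no ¬a) e       f to from = trans ([]-no f (¬a ∘ proj₁ ∘ to)) (sym (zeroˡ _))
  []-× (yes _) (no ¬b) f to from = trans ([]-no f (¬b ∘ proj₂ ∘ to)) (sym (zeroʳ _))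

  module _ {a} {A : Set a} where

    ∑-cong : ∀ {g h : A → Carrier} → (∀ x → g x ≈ h x) → ∀ xs → ∑ xs g ≈ ∑ xs h
    ∑-cong g≈h []       = refl
    ∑-cong g≈h (x ∷ xs) = +-cong (g≈h x) (∑-cong g≈h xs)

    ∑-zero : ∀ (xs : List A) → ∑ xs (λ _ → 0#) ≈ 0#
    ∑-zero []       = refl
    ∑-zero (x ∷ xs) = trans (+-identityˡ _) (∑-zero xs)

    ∑-+ : ∀ (g h : A → Carrier) xs → ∑ xs (λ x → g x + h x) ≈ ∑ xs g + ∑ xs h
    ∑-+ g h []       = sym (+-identityˡ 0#)
    ∑-+ g h (x ∷ xs) = trans (+-congˡ (∑-+ g h xs))
      (solve 4 (λ a b c d → a :+ b :+ (c :+ d) := a :+ c :+ (b :+ d)) refl (g x) (h x) (∑ xs g) (∑ xs h))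

    ∑-*ˡ : ∀ k (g : A → Carrier) xs → ∑ xs (λ x → k * g x) ≈ k * ∑ xs g
    ∑-*ˡ k g []       = sym (zeroʳ k)
    ∑-*ˡ k g (x ∷ xs) = trans (+-congˡ (∑-*ˡ k g xs)) (sym (distribˡ k (g x) (∑ xs g)))

    ∑-*ʳ : ∀ k (g : A → Carrier) xs → ∑ xs (λ x → g x * k) ≈ ∑ xs g * k
    ∑-*ʳ k g []       = sym (zeroˡ k)
    ∑-*ʳ k g (x ∷ xs) = trans (+-congˡ (∑-*ʳ k g xs)) (sym (distribʳ k (g x) (∑ xs g)))

    ∑-++ : ∀ (g : A → Carrier) xs ys → ∑ (xs List.++ ys) g ≈ ∑ xs g + ∑ ys g
    ∑-++ g []       ys = sym (+-identityˡ _)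
    ∑-++ g (x ∷ xs) ys = trans (+-congˡ (∑-++ g xs ys)) (sym (+-assoc _ _ _))

    ∑-filter : ∀ {p} {P : A → Set p} (P? : ∀ x → Dec (P x)) (g : A → Carrier) xs →
               ∑ (List.filter P? xs) g ≈ ∑ xs (λ x → [ P? x ] * g x)
    ∑-filter P? g []       = refl
    ∑-filter P? g (x ∷ xs) with P? x
    ... | yes _ = +-cong (sym (*-identityˡ (g x))) (∑-filter P? g xs)
    ... | no _  = trans (∑-filter P? g xs) (sym (trans (+-congʳ (zeroˡ (g x))) (+-identityˡ _)))

    ∑-tabulate : ∀ {n} (h : Fin n → A) (g : A → Carrier) → ∑ (List.tabulate h) g ≈ sum (λ i → g (h i))
    ∑-tabulate {zero}  h g = refl
    ∑-tabulate {suc n} h g = +-congˡ (∑-tabulate (h ∘ suc) g)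

  module _ {a b} {A : Set a} {B : Set b} where

    ∑-map : ∀ (h : A → B) (g : B → Carrier) xs → ∑ (List.map h xs) g ≈ ∑ xs (g ∘ h)
    ∑-map h g []       = refl
    ∑-map h g (x ∷ xs) = +-congˡ (∑-map h g xs)

    ∑-comm : ∀ (g : A → B → Carrier) xs ys → ∑ xs (λ x → ∑ ys (g x)) ≈ ∑ ys (λ y → ∑ xs (λ x → g x y))
    ∑-comm g []       ys = sym (∑-zero ys)
    ∑-comm g (x ∷ xs) ys = trans (+-congˡ (∑-comm g xs ys)) (sym (∑-+ (g x) (λ y → ∑ xs (λ x → g x y)) ys))

    ∑-cartesianProductWith : ∀ {c} {C : Set c} (h : A → B → C) (g : C → Carrier) xs ys →
      ∑ (List.cartesianProductWith h xs ys) g ≈ ∑ xs (λ x → ∑ ys (λ y → g (h x y)))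
    ∑-cartesianProductWith h g []       ys = refl
    ∑-cartesianProductWith h g (x ∷ xs) ys = trans
      (∑-++ g (List.map (h x) ys) (List.cartesianProductWith h xs ys))
      (+-cong (∑-map′ ys) (∑-cartesianProductWith h g xs ys))
      where
      ∑-map′ : ∀ ys → ∑ (List.map (h x) ys) g ≈ ∑ ys (λ y → g (h x y))
      ∑-map′ []       = refl
      ∑-map′ (y ∷ ys) = +-congˡ (∑-map′ ys)

module FieldSums {c ℓ f p η} (K : CommutativeRing c ℓ) (F : FiniteField f p η) where
  open CommutativeRing K
  open FiniteField F using (enumeration; elements; units; q) renaming (Carrier to 𝔽; 0# to 0F; _≟_ to _≟F_)
  open FiniteFieldTheory F hiding (*-cancelˡ; domain)
  open SumOver +-commutativeMonoid
  open ListSums K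
  open SemiringMult semiring using () renaming (_×_ to _⊗_)
  open SetoidReasoning setoid

  ∑-elements : ∀ g → ∑ elements g ≈ total g
  ∑-elements g = trans (∑-map (Inverse.to enumeration) g (List.allFin q)) (∑-tabulate (λ i → i) (g ∘ Inverse.to enumeration))

  ∑-elements-bijection : ∀ (σ : 𝔽 ↔ 𝔽) g → ∑ elements g ≈ ∑ elements (g ∘ Inverse.to σ)
  ∑-elements-bijection σ g = trans (∑-elements g) (trans (total-bijection σ g) (sym (∑-elements _)))

  ∑-elements-single : ∀ g x → (∀ y → y ≢ x → g y ≈ 0#) → ∑ elements g ≈ g x
  ∑-elements-single g x g≈0 = trans (∑-elements g) (total-single g x g≈0)

  ∑-elements-const : ∀ k → ∑ elements (λ _ → k) ≈ q ⊗ k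
  ∑-elements-const k = trans (∑-elements _) (total-const k)

  ∑-units : ∀ g → ∑ units g + g 0F ≈ ∑ elements g
  ∑-units g = begin
    ∑ units g + g 0F  ≈⟨ +-cong (∑-filter nonzero? g elements) (sym at-zero) ⟩
    ∑ elements (λ x → [ nonzero? x ] * g x) + ∑ elements (λ x → [ x ≟F 0F ] * g x)
                                                        ≈⟨ ∑-+ _ _ elements ⟨
    ∑ elements (λ x → [ nonzero? x ] * g x + [ x ≟F 0F ] * g x)
                                                        ≈⟨ ∑-cong merge elements ⟩
    ∑ elements g  ∎
    where
    nonzero? : ∀ x → Dec (x ≢ 0F)
    nonzero? x = ¬? (x ≟F 0F)
    at-zero : ∑ elements (λ x → [ x ≟F 0F ] * g x) ≈ g 0F
    at-zero = begin
      ∑ elements (λ x → [ x ≟F 0F ] * g x)  ≈⟨ ∑-elements-single _ 0F (λ y y≢0 → trans (*-congʳ ([]-no (y ≟F 0F) y≢0)) (zeroˡ (g y))) ⟩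
      [ 0F ≟F 0F ] * g 0F  ≈⟨ *-congʳ ([]-yes (0F ≟F 0F) ≡.refl) ⟩
      1# * g 0F  ≈⟨ *-identityˡ _ ⟩
      g 0F  ∎
    merge : ∀ x → [ nonzero? x ] * g x + [ x ≟F 0F ] * g x ≈ g x
    merge x with x ≟F 0F
    ... | yes _ = trans (+-congʳ (zeroˡ (g x))) (trans (+-identityˡ _) (*-identityˡ (g x)))
    ... | no _  = trans (+-congˡ (zeroˡ (g x))) (trans (+-identityʳ _) (*-identityˡ (g x)))

  ∑-units-cong : ∀ {g h} → (∀ x → x ≢ 0F → g x ≈ h x) → ∑ units g ≈ ∑ units h
  ∑-units-cong {g} {h} g≈h = trans (∑-filter (λ x → ¬? (x ≟F 0F)) g elements)
    (trans (∑-cong agree elements) (sym (∑-filter (λ x → ¬? (x ≟F 0F)) h elements)))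
    where
    agree : ∀ x → [ ¬? (x ≟F 0F) ] * g x ≈ [ ¬? (x ≟F 0F) ] * h x
    agree x with x ≟F 0F
    ... | yes _   = trans (zeroˡ (g x)) (sym (zeroˡ (h x)))
    ... | no  x≢0 = *-congˡ (g≈h x x≢0)

-- The additive character of a finite field

-- The interface between analysis and arithmetic: only these properties of ℂ and exp(2πi/p) enter
-- the character sums.
record NontrivialRoot {c ℓ} (K : CommutativeRing c ℓ) (p : ℕ) : Set (c ⊔ ℓ) where
  open CommutativeRing K
  open SemiringExp semiring using (_^_)
  field
    _≟0    : ∀ x → Dec (x ≈ 0#)
    cancel : ∀ x y z → ¬ x ≈ 0# → x * y ≈ x * z → y ≈ z
    ζ      : Carrier
    ζ^p≈1  : ζ ^ p ≈ 1#
    ζ≉1    : ¬ ζ ≈ 1#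

module AdditiveCharacter {c ℓ f p η} (K : CommutativeRing c ℓ) (F : FiniteField f p η) (root : NontrivialRoot K p) where
  open CommutativeRing K
  open SemiringExp semiring
  open NontrivialRoot root
  open FiniteField F using (elements; q; Tr; residue)
    renaming (Carrier to 𝔽; 0# to 0F; 1# to 1F; _+_ to _+F_; _*_ to _*F_; _·_ to _·F_; prime to p-prime)
  open FiniteFieldTheory F hiding (*-cancelˡ; domain)
  open FieldSums K F
  open ListSums K
  open SemiringMult semiring using () renaming (_×_ to _⊗_)
  open SetoidReasoning setoid
  private
    module 𝔽P = RingProperties 𝔽.ring
    module 𝔽M = SemiringMult 𝔽.semiring

  ψ : 𝔽 → Carrier
  ψ y = ζ ^ residue (Tr y)

  -- Since 𝔽 has characteristic p, the multiple of 1 by n determines n modulo p. Exponents of `ζ`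
  -- may thus be compared in 𝔽, which turns additivity of the trace into multiplicativity of `ψ`.
  ζ-periodic-≤ : ∀ {m n} → m ℕ.≤ n → m ·F 1F ≡ n ·F 1F → ζ ^ m ≈ ζ ^ n
  ζ-periodic-≤ {m} {n} m≤n eq with n×1≡0⇒p∣n (n ℕ.∸ m) (𝔽P.+-cancelˡ (m ·F 1F) _ _
    (≡.trans (≡.sym (𝔽M.×-homo-+ 1F m (n ℕ.∸ m))) (≡.trans (cong (_·F 1F) (ℕ.m+[n∸m]≡n m≤n))
      (≡.trans (≡.sym eq) (≡.sym (𝔽.+-identityʳ _))))))
  ... | divides k n-m≡kp = begin
    ζ ^ m  ≈⟨ *-identityʳ _ ⟨
    ζ ^ m * 1#  ≈⟨ *-congˡ (CoprimeExponents.multiple-trivial *-monoid p ζ^p≈1 k) ⟨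
    ζ ^ m * ζ ^ (k ℕ.* p)  ≈⟨ ^-homo-* ζ m (k ℕ.* p) ⟨
    ζ ^ (m ℕ.+ k ℕ.* p)  ≡⟨ cong (λ d → ζ ^ (m ℕ.+ d)) n-m≡kp ⟨
    ζ ^ (m ℕ.+ (n ℕ.∸ m))  ≡⟨ cong (ζ ^_) (ℕ.m+[n∸m]≡n m≤n) ⟩
    ζ ^ n  ∎

  ζ-periodic : ∀ m n → m ·F 1F ≡ n ·F 1F → ζ ^ m ≈ ζ ^ n
  ζ-periodic m n eq with ℕ.≤-total m n
  ... | inj₁ m≤n = ζ-periodic-≤ m≤n eq
  ... | inj₂ n≤m = sym (ζ-periodic-≤ n≤m (≡.sym eq))

  ψ-+ : ∀ x y → ψ (x +F y) ≈ ψ x * ψ y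
  ψ-+ x y = trans (ζ-periodic (residue (Tr (x +F y))) (residue (Tr x) ℕ.+ residue (Tr y)) multiples) (^-homo-* ζ (residue (Tr x)) (residue (Tr y)))
    where
    multiples : residue (Tr (x +F y)) ·F 1F ≡ (residue (Tr x) ℕ.+ residue (Tr y)) ·F 1F
    multiples = ≡.trans (residue-Tr (x +F y)) (≡.trans (Tr-+ x y)
      (≡.trans (≡.cong₂ _+F_ (≡.sym (residue-Tr x)) (≡.sym (residue-Tr y)))
        (≡.sym (𝔽M.×-homo-+ 1F (residue (Tr x)) (residue (Tr y))))))

  ψ-0 : ψ 0F ≈ 1#
  ψ-0 = ζ-periodic (residue (Tr 0F)) 0 (≡.trans (residue-Tr 0F) Tr-0)
    where
    Tr-0 : Tr 0F ≡ 0F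
    Tr-0 = 𝔽P.+-cancelˡ (Tr 0F) _ _ (≡.trans (≡.sym (Tr-+ 0F 0F))
      (≡.trans (cong Tr (𝔽.+-identityʳ 0F)) (≡.sym (𝔽.+-identityʳ _))))

  ψ≈1⇒Tr≡0 : ∀ y → ψ y ≈ 1# → Tr y ≡ 0F
  ψ≈1⇒Tr≡0 y ψy≈1 with residue (Tr y) ℕ.≟ 0
  ... | yes r≡0 = ≡.trans (≡.sym (residue-Tr y)) (cong (_·F 1F) r≡0)
  ... | no  r≢0 = contradiction
    (CoprimeExponents.coprime-trivial *-monoid
      (prime⇒coprime p-prime {{ℕ.≢-nonZero r≢0}} (residue<p (Tr y))) ζ^p≈1 ψy≈1)
    ζ≉1

  ψ-nontrivial : ¬ (∀ y → ψ y ≈ 1#)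
  ψ-nontrivial ψ≈1 = Tr≢0 (λ y → ψ≈1⇒Tr≡0 y (ψ≈1 y))

  -- Translation by y multiplies the sum by `ψ y`. If the sum were nonzero, cancelling it would give
  -- `ψ y ≈ 1#` for all y; deciding whether the sum is zero replaces the choice of a y with `ψ y`
  -- different from 1.
  ∑-ψ : ∑ elements ψ ≈ 0#
  ∑-ψ with ∑ elements ψ ≟0
  ... | yes S≈0 = S≈0
  ... | no  S≉0 = contradiction (λ y → cancel _ _ _ S≉0 (begin
    ∑ elements ψ * ψ y  ≈⟨ ∑-*ʳ (ψ y) ψ elements ⟨
    ∑ elements (λ x → ψ x * ψ y)  ≈⟨ ∑-cong (λ x → ψ-+ x y) elements ⟨
    ∑ elements (λ x → ψ (x +F y))  ≈⟨ ∑-elements-bijection (translation y) ψ ⟨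
    ∑ elements ψ  ≈⟨ *-identityʳ _ ⟨
    ∑ elements ψ * 1#  ∎)) ψ-nontrivial

  ∑-ψ-nonzero : ∀ k → k ≢ 0F → ∑ elements (λ x → ψ (x *F k)) ≈ 0#
  ∑-ψ-nonzero k k≢0 = begin
    ∑ elements (λ x → ψ (x *F k))  ≈⟨ ∑-cong (λ x → reflexive (cong ψ (𝔽.*-comm x k))) elements ⟩
    ∑ elements (λ x → ψ (k *F x))  ≈⟨ ∑-elements-bijection (scaling k≢0) ψ ⟨
    ∑ elements ψ  ≈⟨ ∑-ψ ⟩
    0#  ∎

  ∑-ψ-zero : ∀ k → k ≡ 0F → ∑ elements (λ x → ψ (x *F k)) ≈ q ⊗ 1#
  ∑-ψ-zero k k≡0 = trans
    (∑-cong (λ x → trans (reflexive (cong ψ (≡.trans (cong (x *F_) k≡0) (𝔽.zeroʳ x)))) ψ-0) elements)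
    (∑-elements-const 1#)

-- Division by g in the Laurent series, by linear recurrences

module LinearRecurrences {f p η} (F : FiniteField f p η) where
  open Polynomials F
  open LaurentSeries F using (top; digit; fromPoly; [T^_]_; inverseDigits; 1/_) renaming (_/_ to _/ₗ_; _*_ to _*ₗ_)
  open FiniteField F using (_≟_) renaming (Carrier to 𝔽)
  private
    module 𝔽 = CommutativeRing (FiniteField.commutativeRing F)
    module 𝔽S = IntegerSolver (FiniteField.commutativeRing F)
    open CauchyProduct (FiniteField.commutativeRing F) using (conv)
  open ≡-Reasoning

  -- The linear functional on polynomials that takes the value `s i` at Tⁱ.
  pair : Poly → (ℕ → 𝔽) → 𝔽
  pair []      s = 𝔽.0#
  pair (x ∷ a) s = x 𝔽.* s 0 𝔽.+ pair a (s ∘ suc)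

  pair-cong : ∀ a {s t} → (∀ n → s n ≡ t n) → pair a s ≡ pair a t
  pair-cong []      s≡t = ≡.refl
  pair-cong (x ∷ a) s≡t = ≡.cong₂ (λ y z → x 𝔽.* y 𝔽.+ z) (s≡t 0) (pair-cong a (s≡t ∘ suc))

  pair-zeroʳ : ∀ a {s} → (∀ i → i ℕ.< List.length a → s i ≡ 𝔽.0#) → pair a s ≡ 𝔽.0#
  pair-zeroʳ []      s≡0 = ≡.refl
  pair-zeroʳ (x ∷ a) s≡0 = ≡.trans
    (≡.cong₂ (λ y z → x 𝔽.* y 𝔽.+ z) (s≡0 0 (ℕ.s≤s ℕ.z≤n)) (pair-zeroʳ a (λ i i<a → s≡0 (suc i) (ℕ.s≤s i<a))))
    (≡.trans (𝔽.+-identityʳ _) (𝔽.zeroʳ x))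

  pair-zeroˡ : ∀ a s → (∀ n → coeff a n ≡ 𝔽.0#) → pair a s ≡ 𝔽.0#
  pair-zeroˡ []      s a≈0 = ≡.refl
  pair-zeroˡ (x ∷ a) s a≈0 = ≡.trans
    (≡.cong₂ (λ y z → y 𝔽.* s 0 𝔽.+ z) (a≈0 0) (pair-zeroˡ a (s ∘ suc) (a≈0 ∘ suc)))
    (≡.trans (𝔽.+-identityʳ _) (𝔽.zeroˡ (s 0)))

  pair-≈ : ∀ a b s → a ≈ b → pair a s ≡ pair b s
  pair-≈ []      b       s a≈b = ≡.sym (pair-zeroˡ b s (≡.sym ∘ a≈b))
  pair-≈ (x ∷ a) []      s a≈b = pair-zeroˡ (x ∷ a) s a≈b
  pair-≈ (x ∷ a) (y ∷ b) s a≈b = ≡.cong₂ (λ z w → z 𝔽.* s 0 𝔽.+ w) (a≈b 0) (pair-≈ a b (s ∘ suc) (a≈b ∘ suc))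

  pair-+ : ∀ a b s → pair (a + b) s ≡ pair a s 𝔽.+ pair b s
  pair-+ []      b       s = ≡.sym (𝔽.+-identityˡ _)
  pair-+ (x ∷ a) []      s = ≡.sym (𝔽.+-identityʳ _)
  pair-+ (x ∷ a) (y ∷ b) s = ≡.trans (𝔽.+-congˡ (pair-+ a b (s ∘ suc)))
    (𝔽S.solve 5 (λ x y s A B → (x :+ y) :* s :+ (A :+ B) := x :* s :+ A :+ (y :* s :+ B)) ≡.refl x y (s 0) _ _)

  pair-· : ∀ x a s → pair (x · a) s ≡ x 𝔽.* pair a s
  pair-· x []      s = ≡.sym (𝔽.zeroʳ x)
  pair-· x (y ∷ a) s = ≡.trans (𝔽.+-congˡ (pair-· x a (s ∘ suc)))
    (𝔽S.solve 4 (λ x y s A → x :* y :* s :+ x :* A := x :* (y :* s :+ A)) ≡.refl x y (s 0) _)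

  pair-linearʳ : ∀ a x s t → pair a (λ n → x 𝔽.* s n 𝔽.+ t n) ≡ x 𝔽.* pair a s 𝔽.+ pair a t
  pair-linearʳ []      x s t = ≡.sym (≡.trans (𝔽.+-identityʳ _) (𝔽.zeroʳ x))
  pair-linearʳ (y ∷ a) x s t = ≡.trans (𝔽.+-congˡ (pair-linearʳ a x (s ∘ suc) (t ∘ suc)))
    (𝔽S.solve 6 (λ x y s t A B → y :* (x :* s :+ t) :+ (x :* A :+ B) := x :* (y :* s :+ A) :+ (y :* t :+ B))
      ≡.refl x y (s 0) (t 0) _ _)

  -- Polynomials act on sequences, T acting as the shift.
  infixr 7 _⋆_
  _⋆_ : Poly → (ℕ → 𝔽) → ℕ → 𝔽
  (a ⋆ s) n = pair a (λ i → s (n ℕ.+ i))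

  pair-* : ∀ a b s → pair (a * b) s ≡ pair a (b ⋆ s)
  pair-* []      b s = ≡.refl
  pair-* (x ∷ a) b s = begin
    pair (x · b + (𝔽.0# ∷ a * b)) s  ≡⟨ pair-+ (x · b) (𝔽.0# ∷ a * b) s ⟩
    pair (x · b) s 𝔽.+ (𝔽.0# 𝔽.* s 0 𝔽.+ pair (a * b) (s ∘ suc))  ≡⟨ ≡.cong₂ 𝔽._+_ (pair-· x b s) (≡.trans (𝔽.+-congʳ (𝔽.zeroˡ (s 0))) (𝔽.+-identityˡ _)) ⟩
    x 𝔽.* pair b s 𝔽.+ pair (a * b) (s ∘ suc)  ≡⟨ 𝔽.+-congˡ (pair-* a b (s ∘ suc)) ⟩
    x 𝔽.* pair b s 𝔽.+ pair a (b ⋆ (s ∘ suc))  ∎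

  -- Both sides are the value of the functional `s` at the product of a and b. This allows f to be
  -- paired with a sequence that depends only on b and g.
  pair-⋆-comm : ∀ a b s → pair a (b ⋆ s) ≡ pair b (a ⋆ s)
  pair-⋆-comm []      b s = ≡.sym (pair-zeroʳ b (λ _ _ → ≡.refl))
  pair-⋆-comm (x ∷ a) b s = begin
    x 𝔽.* pair b s 𝔽.+ pair a (b ⋆ (s ∘ suc))  ≡⟨ 𝔽.+-congˡ (pair-⋆-comm a b (s ∘ suc)) ⟩
    x 𝔽.* pair b s 𝔽.+ pair b (a ⋆ (s ∘ suc))  ≡⟨ pair-linearʳ b x s (a ⋆ (s ∘ suc)) ⟨
    pair b (λ n → x 𝔽.* s n 𝔽.+ (a ⋆ (s ∘ suc)) n)  ≡⟨ pair-cong b (λ n → ≡.cong₂ (λ y z → x 𝔽.* y 𝔽.+ z)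
      (cong s (ℕ.+-identityʳ n)) (pair-cong a (λ i → cong s (ℕ.+-suc n i)))) ⟨
    pair b ((x ∷ a) ⋆ s)  ∎

  δ : ℕ → ℕ → 𝔽
  δ zero    zero    = 𝔽.1#
  δ zero    (suc i) = 𝔽.0#
  δ (suc n) zero    = 𝔽.0#
  δ (suc n) (suc i) = δ n i

  -- Coefficients are functionals too, so linearity of multiplication in its first factor follows
  -- from `pair-*`.
  coeff≡pair : ∀ a n → coeff a n ≡ pair a (δ n)
  coeff≡pair []      n       = ≡.refl
  coeff≡pair (x ∷ a) zero    = ≡.sym (≡.trans (≡.cong₂ 𝔽._+_ (𝔽.*-identityʳ x) (pair-zeroʳ a (λ _ _ → ≡.refl))) (𝔽.+-identityʳ x))
  coeff≡pair (x ∷ a) (suc n) = ≡.trans (coeff≡pair a n) (≡.sym (≡.trans (𝔽.+-congʳ (𝔽.zeroʳ x)) (𝔽.+-identityˡ _)))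

  coeff-*-distribʳ : ∀ a b c n → coeff ((a + b) * c) n ≡ coeff (a * c) n 𝔽.+ coeff (b * c) n
  coeff-*-distribʳ a b c n = begin
    coeff ((a + b) * c) n  ≡⟨ coeff≡pair ((a + b) * c) n ⟩
    pair ((a + b) * c) (δ n)  ≡⟨ pair-* (a + b) c (δ n) ⟩
    pair (a + b) (c ⋆ δ n)  ≡⟨ pair-+ a b (c ⋆ δ n) ⟩
    pair a (c ⋆ δ n) 𝔽.+ pair b (c ⋆ δ n)  ≡⟨ ≡.cong₂ 𝔽._+_ (pair-* a c (δ n)) (pair-* b c (δ n)) ⟨
    pair (a * c) (δ n) 𝔽.+ pair (b * c) (δ n)  ≡⟨ ≡.cong₂ 𝔽._+_ (coeff≡pair (a * c) n) (coeff≡pair (b * c) n) ⟨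
    coeff (a * c) n 𝔽.+ coeff (b * c) n  ∎

  coeff-·-* : ∀ x a c n → coeff ((x · a) * c) n ≡ x 𝔽.* coeff (a * c) n
  coeff-·-* x a c n = begin
    coeff ((x · a) * c) n  ≡⟨ coeff≡pair ((x · a) * c) n ⟩
    pair ((x · a) * c) (δ n)  ≡⟨ pair-* (x · a) c (δ n) ⟩
    pair (x · a) (c ⋆ δ n)  ≡⟨ pair-· x a (c ⋆ δ n) ⟩
    x 𝔽.* pair a (c ⋆ δ n)  ≡⟨ cong (x 𝔽.*_) (pair-* a c (δ n)) ⟨
    x 𝔽.* pair (a * c) (δ n)  ≡⟨ cong (x 𝔽.*_) (coeff≡pair (a * c) n) ⟨
    x 𝔽.* coeff (a * c) n  ∎

  coeff-length : ∀ b n → List.length b ℕ.≤ n → coeff b n ≡ 𝔽.0#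
  coeff-length []      n       _         = ≡.refl
  coeff-length (x ∷ b) (suc n) (ℕ.s≤s l) = coeff-length b n l

  coeff-++ : ∀ {n} (v : Vec 𝔽 n) t i →
             coeff (Vec.toList v List.++ t) i ≡ coeff (Vec.toList v) i 𝔽.+ coeff (List.replicate n 𝔽.0# List.++ t) i
  coeff-++ []      t i       = ≡.sym (𝔽.+-identityˡ _)
  coeff-++ (x ∷ v) t zero    = ≡.sym (𝔽.+-identityʳ x)
  coeff-++ (x ∷ v) t (suc i) = coeff-++ v t i

  infixl 6 _-ₚ_
  _-ₚ_ : Poly → Poly → Poly
  a -ₚ b = a + (𝔽.- 𝔽.1#) · b

  coeff-sub : ∀ a b n → coeff (a -ₚ b) n ≡ coeff a n 𝔽.+ 𝔽.- 𝔽.1# 𝔽.* coeff b n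
  coeff-sub a b n = ≡.trans (coeff-+ a _ n) (𝔽.+-congˡ (coeff-· (𝔽.- 𝔽.1#) b n))

  module _ (g : Monic) {n : ℕ} (v : Vec 𝔽 n) (t a : Poly) where
    private
      pad = List.replicate n 𝔽.0# List.++ t

    -- As `pad` is Tⁿ t, the polynomial `v ++ t` is v + Tⁿ t: prescribing the higher coefficients t
    -- shifts the residue class of the lower part v.
    ++-≡mod⇒≡mod : Vec.toList v List.++ t ≡ a [mod g ] → Vec.toList v ≡ a -ₚ pad [mod g ]
    ++-≡mod⇒≡mod (h , eq) = h , λ n →
      let V = coeff (Vec.toList v) n; P = coeff pad n; A = coeff a n; H = coeff (h * toPoly g) n in begin
      V  ≡⟨ 𝔽S.solve 2 (λ V P → V := V :+ P :+ :- :1 :* P) ≡.refl V P ⟩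
      V 𝔽.+ P 𝔽.+ 𝔽.- 𝔽.1# 𝔽.* P  ≡⟨ 𝔽.+-congʳ (≡.trans (≡.sym (coeff-++ v t n)) (≡.trans (eq n) (coeff-+ a (h * toPoly g) n))) ⟩
      A 𝔽.+ H 𝔽.+ 𝔽.- 𝔽.1# 𝔽.* P  ≡⟨ 𝔽S.solve 3 (λ A H P → A :+ H :+ :- :1 :* P := A :+ :- :1 :* P :+ H) ≡.refl A H P ⟩
      A 𝔽.+ 𝔽.- 𝔽.1# 𝔽.* P 𝔽.+ H  ≡⟨ 𝔽.+-congʳ (coeff-sub a pad n) ⟨
      coeff (a -ₚ pad) n 𝔽.+ H  ≡⟨ coeff-+ (a -ₚ pad) (h * toPoly g) n ⟨
      coeff (a -ₚ pad + h * toPoly g) n  ∎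

    ≡mod⇒++-≡mod : Vec.toList v ≡ a -ₚ pad [mod g ] → Vec.toList v List.++ t ≡ a [mod g ]
    ≡mod⇒++-≡mod (h , eq) = h , λ n →
      let V = coeff (Vec.toList v) n; P = coeff pad n; A = coeff a n; H = coeff (h * toPoly g) n in begin
      coeff (Vec.toList v List.++ t) n  ≡⟨ coeff-++ v t n ⟩
      V 𝔽.+ P  ≡⟨ 𝔽.+-congʳ (≡.trans (eq n) (≡.trans (coeff-+ (a -ₚ pad) (h * toPoly g) n) (𝔽.+-congʳ (coeff-sub a pad n)))) ⟩
      A 𝔽.+ 𝔽.- 𝔽.1# 𝔽.* P 𝔽.+ H 𝔽.+ P  ≡⟨ 𝔽S.solve 3 (λ A H P → A :+ :- :1 :* P :+ H :+ P := A :+ H) ≡.refl A H P ⟩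
      A 𝔽.+ H  ≡⟨ coeff-+ a (h * toPoly g) n ⟨
      coeff (a + h * toPoly g) n  ∎

  -- The value `β (n - l)`, read as zero for n < l where truncated subtraction would give `β 0`.
  delay : ℕ → (ℕ → 𝔽) → ℕ → 𝔽
  delay zero    β n       = β n
  delay (suc l) β zero    = 𝔽.0#
  delay (suc l) β (suc n) = delay l β n

  delay-< : ∀ l β {n} → n ℕ.< l → delay l β n ≡ 𝔽.0#
  delay-< (suc l) β {zero}  _           = ≡.refl
  delay-< (suc l) β {suc n} (ℕ.s≤s n<l) = delay-< l β n<l

  delay-+ : ∀ k l β n → delay (k ℕ.+ l) β (k ℕ.+ n) ≡ delay l β n
  delay-+ zero    l β n = ≡.refl
  delay-+ (suc k) l β n = delay-+ k l β n

  delay-self : ∀ l β → delay l β l ≡ β 0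
  delay-self zero    β = ≡.refl
  delay-self (suc l) β = delay-self l β

  conv-zeroˡ : ∀ β n → conv (λ _ → 𝔽.0#) β n ≡ 𝔽.0#
  conv-zeroˡ β zero    = 𝔽.zeroˡ _
  conv-zeroˡ β (suc n) = ≡.trans (≡.cong₂ 𝔽._+_ (𝔽.zeroˡ _) (conv-zeroˡ β n)) (𝔽.+-identityˡ _)

  conv-∷ʳ : ∀ r x β n → conv (coeff (r List.∷ʳ x)) β n ≡ conv (coeff r) β n 𝔽.+ x 𝔽.* delay (List.length r) β n
  conv-∷ʳ [] x β zero    = 𝔽S.solve 2 (λ x b → x :* b := con (+ 0) :* b :+ x :* b) ≡.refl x (β 0)
  conv-∷ʳ [] x β (suc n) = ≡.trans (𝔽.+-congˡ (conv-zeroˡ β n)) (≡.trans (𝔽.+-comm _ _)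
    (𝔽.+-congʳ (≡.sym (≡.trans (≡.cong₂ 𝔽._+_ (𝔽.zeroˡ _) (conv-zeroˡ β n)) (𝔽.+-identityˡ _)))))
  conv-∷ʳ (y ∷ r) x β zero    = 𝔽S.solve 3 (λ x y b → y :* b := y :* b :+ x :* con (+ 0)) ≡.refl x y (β 0)
  conv-∷ʳ (y ∷ r) x β (suc n) = ≡.trans (𝔽.+-congˡ (conv-∷ʳ r x β n)) (≡.sym (𝔽.+-assoc _ _ _))

  -- Digits start at the highest power, so the coefficient of Tʲ is the digit at length b - 1 - j.
  -- It meets the digit of `β` at n + j + 1 - length b.
  conv-reverse : ∀ b β n → conv (coeff (List.reverse b)) β n ≡ pair b (λ j → delay (List.length b) β (suc j ℕ.+ n))
  conv-reverse []      β n = conv-zeroˡ β n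
  conv-reverse (x ∷ b) β n = begin
    conv (coeff (List.reverse (x ∷ b))) β n
      ≡⟨ cong (λ r → conv (coeff r) β n) (List.unfold-reverse x b) ⟩
    conv (coeff (List.reverse b List.∷ʳ x)) β n
      ≡⟨ conv-∷ʳ (List.reverse b) x β n ⟩
    conv (coeff (List.reverse b)) β n 𝔽.+ x 𝔽.* delay (List.length (List.reverse b)) β n
      ≡⟨ ≡.cong₂ (λ y l → y 𝔽.+ x 𝔽.* delay l β n) (conv-reverse b β n) (List.length-reverse b) ⟩
    pair b (λ j → delay (List.length b) β (suc j ℕ.+ n)) 𝔽.+ x 𝔽.* delay (List.length b) β n
      ≡⟨ 𝔽.+-comm _ _ ⟩
    pair (x ∷ b) (λ j → delay (List.length (x ∷ b)) β (suc j ℕ.+ n)) ∎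

  private
    rangeSum : (ℕ → 𝔽) → ℕ → 𝔽
    rangeSum h zero    = 𝔽.0#
    rangeSum h (suc n) = h 0 𝔽.+ rangeSum (h ∘ suc) n

    foldr-applyUpTo : ∀ (h : ℕ → 𝔽) (g : ℕ → ℕ) n →
      List.foldr (λ i s → h i 𝔽.+ s) 𝔽.0# (List.applyUpTo g n) ≡ rangeSum (h ∘ g) n
    foldr-applyUpTo h g zero    = ≡.refl
    foldr-applyUpTo h g (suc n) = 𝔽.+-congˡ (foldr-applyUpTo h (g ∘ suc) n)

    rangeSum-conv : ∀ α β n → rangeSum (λ i → α i 𝔽.* β (n ℕ.∸ i)) (suc n) ≡ conv α β n
    rangeSum-conv α β zero    = 𝔽.+-identityʳ _
    rangeSum-conv α β (suc n) = 𝔽.+-congˡ (rangeSum-conv (α ∘ suc) β n)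

  digit-* : ∀ α β n → digit (α *ₗ β) n ≡ conv (digit α) (digit β) n
  digit-* α β n = ≡.trans (foldr-applyUpTo (λ i → digit α i 𝔽.* digit β (n ℕ.∸ i)) (λ i → i) (suc n))
    (rangeSum-conv (digit α) (digit β) n)

  [T^]-digit : ∀ {j α n} → top α ℤ.- j ≡ + n → [T^ j ] α ≡ digit α n
  [T^]-digit {j} {α} eq with top α ℤ.- j | eq
  ... | + n | ≡.refl = ≡.refl

  [T^]-zero : ∀ {j α n} → top α ℤ.- j ≡ -[1+ n ] → [T^ j ] α ≡ 𝔽.0#
  [T^]-zero {j} {α} eq with top α ℤ.- j | eq
  ... | -[1+ n ] | ≡.refl = ≡.refl

  length-toPoly : ∀ g → List.length (toPoly g) ≡ suc (deg g)
  length-toPoly (monic m lo) = ≡.trans (List.length-++ (Vec.toList lo)) (≡.trans (cong (ℕ._+ 1) (Vec.length-toList lo)) (ℕ.+-comm m 1))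

  module _ (g : Monic) where
    private
      G = toPoly g
      m = deg g

    β : ℕ → 𝔽
    β = digit (1/ g)

    -- The coefficient of T⁻¹ in Tʲ / g.
    B : ℕ → 𝔽
    B j = delay m β (suc j)

    private
      ĝ : ℕ → 𝔽
      ĝ = coeff (List.reverse G)

      foldr-zipWith : ∀ s n → Vec.foldr′ 𝔽._+_ 𝔽.0# (Vec.zipWith 𝔽._*_ (Vec.tabulate (λ (i : Fin (suc n)) → s (toℕ i))) (inverseDigits g n))
                              ≡ conv s β n
      foldr-zipWith s zero    = 𝔽.+-identityʳ _
      foldr-zipWith s (suc n) = 𝔽.+-congˡ (foldr-zipWith (s ∘ suc) n)

      ĝ₀≡1 : ĝ 0 ≡ 𝔽.1#
      ĝ₀≡1 = cong (λ r → coeff r 0) (List.reverse-++ (Vec.toList (lower g)) (𝔽.1# ∷ []))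

      -- The recursion for the digits of 1/g says that g times 1/g has no digit after the leading
      -- one.
      conv-ĝ-β : ∀ n → conv ĝ β (suc n) ≡ 𝔽.0#
      conv-ĝ-β n = begin
        ĝ 0 𝔽.* β (suc n) 𝔽.+ conv (ĝ ∘ suc) β n  ≡⟨ ≡.cong₂ (λ x y → x 𝔽.* β (suc n) 𝔽.+ y) ĝ₀≡1 (≡.sym (foldr-zipWith (ĝ ∘ suc) n)) ⟩
        𝔽.1# 𝔽.* 𝔽.- X 𝔽.+ X  ≡⟨ 𝔽S.solve 1 (λ X → :1 :* :- X :+ X := con (+ 0)) ≡.refl X ⟩
        𝔽.0#  ∎
        where X = Vec.foldr′ 𝔽._+_ 𝔽.0# (Vec.zipWith 𝔽._*_ (Vec.tabulate (λ (i : Fin (suc n)) → ĝ (suc (toℕ i)))) (inverseDigits g n))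

    -- The left side is the coefficient of T⁻¹ in g Tⁿ/g, a polynomial. In other words, `B` is a
    -- linear recurrence with characteristic polynomial g.
    G⋆B≡0 : ∀ n → (G ⋆ B) n ≡ 𝔽.0#
    G⋆B≡0 n = begin
      pair G (λ i → delay m β (suc (n ℕ.+ i)))  ≡⟨ pair-cong G (λ i → cong (delay m β) (≡.trans (cong suc (ℕ.+-comm n i)) (≡.sym (ℕ.+-suc i n)))) ⟩
      pair G (λ i → delay (suc m) β (suc i ℕ.+ suc n))  ≡⟨ cong (λ l → pair G (λ i → delay l β (suc i ℕ.+ suc n))) (length-toPoly g) ⟨
      pair G (λ i → delay (List.length G) β (suc i ℕ.+ suc n))  ≡⟨ conv-reverse G β (suc n) ⟨
      conv ĝ β (suc n)  ≡⟨ conv-ĝ-β n ⟩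
      𝔽.0#  ∎

    top-/ : ∀ b → top (b /ₗ g) ℤ.- ℤ.-1ℤ ≡ List.length b ℤ.⊖ m
    top-/ b = begin
      (L ℤ.⊖ 1 ℤ.+ ℤ.- (+ m)) ℤ.- ℤ.-1ℤ  ≡⟨ cong (λ k → (k ℤ.+ ℤ.- (+ m)) ℤ.- ℤ.-1ℤ) (ℤ.m-n≡m⊖n L 1) ⟨
      (+ L ℤ.- + 1 ℤ.+ ℤ.- (+ m)) ℤ.- ℤ.-1ℤ  ≡⟨ ℤS.solve 2 (λ L m → (L :- con (+ 1) :+ :- m) :- con ℤ.-1ℤ := L :- m) ≡.refl (+ L) (+ m) ⟩
      + L ℤ.- + m  ≡⟨ ℤ.m-n≡m⊖n L m ⟩
      L ℤ.⊖ m  ∎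
      where
      L = List.length b
      module ℤS = IntegerSolver ℤ.+-*-commutativeRing

    -- T⁻¹ belongs to the digit at length b - m. If this is negative, `[T^_]_` returns zero by
    -- default; the pairing agrees, because it involves only values `B i` with i + 1 < m.
    [T^-1]-/ : ∀ b → [T^ ℤ.-1ℤ ] (b /ₗ g) ≡ pair b B
    [T^-1]-/ b with m ℕ.≤? List.length b
    ... | yes m≤L = begin
      [T^ ℤ.-1ℤ ] (b /ₗ g)  ≡⟨ [T^]-digit {ℤ.-1ℤ} {b /ₗ g} (≡.trans (top-/ b) (ℤ.⊖-≥ m≤L)) ⟩
      digit (b /ₗ g) n  ≡⟨ digit-* (fromPoly b) (1/ g) n ⟩
      conv (coeff (List.reverse b)) β n  ≡⟨ conv-reverse b β n ⟩
      pair b (λ j → delay L β (suc j ℕ.+ n))  ≡⟨ pair-cong b (λ j → ≡.trans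
        (≡.cong₂ (λ l k → delay l β k) (≡.sym (ℕ.m+[n∸m]≡n m≤L)) (ℕ.+-comm (suc j) n))
        (≡.trans (cong (λ l → delay l β (n ℕ.+ suc j)) (ℕ.+-comm m n)) (delay-+ n m β (suc j)))) ⟩
      pair b B  ∎
      where
      L = List.length b
      n = L ℕ.∸ m
    ... | no m≰L = ≡.trans
      ([T^]-zero {ℤ.-1ℤ} {b /ₗ g} {m ℕ.∸ suc L} (≡.trans (top-/ b) (≡.trans (ℤ.⊖-< L<m)
        (cong (λ k → ℤ.- (+ k)) (ℕ.+-∸-assoc 1 L<m)))))
      (≡.sym (pair-zeroʳ b (λ i i<L → delay-< m β (ℕ.≤-<-trans i<L L<m))))
      where
      L = List.length b
      L<m : L ℕ.< m
      L<m = ℕ.≰⇒> m≰L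

    [T^-1]-*/ : ∀ b a → [T^ ℤ.-1ℤ ] ((b * a) /ₗ g) ≡ pair a (b ⋆ B)
    [T^-1]-*/ b a = ≡.trans ([T^-1]-/ (b * a)) (≡.trans (pair-* b a B) (pair-⋆-comm b a B))

    multiples-⋆ : ∀ h n → ((h * G) ⋆ B) n ≡ 𝔽.0#
    multiples-⋆ h n = ≡.trans (pair-* h G (λ i → B (n ℕ.+ i)))
      (pair-zeroʳ h (λ k _ → ≡.trans (pair-cong G (λ i → cong B (≡.sym (ℕ.+-assoc n k i)))) (G⋆B≡0 (n ℕ.+ k))))

    record Remainder (a : Poly) : Set f where
      field
        quotient remainder : Poly
        division           : ∀ n → coeff a n ≡ coeff remainder n 𝔽.+ coeff (quotient * G) n
        small              : ∀ n → m ℕ.≤ n → coeff remainder n ≡ 𝔽.0#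

    remainder : ∀ a → Remainder a
    remainder a with divide g a
    ... | h , agree = record
      { quotient  = h
      ; remainder = a -ₚ h * G
      ; division  = λ n → ≡.trans (𝔽S.solve 2 (λ a h → a := a :+ :- :1 :* h :+ h) ≡.refl (coeff a n) (coeff (h * G) n))
          (𝔽.+-congʳ (≡.sym (coeff-r n)))
      ; small     = λ n m≤n → ≡.trans (coeff-r n) (≡.trans (𝔽.+-congʳ (agree n m≤n))
          (𝔽S.solve 1 (λ h → h :+ :- :1 :* h := con (+ 0)) ≡.refl (coeff (h * G) n)))
      }
      where
      coeff-r : ∀ n → coeff (a -ₚ h * G) n ≡ coeff a n 𝔽.+ 𝔽.- 𝔽.1# 𝔽.* coeff (h * G) n
      coeff-r = coeff-sub a (h * G)

    module _ {a : Poly} (R : Remainder a) where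
      open Remainder R renaming (remainder to r; quotient to h)

      remainder-⋆ : ∀ n → (a ⋆ B) n ≡ (r ⋆ B) n
      remainder-⋆ n = begin
        (a ⋆ B) n  ≡⟨ pair-≈ a (r + h * G) _ (λ k → ≡.trans (division k) (≡.sym (coeff-+ r (h * G) k))) ⟩
        pair (r + h * G) s  ≡⟨ pair-+ r (h * G) s ⟩
        pair r s 𝔽.+ pair (h * G) s  ≡⟨ 𝔽.+-congˡ (multiples-⋆ h n) ⟩
        pair r s 𝔽.+ 𝔽.0#  ≡⟨ 𝔽.+-identityʳ _ ⟩
        pair r s  ∎
        where s = λ i → B (n ℕ.+ i)

      ≈remainder⇒≡mod : ∀ b → b ≈ r → b ≡ a [mod g ]
      ≈remainder⇒≡mod b b≈r = (𝔽.- 𝔽.1#) · h , λ n → begin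
        coeff b n  ≡⟨ b≈r n ⟩
        coeff r n  ≡⟨ 𝔽S.solve 2 (λ r h → r := r :+ h :+ :- :1 :* h) ≡.refl (coeff r n) (coeff (h * G) n) ⟩
        coeff r n 𝔽.+ coeff (h * G) n 𝔽.+ 𝔽.- 𝔽.1# 𝔽.* coeff (h * G) n ≡⟨ ≡.cong₂ 𝔽._+_ (division n) (coeff-·-* (𝔽.- 𝔽.1#) h G n) ⟨
        coeff a n 𝔽.+ coeff (((𝔽.- 𝔽.1#) · h) * G) n  ≡⟨ coeff-+ a _ n ⟨
        coeff (a + ((𝔽.- 𝔽.1#) · h) * G) n  ∎

      ≡mod⇒≈remainder : ∀ b → (∀ n → m ℕ.≤ n → coeff b n ≡ 𝔽.0#) → b ≡ a [mod g ] → b ≈ r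
      ≡mod⇒≈remainder b b-small (k , b≡a+kG) n = begin
        coeff b n  ≡⟨ b≡r+multiple n ⟩
        coeff r n 𝔽.+ coeff ((h + k) * G) n  ≡⟨ 𝔽.+-congˡ (multiples-unique g (h + k) [] agree n) ⟩
        coeff r n 𝔽.+ 𝔽.0#  ≡⟨ 𝔽.+-identityʳ _ ⟩
        coeff r n  ∎
        where
        b≡r+multiple : ∀ n → coeff b n ≡ coeff r n 𝔽.+ coeff ((h + k) * G) n
        b≡r+multiple n = begin
          coeff b n  ≡⟨ b≡a+kG n ⟩
          coeff (a + k * G) n  ≡⟨ coeff-+ a (k * G) n ⟩
          coeff a n 𝔽.+ coeff (k * G) n  ≡⟨ 𝔽.+-congʳ (division n) ⟩
          coeff r n 𝔽.+ coeff (h * G) n 𝔽.+ coeff (k * G) n  ≡⟨ 𝔽.+-assoc _ _ _ ⟩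
          coeff r n 𝔽.+ (coeff (h * G) n 𝔽.+ coeff (k * G) n)  ≡⟨ 𝔽.+-congˡ (coeff-*-distribʳ h k G n) ⟨
          coeff r n 𝔽.+ coeff ((h + k) * G) n  ∎
        agree : AgreeAbove g ((h + k) * G) ([] * G)
        agree n m≤n = begin
          coeff ((h + k) * G) n  ≡⟨ 𝔽.+-identityˡ _ ⟨
          𝔽.0# 𝔽.+ coeff ((h + k) * G) n  ≡⟨ 𝔽.+-congʳ (small n m≤n) ⟨
          coeff r n 𝔽.+ coeff ((h + k) * G) n  ≡⟨ b≡r+multiple n ⟨
          coeff b n  ≡⟨ b-small n m≤n ⟩
          𝔽.0#  ∎

  data Leading (r : Poly) : Set f where
    zero    : (∀ n → coeff r n ≡ 𝔽.0#) → Leading r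
    leading : ∀ d → coeff r d ≢ 𝔽.0# → (∀ n → d ℕ.< n → coeff r n ≡ 𝔽.0#) → Leading r

  leading? : ∀ r → Leading r
  leading? []      = zero (λ _ → ≡.refl)
  leading? (x ∷ r) with leading? r
  ... | leading d r_d≢0 higher = leading (suc d) r_d≢0 λ where (suc n) (ℕ.s≤s d<n) → higher n d<n
  ... | zero r≈0 with x ≟ 𝔽.0#
  ...   | yes x≡0 = zero λ where
    zero    → x≡0
    (suc n) → r≈0 n
  ...   | no  x≢0 = leading 0 x≢0 λ where (suc n) _ → r≈0 n

  pair-leading : ∀ r s d → (∀ n → d ℕ.< n → coeff r n ≡ 𝔽.0#) → (∀ i → i ℕ.< d → s i ≡ 𝔽.0#) →
                 pair r s ≡ coeff r d 𝔽.* s d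
  pair-leading []      s d       higher lower = ≡.sym (𝔽.zeroˡ (s d))
  pair-leading (x ∷ r) s zero    higher lower = ≡.trans
    (𝔽.+-congˡ (pair-zeroˡ r (s ∘ suc) (λ n → higher (suc n) (ℕ.s≤s ℕ.z≤n)))) (𝔽.+-identityʳ _)
  pair-leading (x ∷ r) s (suc d) higher lower = ≡.trans
    (≡.cong₂ (λ y z → x 𝔽.* y 𝔽.+ z) (lower 0 (ℕ.s≤s ℕ.z≤n))
      (pair-leading r (s ∘ suc) d (λ n d<n → higher (suc n) (ℕ.s≤s d<n)) (λ i i<d → lower (suc i) (ℕ.s≤s i<d))))
    (≡.trans (𝔽.+-congʳ (𝔽.zeroʳ x)) (𝔽.+-identityˡ _))

  module _ (g : Monic) (a : Poly) where
    private
      m = deg g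
      R = remainder g a
      r = Remainder.remainder R
      B′ = B g

    -- The remainder r of a vanishes, or has degree d and leading coefficient ρ; in the
    -- second case k = m - 1 - d is the least index with (a ⋆ B) k ≠ 0.
    data Class : Set f where
      divisible    : (∀ n → coeff r n ≡ 𝔽.0#) → (∀ n → (a ⋆ B′) n ≡ 𝔽.0#) → Class
      nondivisible : ∀ d k → suc (k ℕ.+ d) ≡ m → coeff r d ≢ 𝔽.0# → (∀ n → d ℕ.< n → coeff r n ≡ 𝔽.0#) →
                     (∀ n → n ℕ.< k → (a ⋆ B′) n ≡ 𝔽.0#) → (a ⋆ B′) k ≡ coeff r d → Class

    classify : Class
    classify with leading? r
    ... | zero r≈0 = divisible r≈0 (λ n → ≡.trans (remainder-⋆ g R n) (pair-zeroˡ r _ r≈0))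
    ... | leading d r_d≢0 higher = nondivisible d k k+d r_d≢0 higher below at
      where
      d<m : d ℕ.< m
      d<m = ℕ.≰⇒> (λ m≤d → r_d≢0 (Remainder.small R d m≤d))
      k = m ℕ.∸ suc d
      k+d : suc (k ℕ.+ d) ≡ m
      k+d = ≡.trans (≡.sym (ℕ.+-suc k d)) (ℕ.m∸n+n≡m d<m)
      -- For n ≤ k and i < d the index n + i stays below m - 1, where `B` vanishes, so only the
      -- leading term of r contributes.
      value : ∀ n → n ℕ.≤ k → (a ⋆ B′) n ≡ coeff r d 𝔽.* B′ (n ℕ.+ d)
      value n n≤k = ≡.trans (remainder-⋆ g R n) (pair-leading r _ d higher
        (λ i i<d → delay-< m (β g) (≡.subst (suc (n ℕ.+ i) ℕ.<_) k+d (ℕ.s≤s (ℕ.+-mono-≤-< n≤k i<d)))))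
      below : ∀ n → n ℕ.< k → (a ⋆ B′) n ≡ 𝔽.0#
      below n n<k = ≡.trans (value n (ℕ.<⇒≤ n<k)) (≡.trans
        (cong (coeff r d 𝔽.*_) (delay-< m (β g) (≡.subst (suc (n ℕ.+ d) ℕ.<_) k+d (ℕ.s≤s (ℕ.+-monoˡ-< d n<k)))))
        (𝔽.zeroʳ _))
      at : (a ⋆ B′) k ≡ coeff r d
      at = begin
        (a ⋆ B′) k  ≡⟨ value k ℕ.≤-refl ⟩
        coeff r d 𝔽.* delay m (β g) (suc (k ℕ.+ d)) ≡⟨ cong (λ j → coeff r d 𝔽.* delay m (β g) j) k+d ⟩
        coeff r d 𝔽.* delay m (β g) m  ≡⟨ cong (coeff r d 𝔽.*_) (delay-self m (β g)) ⟩
        coeff r d 𝔽.* 𝔽.1#  ≡⟨ 𝔽.*-identityʳ _ ⟩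
        coeff r d  ∎

-- Counting monic polynomials in a residue class

module MonicSums {c ℓ f p η} (K : CommutativeRing c ℓ) (F : FiniteField f p η) where
  open CommutativeRing K hiding (zero)
  open FiniteField F using (elements; q; _≟_) renaming (Carrier to 𝔽; 0# to 0F; 1# to 1F)
  open Polynomials F using (Poly; Monic; monic; deg; toPoly; coeff; vectors; _≡_[mod_]; _≡?_[mod_]; _≈?_)
    renaming (_≈_ to _≈ₚ_)
  open LinearRecurrences F
  open FieldSums K F
  open ListSums K
  open SemiringExp semiring using (_^_)
  open SemiringMult semiring using (×-assoc-*; ×-congʳ) renaming (_×_ to _⊗_)
  open SetoidReasoning setoid
  Q : Carrier
  Q = q ⊗ 1#

  ∑-vectors-suc : ∀ n g → ∑ (vectors (suc n)) g ≈ ∑ elements (λ x → ∑ (vectors n) (λ v → g (x ∷ v)))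
  ∑-vectors-suc n g = ∑-cartesianProductWith _∷_ g elements (vectors n)

  ∑-vectors-1 : ∀ n → ∑ (vectors n) (λ _ → 1#) ≈ Q ^ n
  ∑-vectors-1 zero    = +-identityʳ 1#
  ∑-vectors-1 (suc n) = begin
    ∑ (vectors (suc n)) (λ _ → 1#)  ≈⟨ ∑-vectors-suc n _ ⟩
    ∑ elements (λ _ → ∑ (vectors n) (λ _ → 1#))  ≈⟨ ∑-cong (λ _ → ∑-vectors-1 n) elements ⟩
    ∑ elements (λ _ → Q ^ n)  ≈⟨ ∑-elements-const (Q ^ n) ⟩
    q ⊗ (Q ^ n)  ≈⟨ ×-congʳ q (*-identityˡ (Q ^ n)) ⟨
    q ⊗ (1# * Q ^ n)  ≈⟨ ×-assoc-* q 1# (Q ^ n) ⟨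
    Q * Q ^ n  ∎

  ∑-vectors-+ : ∀ m n (g : Poly → Carrier) → ∑ (vectors (m ℕ.+ n)) (g ∘ Vec.toList) ≈
                ∑ (vectors m) (λ v → ∑ (vectors n) (λ w → g (Vec.toList v List.++ Vec.toList w)))
  ∑-vectors-+ zero    n g = sym (+-identityʳ _)
  ∑-vectors-+ (suc m) n g = begin
    ∑ (vectors (suc m ℕ.+ n)) (g ∘ Vec.toList)
      ≈⟨ ∑-vectors-suc (m ℕ.+ n) (g ∘ Vec.toList) ⟩
    ∑ elements (λ x → ∑ (vectors (m ℕ.+ n)) (λ v → g (x ∷ Vec.toList v)))
      ≈⟨ ∑-cong (λ x → ∑-vectors-+ m n (g ∘ (x ∷_))) elements ⟩
    ∑ elements (λ x → ∑ (vectors m) (λ v → ∑ (vectors n) (λ w → g (x ∷ Vec.toList v List.++ Vec.toList w))))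
      ≈⟨ ∑-vectors-suc m _ ⟨
    ∑ (vectors (suc m)) (λ v → ∑ (vectors n) (λ w → g (Vec.toList v List.++ Vec.toList w))) ∎

  coeff-drop : ∀ n r i → coeff (List.drop n r) i ≡ coeff r (n ℕ.+ i)
  coeff-drop zero    r       i = ≡.refl
  coeff-drop (suc n) []      i = ≡.refl
  coeff-drop (suc n) (x ∷ r) i = coeff-drop n r i

  -- The entries of v are forced to be the lowest coefficients of r, so one vector is counted if t
  -- matches the rest of r and none otherwise.
  count-≈ : ∀ n t r → ∑ (vectors n) (λ v → [ Vec.toList v List.++ t ≈? r ]) ≈ [ t ≈? List.drop n r ]
  count-≈ zero    t r = +-identityʳ _
  count-≈ (suc n) t r = begin
    ∑ (vectors (suc n)) (λ v → [ Vec.toList v List.++ t ≈? r ])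
      ≈⟨ ∑-vectors-suc n _ ⟩
    ∑ elements (λ x → ∑ (vectors n) (λ v → [ x ∷ Vec.toList v List.++ t ≈? r ]))
      ≈⟨ ∑-cong (λ x → trans (∑-cong (λ v → split x (Vec.toList v List.++ t)) (vectors n))
                             (∑-*ˡ [ x ≟ coeff r 0 ] (λ v → [ Vec.toList v List.++ t ≈? List.drop 1 r ]) (vectors n))) elements ⟩
    ∑ elements (λ x → [ x ≟ coeff r 0 ] * ∑ (vectors n) (λ v → [ Vec.toList v List.++ t ≈? List.drop 1 r ]))
      ≈⟨ ∑-elements-single _ (coeff r 0) (λ x x≢ → trans (*-congʳ ([]-no (x ≟ coeff r 0) x≢)) (zeroˡ _)) ⟩
    [ coeff r 0 ≟ coeff r 0 ] * ∑ (vectors n) (λ v → [ Vec.toList v List.++ t ≈? List.drop 1 r ])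
      ≈⟨ trans (*-congʳ ([]-yes (coeff r 0 ≟ coeff r 0) ≡.refl)) (*-identityˡ _) ⟩
    ∑ (vectors n) (λ v → [ Vec.toList v List.++ t ≈? List.drop 1 r ])
      ≈⟨ count-≈ n t (List.drop 1 r) ⟩
    [ t ≈? List.drop n (List.drop 1 r) ]
      ≡⟨ cong (λ s → [ t ≈? s ]) (≡.trans (List.drop-drop 1 n r) ≡.refl) ⟩
    [ t ≈? List.drop (suc n) r ] ∎
    where
    split : ∀ x w → [ x ∷ w ≈? r ] ≈ [ x ≟ coeff r 0 ] * [ w ≈? List.drop 1 r ]
    split x w = []-× (x ≟ coeff r 0) (w ≈? List.drop 1 r) (x ∷ w ≈? r)
      (λ eq → eq 0 , λ n → ≡.trans (eq (suc n)) (≡.sym (coeff-drop 1 r n)))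
      (λ x≡ w≈ → λ where
        zero    → x≡
        (suc n) → ≡.trans (w≈ n) (coeff-drop 1 r n))

  module _ (g : Monic) (a : Poly) where
    private
      m = deg g
      G = toPoly g

    count : ℕ → Carrier
    count n = ∑ (vectors n) (λ v → [ toPoly (monic n v) ≡? a [mod g ] ])

    -- A residue class fixes the m lowest coefficients in terms of the others.
    count-low : ∀ t → ∑ (vectors m) (λ v → [ (Vec.toList v List.++ t) ≡? a [mod g ] ]) ≈ 1#
    count-low t = begin
      ∑ (vectors m) (λ v → [ (Vec.toList v List.++ t) ≡? a [mod g ] ])
        -- Appending the empty list gives the form of `count-≈`; its condition becomes that the
        -- remainder has no coefficients from m on.
        ≈⟨ ∑-cong (λ v → []-cong ((Vec.toList v List.++ t) ≡? a [mod g ]) (Vec.toList v List.++ [] ≈? r) (to v) (from v)) (vectors m) ⟩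
      ∑ (vectors m) (λ v → [ Vec.toList v List.++ [] ≈? r ])
        ≈⟨ count-≈ m [] r ⟩
      [ [] ≈? List.drop m r ]
        ≈⟨ []-yes ([] ≈? List.drop m r) (λ n → ≡.sym (≡.trans (coeff-drop m r n) (Remainder.small R (m ℕ.+ n) (ℕ.m≤m+n m n)))) ⟩
      1# ∎
      where
      R = remainder g (a -ₚ (List.replicate m 0F List.++ t))
      r = Remainder.remainder R
      to : ∀ (v : Vec 𝔽 m) → Vec.toList v List.++ t ≡ a [mod g ] → Vec.toList v List.++ [] ≈ₚ r
      to v eq rewrite List.++-identityʳ (Vec.toList v) = ≡mod⇒≈remainder g R (Vec.toList v)
        (λ n m≤n → coeff-length (Vec.toList v) n (ℕ.≤-trans (ℕ.≤-reflexive (Vec.length-toList v)) m≤n))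
        (++-≡mod⇒≡mod g v t a eq)
      from : ∀ (v : Vec 𝔽 m) → Vec.toList v List.++ [] ≈ₚ r → Vec.toList v List.++ t ≡ a [mod g ]
      from v v≈r rewrite List.++-identityʳ (Vec.toList v) = ≡mod⇒++-≡mod g v t a (≈remainder⇒≡mod g R (Vec.toList v) v≈r)

    -- The n coefficients between the m lowest ones and the leading 1 are free, and each choice of
    -- them determines the lowest ones.
    count-large : ∀ n → count (n ℕ.+ m) ≈ Q ^ n
    count-large n = begin
      count (n ℕ.+ m)
        ≡⟨ cong count (ℕ.+-comm n m) ⟩
      ∑ (vectors (m ℕ.+ n)) (λ v → member (Vec.toList v))
        ≈⟨ ∑-vectors-+ m n member ⟩
      ∑ (vectors m) (λ v → ∑ (vectors n) (λ w → member (Vec.toList v List.++ Vec.toList w)))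
        ≈⟨ ∑-comm _ (vectors m) (vectors n) ⟩
      ∑ (vectors n) (λ w → ∑ (vectors m) (λ v → member (Vec.toList v List.++ Vec.toList w)))
        ≈⟨ ∑-cong (λ w → trans
             (∑-cong (λ v → reflexive (cong (λ b → [ b ≡? a [mod g ] ]) (List.++-assoc (Vec.toList v) (Vec.toList w) (1F ∷ [])))) (vectors m))
             (count-low (Vec.toList w List.++ 1F ∷ []))) (vectors n) ⟩
      ∑ (vectors n) (λ _ → 1#)
        ≈⟨ ∑-vectors-1 n ⟩
      Q ^ n ∎
      where
      member : Poly → Carrier
      member b = [ (b List.++ 1F ∷ []) ≡? a [mod g ] ]

    private
      R = remainder g a
      r = Remainder.remainder R

    -- Below degree m a polynomial is its own remainder, so membership in the class means equality
    -- with r.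
    count-small : ∀ n → n ℕ.< m → count n ≈ [ 1F ∷ [] ≈? List.drop n r ]
    count-small n n<m = trans
      (∑-cong (λ v → let b = toPoly (monic n v) in []-cong (b ≡? a [mod g ]) (b ≈? r)
        (≡mod⇒≈remainder g R b (λ k m≤k → coeff-length b k
          (ℕ.≤-trans (ℕ.≤-reflexive (length-toPoly (monic n v))) (ℕ.≤-trans n<m m≤k))))
        (≈remainder⇒≡mod g R b)) (vectors n))
      (count-≈ n (1F ∷ []) r)

    count-small-≢ : ∀ n → n ℕ.< m → coeff r n ≢ 1F → count n ≈ 0#
    count-small-≢ n n<m r_n≢1 = trans (count-small n n<m) ([]-no (1F ∷ [] ≈? List.drop n r)
      (λ eq → r_n≢1 (≡.sym (≡.trans (eq 0) (≡.trans (coeff-drop n r 0) (cong (coeff r) (ℕ.+-identityʳ n)))))))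

    count-small-higher : ∀ n d → n ℕ.< d → d ℕ.< m → coeff r d ≢ 0F → count n ≈ 0#
    count-small-higher n d n<d d<m r_d≢0 = trans (count-small n (ℕ.<-trans n<d d<m)) ([]-no (1F ∷ [] ≈? List.drop n r)
      (λ eq → r_d≢0 (≡.trans (cong (coeff r) (≡.sym (ℕ.m+[n∸m]≡n (ℕ.<⇒≤ n<d))))
        (≡.trans (≡.sym (coeff-drop n r (d ℕ.∸ n))) (≡.trans (≡.sym (eq (d ℕ.∸ n)))
          (coeff-length (1F ∷ []) (d ℕ.∸ n) (ℕ.m<n⇒0<n∸m n<d)))))))

    count-degree : ∀ d → d ℕ.< m → (∀ n → d ℕ.< n → coeff r n ≡ 0F) → count d ≈ [ coeff r d ≟ 1F ]
    count-degree d d<m higher = trans (count-small d d<m) ([]-cong (1F ∷ [] ≈? List.drop d r) (coeff r d ≟ 1F)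
      (λ eq → ≡.sym (≡.trans (eq 0) (≡.trans (coeff-drop d r 0) (cong (coeff r) (ℕ.+-identityʳ d)))))
      (λ r_d≡1 → λ where
        zero    → ≡.sym (≡.trans (coeff-drop d r 0) (≡.trans (cong (coeff r) (ℕ.+-identityʳ d)) r_d≡1))
        (suc n) → ≡.sym (≡.trans (coeff-drop d r (suc n)) (higher (d ℕ.+ suc n) (ℕ.m<m+n d (ℕ.s≤s ℕ.z≤n))))))

-- Character sums over monic polynomials and over the units

module CharacterSums {c ℓ f p η} (K : CommutativeRing c ℓ) (F : FiniteField f p η) (root : NontrivialRoot K p) where
  open CommutativeRing K hiding (zero)
  open SemiringExp semiring using (_^_)
  open FiniteField F using (elements; units; _≟_) renaming (Carrier to 𝔽; 0# to 0F; 1# to 1F; _+_ to _+F_; _*_ to _*F_; -_ to -F_)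
  open Polynomials F using (monic; toPoly; vectors)
  open LinearRecurrences F using (pair)
  open AdditiveCharacter K F root public
  open FieldSums K F
  open ListSums K
  open MonicSums K F using (Q; ∑-vectors-suc)
  open IntegerSolver K
  open RingProperties ring
  open SetoidReasoning setoid
  private
    module 𝔽 = CommutativeRing (FiniteField.commutativeRing F)
    module 𝔽P = RingProperties 𝔽.ring
    module 𝔽S = IntegerSolver (FiniteField.commutativeRing F)

  monicSum : (ℕ → 𝔽) → ℕ → Carrier
  monicSum s n = ∑ (vectors n) (λ v → ψ (pair (toPoly (monic n v)) s))

  monicSum-zero : ∀ s → monicSum s 0 ≈ ψ (s 0)
  monicSum-zero s = trans (+-identityʳ _) (reflexive (cong ψ (≡.trans (𝔽.+-identityʳ _) (𝔽.*-identityˡ (s 0)))))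

  monicSum-suc : ∀ s n → monicSum s (suc n) ≈ ∑ elements (λ x → ψ (x *F s 0)) * monicSum (s ∘ suc) n
  monicSum-suc s n = begin
    monicSum s (suc n)
      ≈⟨ ∑-vectors-suc n _ ⟩
    ∑ elements (λ x → ∑ (vectors n) (λ v → ψ (x *F s 0 +F pair (toPoly (monic n v)) (s ∘ suc))))
      ≈⟨ ∑-cong (λ x → trans (∑-cong (λ v → ψ-+ (x *F s 0) (pair (toPoly (monic n v)) (s ∘ suc))) (vectors n))
                             (∑-*ˡ (ψ (x *F s 0)) (λ v → ψ (pair (toPoly (monic n v)) (s ∘ suc))) (vectors n))) elements ⟩
    ∑ elements (λ x → ψ (x *F s 0) * monicSum (s ∘ suc) n)
      ≈⟨ ∑-*ʳ (monicSum (s ∘ suc) n) (λ x → ψ (x *F s 0)) elements ⟩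
    ∑ elements (λ x → ψ (x *F s 0)) * monicSum (s ∘ suc) n ∎

  monicSum-trivial : ∀ s n → (∀ i → i ℕ.< n → s i ≡ 0F) → monicSum s n ≈ Q ^ n * ψ (s n)
  monicSum-trivial s zero    s≡0 = trans (monicSum-zero s) (sym (*-identityˡ _))
  monicSum-trivial s (suc n) s≡0 = begin
    monicSum s (suc n)  ≈⟨ monicSum-suc s n ⟩
    ∑ elements (λ x → ψ (x *F s 0)) * monicSum (s ∘ suc) n  ≈⟨ *-cong (∑-ψ-zero (s 0) (s≡0 0 (ℕ.s≤s ℕ.z≤n)))
      (monicSum-trivial (s ∘ suc) n (λ i i<n → s≡0 (suc i) (ℕ.s≤s i<n))) ⟩
    Q * (Q ^ n * ψ (s (suc n)))  ≈⟨ *-assoc Q (Q ^ n) _ ⟨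
    Q * Q ^ n * ψ (s (suc n))  ∎

  monicSum-vanish : ∀ s n i → i ℕ.< n → s i ≢ 0F → monicSum s n ≈ 0#
  monicSum-vanish s (suc n) zero    _           s₀≢0 = trans (monicSum-suc s n)
    (trans (*-congʳ (∑-ψ-nonzero (s 0) s₀≢0)) (zeroˡ _))
  monicSum-vanish s (suc n) (suc i) (ℕ.s≤s i<n) sᵢ≢0 = trans (monicSum-suc s n)
    (trans (*-congˡ (monicSum-vanish (s ∘ suc) n i i<n sᵢ≢0)) (zeroʳ _))

  ∑-units-minus : ∀ g → ∑ units g ≈ ∑ elements g - g 0F
  ∑-units-minus g = trans (solve 2 (λ S x → S := S :+ x :- x) refl (∑ units g) (g 0F)) (+-congʳ (∑-units g))

  ∑-units-1 : ∑ units (λ _ → 1#) ≈ Q - 1#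
  ∑-units-1 = trans (∑-units-minus _) (+-congʳ (∑-elements-const 1#))

  ∑-units-ψ : ∀ k → ∑ units (λ l → ψ (l *F k)) ≈ ∑ elements (λ l → ψ (l *F k)) - 1#
  ∑-units-ψ k = trans (∑-units-minus _) (+-congˡ (-‿cong (trans (reflexive (cong ψ (𝔽.zeroˡ k))) ψ-0)))

  ∑-units-ψ-nonzero : ∀ k → k ≢ 0F → ∑ units (λ l → ψ (l *F k)) ≈ - 1#
  ∑-units-ψ-nonzero k k≢0 = trans (∑-units-ψ k) (trans (+-congʳ (∑-ψ-nonzero k k≢0)) (+-identityˡ _))

  ∑-units-ψ-neg : ∑ units (λ l → ψ (-F l)) ≈ - 1#
  ∑-units-ψ-neg = trans
    (∑-units-cong (λ l _ → reflexive (cong ψ (𝔽S.solve 1 (λ l → :- l := l :* :- :1) ≡.refl l))))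
    (∑-units-ψ-nonzero (-F 1F) (λ -1≡0 → FiniteField.0≢1 F
      (≡.sym (≡.trans (≡.sym (𝔽P.-‿involutive 1F)) (≡.trans (cong -F_ -1≡0) 𝔽P.-0#≈0#)))))

  -- The summand is `ψ` at l (k - 1), so orthogonality detects k = 1. For k the leading coefficient
  -- of r this tests whether r is monic.
  ∑-units-ψ-shifted : ∀ k → ∑ units (λ l → ψ (-F l) * ψ (l *F k)) ≈ Q * [ k ≟ 1F ] - 1#
  ∑-units-ψ-shifted k = begin
    ∑ units (λ l → ψ (-F l) * ψ (l *F k))  ≈⟨ ∑-units-cong (λ l _ → trans (sym (ψ-+ (-F l) (l *F k)))
      (reflexive (cong ψ (𝔽S.solve 2 (λ l k → :- l :+ l :* k := l :* (k :- :1)) ≡.refl l k)))) ⟩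
    ∑ units (λ l → ψ (l *F (k 𝔽.- 1F)))  ≈⟨ ∑-units-ψ (k 𝔽.- 1F) ⟩
    ∑ elements (λ l → ψ (l *F (k 𝔽.- 1F))) - 1# ≈⟨ +-congʳ complete ⟩
    Q * [ k ≟ 1F ] - 1#  ∎
    where
    complete : ∑ elements (λ l → ψ (l *F (k 𝔽.- 1F))) ≈ Q * [ k ≟ 1F ]
    complete with k ≟ 1F
    ... | yes k≡1 = trans (∑-ψ-zero (k 𝔽.- 1F) (𝔽P.x≈y⇒x∙y⁻¹≈ε k≡1)) (sym (*-identityʳ Q))
    ... | no  k≢1 = trans (∑-ψ-nonzero (k 𝔽.- 1F) (k≢1 ∘ 𝔽P.x∙y⁻¹≈ε⇒x≈y k 1F)) (sym (zeroʳ Q))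

-- Evaluation of the sum over the units

module UnitSums {c ℓ f p η} (K : CommutativeRing c ℓ) (F : FiniteField f p η) where
  open CommutativeRing K
  open IntegerSolver K
  open ListSums K
  open FiniteField F using (units) renaming (Carrier to 𝔽; 0# to 0F)
  open FieldSums K F using (∑-units-cong)
  open CauchyProduct K using (Σ<)
  open SemiringExp semiring using (_^_)
  open SetoidReasoning setoid

  geometric : ∀ w k → (w - 1#) * Σ< (w ^_) k ≈ w ^ k - 1#
  geometric w zero    = solve 1 (λ w → (w :- :1) :* con (+ 0) := :1 :- :1) refl w
  geometric w (suc k) = begin
    (w - 1#) * (Σ< (w ^_) k + w ^ k)  ≈⟨ distribˡ (w - 1#) _ _ ⟩
    (w - 1#) * Σ< (w ^_) k + (w - 1#) * w ^ k  ≈⟨ +-congʳ (geometric w k) ⟩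
    w ^ k - 1# + (w - 1#) * w ^ k  ≈⟨ solve 2 (λ w x → x :- :1 :+ (w :- :1) :* x := w :* x :- :1) refl w (w ^ k) ⟩
    w * w ^ k - 1#  ∎

  ∑-units-expand : ∀ (α β : 𝔽 → Carrier) Q′ Y H W →
    ∑ units (λ l → (α l * Q′ - Y) * (H + β l * W)) ≈
    H * (Q′ * ∑ units α - Y * ∑ units (λ _ → 1#)) + W * (Q′ * ∑ units (λ l → α l * β l) - Y * ∑ units β)
  ∑-units-expand α β Q′ Y H W = begin
    ∑ units (λ l → (α l * Q′ - Y) * (H + β l * W))
      ≈⟨ ∑-cong (λ l → solve 6 (λ a b Q Y H W → (a :* Q :- Y) :* (H :+ b :* W) :=
          (H :* Q :* a :+ :- (H :* Y) :* :1) :+ (W :* Q :* (a :* b) :+ :- (W :* Y) :* b)) refl (α l) (β l) Q′ Y H W) units ⟩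
    ∑ units (λ l → (H * Q′ * α l + - (H * Y) * 1#) + (W * Q′ * (α l * β l) + - (W * Y) * β l))
      ≈⟨ trans (∑-+ _ _ units) (+-cong (trans (∑-+ _ _ units) (+-cong (∑-*ˡ _ _ units) (∑-*ˡ _ _ units)))
                                       (trans (∑-+ _ _ units) (+-cong (∑-*ˡ _ _ units) (∑-*ˡ _ _ units)))) ⟩
    (H * Q′ * ∑ units α + - (H * Y) * ∑ units (λ _ → 1#)) + (W * Q′ * ∑ units (λ l → α l * β l) + - (W * Y) * ∑ units β)
      ≈⟨ solve 8 (λ a b c d Q Y H W → (H :* Q :* a :+ :- (H :* Y) :* b) :+ (W :* Q :* c :+ :- (W :* Y) :* d) :=
          H :* (Q :* a :- Y :* b) :+ W :* (Q :* c :- Y :* d)) refl _ _ _ _ Q′ Y H W ⟩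
    H * (Q′ * ∑ units α - Y * ∑ units (λ _ → 1#)) + W * (Q′ * ∑ units (λ l → α l * β l) - Y * ∑ units β) ∎

  module _ {Q Q′ u w X′ : Carrier} (QQ′≈1 : Q * Q′ ≈ 1#) (XX′≈1 : (1# - Q * u) * X′ ≈ 1#) where

    -- - 1/Q - (Q - 1)/(Q X) = - (1 - u)/X for X = 1 - Q u.
    kernel-sum : Q′ * - 1# - Q′ * X′ * (Q - 1#) ≈ - ((1# - u) * X′)
    kernel-sum = begin
      Q′ * - 1# - Q′ * X′ * (Q - 1#)
        ≈⟨ solve 3 (λ Q Q′ X′ → Q′ :* :- :1 :- Q′ :* X′ :* (Q :- :1) := :- (Q′ :* :1) :- Q′ :* X′ :* (Q :- :1)) refl Q Q′ X′ ⟩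
      - (Q′ * 1#) - Q′ * X′ * (Q - 1#)
        ≈⟨ +-congʳ (-‿cong (*-congˡ XX′≈1)) ⟨
      - (Q′ * ((1# - Q * u) * X′)) - Q′ * X′ * (Q - 1#)
        ≈⟨ solve 4 (λ Q Q′ u X′ → :- (Q′ :* ((:1 :- Q :* u) :* X′)) :- Q′ :* X′ :* (Q :- :1) := :- (Q :* Q′ :* ((:1 :- u) :* X′))) refl Q Q′ u X′ ⟩
      - (Q * Q′ * ((1# - u) * X′))
        ≈⟨ -‿cong (trans (*-congʳ QQ′≈1) (*-identityˡ _)) ⟩
      - ((1# - u) * X′) ∎

    kernel-difference : Q′ * X′ - Q′ ≈ u * X′
    kernel-difference = begin
      Q′ * X′ - Q′  ≈⟨ +-congˡ (-‿cong (trans (*-congˡ XX′≈1) (*-identityʳ Q′))) ⟨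
      Q′ * X′ - Q′ * ((1# - Q * u) * X′)  ≈⟨ solve 4 (λ Q Q′ u X′ → Q′ :* X′ :- Q′ :* ((:1 :- Q :* u) :* X′) := Q :* Q′ :* (u :* X′)) refl Q Q′ u X′ ⟩
      Q * Q′ * (u * X′)  ≈⟨ trans (*-congʳ QQ′≈1) (*-identityˡ _) ⟩
      u * X′  ∎

    -- The weights are α l / Q - 1/(Q X); the argument of the values is w / Q with w = 1/u.
    module _ (uw≈1 : u * w ≈ 1#) {α weight value : 𝔽 → Carrier}
      (weight≈ : ∀ l → weight l ≈ α l * Q′ - Q′ * X′) (∑α≈-1 : ∑ units α ≈ - 1#) (∑1≈Q-1 : ∑ units (λ _ → 1#) ≈ Q - 1#) where

      private
        T : Carrier
        T = ∑ units (λ l → weight l * value l)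

      -- The form H + β W covers both kinds of values of 𝒟₁: H does not depend on l and meets only
      -- the total of the weights, while the character β remains attached to W.
      weighted-sum : ∀ {H W β} → (∀ l → l ≢ 0F → value l ≈ H + β l * W) →
        T ≈ H * - ((1# - u) * X′) + W * (Q′ * ∑ units (λ l → α l * β l) - Q′ * X′ * ∑ units β)
      weighted-sum {H} {W} {β} value≈ = begin
        T
          ≈⟨ ∑-units-cong (λ l l≢0 → *-cong (weight≈ l) (value≈ l l≢0)) ⟩
        ∑ units (λ l → (α l * Q′ - Q′ * X′) * (H + β l * W))
          ≈⟨ ∑-units-expand α β Q′ (Q′ * X′) H W ⟩
        H * (Q′ * ∑ units α - Q′ * X′ * ∑ units (λ _ → 1#)) + W * S
          ≈⟨ +-congʳ (*-congˡ (trans (+-cong (*-congˡ ∑α≈-1) (-‿cong (*-congˡ ∑1≈Q-1))) kernel-sum)) ⟩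
        H * - ((1# - u) * X′) + W * S ∎
        where S = Q′ * ∑ units (λ l → α l * β l) - Q′ * X′ * ∑ units β

      -- To be read with A = uᵏ, D = uᵈ, W = wᵏ, M = uᵐ and ε the bracket of ρ = 1. Since (1 - u) H
      -- = u (W - 1), the part with H contributes A D u X′ - D u X′ and the part with W contributes
      -- ε D + D u X′; the terms D u X′ cancel.
      nondivisible-identity : ∀ {Z S M U A D W H ε β} →
        (∀ l → l ≢ 0F → value l ≈ H + β l * W) → ∑ units (λ l → α l * β l) ≈ Q * ε - 1# → ∑ units β ≈ - 1# →
        A * W ≈ 1# → (w - 1#) * H ≈ W - 1# → Z ≈ S + M * X′ → S ≈ ε * D → M ≈ A * D * u → U ≈ A * D → Z ≈ U * T
      nondivisible-identity {Z} {S} {M} {U} {A} {D} {W} {H} {ε} {β} value≈ ∑αβ ∑β AW≈1 geometric Z≈ S≈ M≈ U≈ = sym (begin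
        U * T
          ≈⟨ *-cong U≈ (weighted-sum value≈) ⟩
        A * D * (H * - ((1# - u) * X′) + W * (Q′ * ∑ units (λ l → α l * β l) - Q′ * X′ * ∑ units β))
          ≈⟨ *-congˡ (+-congˡ (*-congˡ (trans (+-cong (*-congˡ ∑αβ) (-‿cong (*-congˡ ∑β))) second))) ⟩
        A * D * (H * - ((1# - u) * X′) + W * (ε + u * X′))
          ≈⟨ solve 7 (λ A D W H e u X → A :* D :* (H :* :- ((:1 :- u) :* X) :+ W :* (e :+ u :* X)) :=
              A :* D :* (X :* :- ((:1 :- u) :* H)) :+ A :* W :* D :* (e :+ u :* X)) refl A D W H ε u X′ ⟩
        A * D * (X′ * - ((1# - u) * H)) + A * W * D * (ε + u * X′)
          ≈⟨ +-cong (*-congˡ (*-congˡ (-‿cong first))) (*-congʳ (trans (*-congʳ AW≈1) (*-identityˡ D))) ⟩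
        A * D * (X′ * - (u * (W - 1#))) + D * (ε + u * X′)
          -- The cancellation depends on A W = 1, which is no ring identity; its defect is isolated
          -- as the last summand.
          ≈⟨ solve 6 (λ A D W e u X → A :* D :* (X :* :- (u :* (W :- :1))) :+ D :* (e :+ u :* X) :=
              e :* D :+ A :* D :* u :* X :+ (:1 :- A :* W) :* (D :* u :* X)) refl A D W ε u X′ ⟩
        ε * D + A * D * u * X′ + (1# - A * W) * (D * u * X′)
          ≈⟨ +-congˡ (trans (*-congʳ (trans (+-congˡ (-‿cong AW≈1)) (-‿inverseʳ 1#))) (zeroˡ _)) ⟩
        ε * D + A * D * u * X′ + 0#
          ≈⟨ +-identityʳ _ ⟩
        ε * D + A * D * u * X′
          ≈⟨ +-cong S≈ (*-congʳ M≈) ⟨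
        S + M * X′
          ≈⟨ Z≈ ⟨
        Z ∎)
        where
        first : (1# - u) * H ≈ u * (W - 1#)
        first = begin
          (1# - u) * H  ≈⟨ *-congʳ (+-congʳ uw≈1) ⟨
          (u * w - u) * H  ≈⟨ solve 3 (λ u w H → (u :* w :- u) :* H := u :* ((w :- :1) :* H)) refl u w H ⟩
          u * ((w - 1#) * H)  ≈⟨ *-congˡ geometric ⟩
          u * (W - 1#)  ∎
        second : Q′ * (Q * ε - 1#) - Q′ * X′ * - 1# ≈ ε + u * X′
        second = begin
          Q′ * (Q * ε - 1#) - Q′ * X′ * - 1#  ≈⟨ solve 4 (λ Q Q′ e X → Q′ :* (Q :* e :- :1) :- Q′ :* X :* :- :1 := Q :* Q′ :* e :+ (Q′ :* X :- Q′)) refl Q Q′ ε X′ ⟩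
          Q * Q′ * ε + (Q′ * X′ - Q′)  ≈⟨ +-cong (trans (*-congʳ QQ′≈1) (*-identityˡ ε)) kernel-difference ⟩
          ε + u * X′  ∎

      -- Here H = E = 1/(1 - w) and W = 0. As u w = 1, the quotient -(1 - u)/(1 - w) equals u, so
      -- the sum over the units is u X′.
      divisible-identity : ∀ {Z S M U E} → (∀ l → l ≢ 0F → value l ≈ E) → (1# - w) * E ≈ 1# →
        Z ≈ S + M * X′ → S ≈ 0# → M ≈ U * u → Z ≈ U * T
      divisible-identity {Z} {S} {M} {U} {E} value≈ YE≈1 Z≈ S≈ M≈ = sym (begin
        U * T  ≈⟨ *-congˡ (weighted-sum {E} {0#} {λ _ → 0#} (λ l l≢0 → trans (value≈ l l≢0)
          (solve 1 (λ E → E := E :+ con (+ 0) :* con (+ 0)) refl E))) ⟩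
        U * (E * - ((1# - u) * X′) + 0# * _)  ≈⟨ *-congˡ (trans (+-congˡ (zeroˡ _)) (+-identityʳ _)) ⟩
        U * (E * - ((1# - u) * X′))  ≈⟨ *-congˡ (*-congˡ (-‿cong (*-congʳ (+-congʳ uw≈1)))) ⟨
        U * (E * - ((u * w - u) * X′))  ≈⟨ solve 5 (λ U E u w X → U :* (E :* :- ((u :* w :- u) :* X)) := (:1 :- w) :* E :* (U :* u :* X)) refl U E u w X′ ⟩
        (1# - w) * E * (U * u * X′)  ≈⟨ trans (*-congʳ YE≈1) (*-identityˡ _) ⟩
        U * u * X′  ≈⟨ +-identityˡ _ ⟨
        0# + U * u * X′  ≈⟨ +-cong S≈ (*-congʳ M≈) ⟨
        S + M * X′  ≈⟨ Z≈ ⟨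
        Z  ∎)

-- The functional equation

module FunctionalEquation {c ℓ₁ ℓ₂ f p η} (R : CompleteOrderedField c ℓ₁ ℓ₂)
  (π : CompleteOrderedField.Carrier R) (isPi : Complex.IsPi R π) (F : FiniteField f p η) where
  open Complex R hiding (module ℂ; ∑)
  open ComplexField R hiding (domain)
  open ExponentialFunction R using (module RootOfUnity; partialSum≈Σ<)
  open GeneratingSeries R π F using (q; e_q; e; 𝒵; 𝒟₁; _Continues_)
  open FiniteField F using (Tr; residue; units) renaming (Carrier to 𝔽; 0# to 0F; 1# to 1F; -_ to infix 8 -F_; _*_ to _*F_; _≟_ to _≟F_)
  open Polynomials F using (Poly; Monic; monic; deg; toPoly; coeff; vectors; monics; _·_; _≡?_[mod_]) renaming (_*_ to infixl 7 _*ₚ_)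
  open LaurentSeries F using () renaming (_/_ to infixl 7 _/ₗ_)
  open FiniteFieldTheory F using (1<p; q-nonZero; domain)
  open LinearRecurrences F
  open ListSums ℂ-commutativeRing
  open MonicSums ℂ-commutativeRing F
  open UnitSums ℂ-commutativeRing F
  open RootOfUnity π isPi p 1<p

  ζ-root : NontrivialRoot ℂ-commutativeRing p
  ζ-root = record
    { _≟0    = _≟ 0#
    ; cancel = λ x y z → *-cancelˡ {x} {y} {z}
    ; ζ      = ζ
    ; ζ^p≈1  = ζ^p≈1
    ; ζ≉1    = ζ≉1
    }

  open CharacterSums ℂ-commutativeRing F ζ-root
  open PowerSeries R
  open OnDisc (FiniteField.q F) {{q-nonZero}}
  open SetoidReasoning ℂ.setoid
  private
    module 𝔽 = CommutativeRing (FiniteField.commutativeRing F)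

  q≈Q : q ≈ Q
  q≈Q = fromℕ≈ν (FiniteField.q F)

  q≉0 : q ≉ 0#
  q≉0 = fromℕ≉0 (FiniteField.q F) {{q-nonZero}}

  e_q≈ψ : ∀ y → e_q y ≈ ψ y
  e_q≈ψ y = cis-multiple (residue (Tr y))

  module _ (g : Monic) where
    private
      m = deg g
      B′ = B g

    𝒟₁-series : ∀ b u n → 𝒟₁ b g u n ≈ series (monicSum (b ⋆ B′)) u n
    𝒟₁-series b u n = begin
      𝒟₁ b g u n
        ≈⟨ ∑-map (monic n) (λ f → e (b *ₚ toPoly f /ₗ g) * u ^ deg f) (vectors n) ⟩
      ∑ (vectors n) (λ v → e (b *ₚ toPoly (monic n v) /ₗ g) * u ^ n)
        ≈⟨ ∑-cong (λ v → ℂ.*-congʳ {u ^ n} (ℂ.trans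
          (ℂ.reflexive (cong e_q ([T^-1]-*/ g b (toPoly (monic n v))))) (e_q≈ψ (pair (toPoly (monic n v)) (b ⋆ B′))))) (vectors n) ⟩
      ∑ (vectors n) (λ v → ψ (pair (toPoly (monic n v)) (b ⋆ B′)) * u ^ n)
        ≈⟨ ∑-*ʳ (u ^ n) (λ v → ψ (pair (toPoly (monic n v)) (b ⋆ B′))) (vectors n) ⟩
      monicSum (b ⋆ B′) n * u ^ n ∎

    𝒵-series : ∀ a u n → 𝒵 a g u n ≈ series (count g a) u n
    𝒵-series a u n = begin
      𝒵 a g u n
        ≈⟨ ∑-filter (λ f → toPoly f ≡? a [mod g ]) (λ f → u ^ deg f) (monics n) ⟩
      ∑ (monics n) (λ f → [ toPoly f ≡? a [mod g ] ] * u ^ deg f)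
        ≈⟨ ∑-map (monic n) (λ f → [ toPoly f ≡? a [mod g ] ] * u ^ deg f) (vectors n) ⟩
      ∑ (vectors n) (λ v → [ toPoly (monic n v) ≡? a [mod g ] ] * u ^ n)
        ≈⟨ ∑-*ʳ (u ^ n) (λ v → [ toPoly (monic n v) ≡? a [mod g ] ]) (vectors n) ⟩
      count g a n * u ^ n ∎

    module ZetaSeries (a : Poly) =
      Geometric {𝒵 a g} {count g a} {1#} m (𝒵-series a)
        (λ n → ℂ.trans (count-large g a n) (ℂ.trans (ℂ.^-congˡ n (ℂ.sym q≈Q)) (ℂ.sym (ℂ.*-identityˡ (q ^ n)))))

    module Divisible (b : Poly) (b⋆B≡0 : ∀ n → (b ⋆ B′) n ≡ 0F) =
      Geometric {𝒟₁ b g} {monicSum (b ⋆ B′)} {1#} 0 (𝒟₁-series b)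
        (λ n → begin
          monicSum (b ⋆ B′) (n ℕ.+ 0)  ≈⟨ ℂ.reflexive (cong (monicSum (b ⋆ B′)) (ℕ.+-identityʳ n)) ⟩
          monicSum (b ⋆ B′) n  ≈⟨ monicSum-trivial (b ⋆ B′) n (λ i _ → b⋆B≡0 i) ⟩
          Q ^ n * ψ ((b ⋆ B′) n)  ≈⟨ ℂ.*-cong (ℂ.^-congˡ n (ℂ.sym q≈Q)) (ℂ.trans (ℂ.reflexive (cong ψ (b⋆B≡0 n))) ψ-0) ⟩
          q ^ n * 1#  ≈⟨ ℂ.*-comm (q ^ n) 1# ⟩
          1# * q ^ n  ∎)

    module Nondivisible (b : Poly) (k : ℕ) (b⋆Bₖ≢0 : (b ⋆ B′) k ≢ 0F) =
      Finite {𝒟₁ b g} {monicSum (b ⋆ B′)} (suc k) (𝒟₁-series b)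
        (λ n → monicSum-vanish (b ⋆ B′) (n ℕ.+ suc k) k (ℕ.m≤n+m (suc k) n) b⋆Bₖ≢0)

    -- The pole of the geometric series is genuine, so regularity at v already excludes q v = 1. For
    -- v = 1/(q u) this is the point u = 1, which the explicit conditions on u do not rule out.
    divisible-value : ∀ b → (∀ n → (b ⋆ B′) n ≡ 0F) → ∀ D → D Continues 𝒟₁ b g → ∀ v → D RegularAt v →
                      (1# - q * v) ≉ 0# × D ⟨ v ⟩ ≈ (1# - q * v) ⁻¹
    divisible-value b b⋆B≡0 D continues v regular = X≉0 , ℂ.trans
      (continuation-value D continues v regular X≉0)
      (ℂ.solve 1 (λ i → con (+ 0) :+ :1 :* :1 :* i := i) ℂ.refl ((1# - q * v) ⁻¹))
      where
      open Divisible b b⋆B≡0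
      X≉0 : 1# - q * v ≉ 0#
      X≉0 = pole 1≉0 D continues v regular

    nondivisible-value : ∀ b k → (∀ n → n ℕ.< k → (b ⋆ B′) n ≡ 0F) → (b ⋆ B′) k ≢ 0F →
      ∀ D → D Continues 𝒟₁ b g → ∀ v → D RegularAt v →
      D ⟨ v ⟩ ≈ ℂ.Σ< ((q * v) ^_) k + ψ ((b ⋆ B′) k) * (q * v) ^ k
    nondivisible-value b k below at D continues v regular = begin
      D ⟨ v ⟩  ≈⟨ Nondivisible.continuation-value b k at D continues v regular ⟩
      partialSum (series C v) (suc k)  ≈⟨ partialSum≈Σ< (series C v) (suc k) ⟩
      ℂ.Σ< (series C v) k + series C v k  ≈⟨ ℂ.+-cong (ℂ.Σ<-cong-< k earlier) (term k below) ⟩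
      ℂ.Σ< ((q * v) ^_) k + ψ ((b ⋆ B′) k) * (q * v) ^ k  ∎
      where
      C = monicSum (b ⋆ B′)
      term : ∀ n → (∀ i → i ℕ.< n → (b ⋆ B′) i ≡ 0F) → series C v n ≈ ψ ((b ⋆ B′) n) * (q * v) ^ n
      term n zeros = begin
        C n * v ^ n  ≈⟨ ℂ.*-congʳ {v ^ n} (monicSum-trivial (b ⋆ B′) n zeros) ⟩
        Q ^ n * ψ ((b ⋆ B′) n) * v ^ n  ≈⟨ ℂ.solve 3 (λ x y z → x :* y :* z := y :* (x :* z)) ℂ.refl (Q ^ n) (ψ ((b ⋆ B′) n)) (v ^ n) ⟩
        ψ ((b ⋆ B′) n) * (Q ^ n * v ^ n)  ≈⟨ ℂ.*-congˡ {ψ ((b ⋆ B′) n)} (ℂ.*-congʳ {v ^ n} (ℂ.^-congˡ n q≈Q)) ⟨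
        ψ ((b ⋆ B′) n) * (q ^ n * v ^ n)  ≈⟨ ℂ.*-congˡ {ψ ((b ⋆ B′) n)} (ℂ.^-distrib-* q v n) ⟨
        ψ ((b ⋆ B′) n) * (q * v) ^ n  ∎
      earlier : ∀ n → n ℕ.< k → series C v n ≈ (q * v) ^ n
      earlier n n<k = begin
        series C v n  ≈⟨ term n (λ i i<n → below i (ℕ.<-trans i<n n<k)) ⟩
        ψ ((b ⋆ B′) n) * (q * v) ^ n  ≈⟨ ℂ.*-congʳ {(q * v) ^ n} (ℂ.trans (ℂ.reflexive (cong ψ (below n n<k))) ψ-0) ⟩
        1# * (q * v) ^ n  ≈⟨ ℂ.*-identityˡ ((q * v) ^ n) ⟩
        (q * v) ^ n  ∎

    𝒟₁-continuation : ∀ b → ∃[ D ] D Continues 𝒟₁ b g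
    𝒟₁-continuation b = by-class (classify g b)
      where
      by-class : Class g b → ∃[ D ] D Continues 𝒟₁ b g
      by-class (divisible _ b⋆B≡0)               = Divisible.continuation b b⋆B≡0
      by-class (nondivisible _ k _ r_d≢0 _ _ at) = Nondivisible.continuation b k (λ eq → r_d≢0 (≡.trans (≡.sym at) eq))

    ·-⋆ : ∀ l a n → ((l · a) ⋆ B′) n ≡ l *F (a ⋆ B′) n
    ·-⋆ l a n = pair-· l a (λ i → B′ (n ℕ.+ i))

  ^ᶻ-pred : ∀ u {m n} → suc n ≡ m → u ^ᶻ (+ m ℤ.- ℤ.1ℤ) ≈ u ^ n
  ^ᶻ-pred u {n = n} ≡.refl = ℂ.refl {u ^ n}

  -- Covers m = 0, where the exponent is -1. Then g = 1 and every remainder is zero, so this occurs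
  -- in the divisible case alone.
  ^ᶻ-pred-* : ∀ u → u ≉ 0# → ∀ m → u ^ᶻ (+ m ℤ.- ℤ.1ℤ) * u ≈ u ^ m
  ^ᶻ-pred-* u u≉0 zero    = begin
    u ⁻¹ * 1# * u  ≈⟨ ℂ.solve 2 (λ u i → i :* :1 :* u := u :* i) ℂ.refl u (u ⁻¹) ⟩
    u * u ⁻¹  ≈⟨ ⁻¹-inverseʳ u≉0 ⟩
    1#  ∎
  ^ᶻ-pred-* u u≉0 (suc m) = ℂ.trans (ℂ.*-congʳ {u} (^ᶻ-pred u {suc m} {m} ≡.refl)) (ℂ.*-comm (u ^ m) u)

  module Identity (g : Monic) (a : Poly) (Z : RationalFunction) (D : 𝔽 → RationalFunction)
    (Z-continues : Z Continues 𝒵 a g)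
    (D-continues : ∀ l → l ≢ 0F → D l Continues 𝒟₁ (l · a) g)
    (u : ℂ) (u≉0 : u ≉ 0#) (X≉0 : 1# - q * u ≉ 0#)
    (Z-regular : Z RegularAt u) (D-regular : ∀ l → l ≢ 0F → D l RegularAt ((q * u) ⁻¹)) where

    private
      m = deg g
      B′ = B g
      r = Remainder.remainder (remainder g a)
      v = (q * u) ⁻¹
      w = q * v
      U = u ^ᶻ (+ m ℤ.- ℤ.1ℤ)
      Q′ = q ⁻¹
      X′ = (1# - q * u) ⁻¹

      kernel : 𝔽 → ℂ
      kernel l = e_q (-F l) * q ⁻¹ - (q * (1# - q * u)) ⁻¹

      qQ′≈1 : q * Q′ ≈ 1#
      qQ′≈1 = ⁻¹-inverseʳ q≉0

      XX′≈1 : (1# - q * u) * X′ ≈ 1#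
      XX′≈1 = ⁻¹-inverseʳ X≉0

      uw≈1 : u * w ≈ 1#
      uw≈1 = ℂ.trans (ℂ.solve 3 (λ u q v → u :* (q :* v) := q :* u :* v) ℂ.refl u q v)
        (⁻¹-inverseʳ (*-≉0 {q} {u} q≉0 u≉0))

      kernel≈ : ∀ l → kernel l ≈ ψ (-F l) * Q′ - Q′ * X′
      kernel≈ l = ℂ.+-cong (ℂ.*-congʳ {Q′} (e_q≈ψ (-F l))) (ℂ.-‿cong (ℂ.sym (⁻¹-unique {q * (1# - q * u)} {Q′ * X′} (begin
        q * (1# - q * u) * (Q′ * X′)  ≈⟨ ℂ.solve 4 (λ q X i j → q :* X :* (i :* j) := q :* i :* (X :* j)) ℂ.refl q (1# - q * u) Q′ X′ ⟩
        q * Q′ * ((1# - q * u) * X′)  ≈⟨ ℂ.*-cong qQ′≈1 XX′≈1 ⟩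
        1# * 1#  ≈⟨ ℂ.*-identityˡ 1# ⟩
        1#  ∎))))

      ∑-1 : ∑ units (λ _ → 1#) ≈ q - 1#
      ∑-1 = ℂ.trans ∑-units-1 (ℂ.+-congʳ { - 1#} (ℂ.sym q≈Q))

      S : ℂ
      S = ℂ.Σ< (series (count g a) u) m

      Z-value : Z ⟨ u ⟩ ≈ S + u ^ m * X′
      Z-value = ℂ.trans (ZetaSeries.continuation-value g a Z Z-continues u Z-regular X≉0)
        (ℂ.+-cong (partialSum≈Σ< (series (count g a) u) m) (ℂ.*-congʳ {X′} (ℂ.*-identityˡ (u ^ m))))

    divisible-case : (∀ n → coeff r n ≡ 0F) → (∀ n → (a ⋆ B′) n ≡ 0F) →
                     Z ⟨ u ⟩ ≈ U * ∑ units (λ l → kernel l * D l ⟨ v ⟩)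
    divisible-case r≈0 a⋆B≡0 = divisible-identity {q} {Q′} {u} {w} {X′} qQ′≈1 XX′≈1 uw≈1
      {λ l → ψ (-F l)} {kernel} {λ l → D l ⟨ v ⟩} kernel≈ ∑-units-ψ-neg ∑-1
      {Z ⟨ u ⟩} {S} {u ^ m} {U} {(1# - w) ⁻¹}
      (λ l l≢0 → proj₂ (values l l≢0)) YE≈1 Z-value no-small (ℂ.sym (^ᶻ-pred-* u u≉0 m))
      where
      values : ∀ l → l ≢ 0F → (1# - w) ≉ 0# × D l ⟨ v ⟩ ≈ (1# - w) ⁻¹
      values l l≢0 = divisible-value g (l · a)
        (λ n → ≡.trans (·-⋆ g l a n) (≡.trans (cong (l *F_) (a⋆B≡0 n)) (𝔽.zeroʳ l)))
        (D l) (D-continues l l≢0) v (D-regular l l≢0)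
      YE≈1 : (1# - w) * (1# - w) ⁻¹ ≈ 1#
      -- `w` does not involve l, so the regularity of a single member of the family suffices; the
      -- unit 1 is at hand.
      YE≈1 = ⁻¹-inverseʳ (proj₁ (values 1F (FiniteField.0≢1 F ∘ ≡.sym)))
      no-small : S ≈ 0#
      no-small = ℂ.Σ<-zero m (λ n n<m → ℂ.trans
        (ℂ.*-congʳ {u ^ n} (count-small-≢ g a n n<m (λ r_n≡1 → FiniteField.0≢1 F (≡.trans (≡.sym (r≈0 n)) r_n≡1))))
        (ℂ.zeroˡ (u ^ n)))

    nondivisible-case : ∀ d k → suc (k ℕ.+ d) ≡ m → coeff r d ≢ 0F → (∀ n → d ℕ.< n → coeff r n ≡ 0F) →
      (∀ n → n ℕ.< k → (a ⋆ B′) n ≡ 0F) → (a ⋆ B′) k ≡ coeff r d →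
      Z ⟨ u ⟩ ≈ U * ∑ units (λ l → kernel l * D l ⟨ v ⟩)
    nondivisible-case d k k+d r_d≢0 higher below at = nondivisible-identity {q} {Q′} {u} {w} {X′} qQ′≈1 XX′≈1 uw≈1
      {λ l → ψ (-F l)} {kernel} {λ l → D l ⟨ v ⟩} kernel≈ ∑-units-ψ-neg ∑-1
      {Z ⟨ u ⟩} {S} {u ^ m} {U} {u ^ k} {u ^ d} {w ^ k} {H} {ε} {λ l → ψ (l *F ρ)}
      D-value ∑-shifted (∑-units-ψ-nonzero ρ r_d≢0) AW≈1 (geometric w k) Z-value small u^m U≈
      where
      ρ = coeff r d
      ε : ℂ
      ε = [ ρ ≟F 1F ]
      H : ℂ
      H = ℂ.Σ< (w ^_) k
      ∑-shifted : ∑ units (λ l → ψ (-F l) * ψ (l *F ρ)) ≈ q * ε - 1#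
      ∑-shifted = ℂ.trans (∑-units-ψ-shifted ρ) (ℂ.+-congʳ { - 1#} (ℂ.*-congʳ {ε} (ℂ.sym q≈Q)))
      d<m : d ℕ.< m
      d<m = ≡.subst (d ℕ.<_) k+d (ℕ.s≤s (ℕ.m≤n+m d k))
      U≈ : U ≈ u ^ k * u ^ d
      U≈ = ℂ.trans (^ᶻ-pred u k+d) (ℂ.^-homo-* u k d)
      u^m : u ^ m ≈ u ^ k * u ^ d * u
      u^m = ℂ.trans (ℂ.^-congʳ u (≡.sym k+d)) (ℂ.trans (ℂ.*-congˡ {u} (ℂ.^-homo-* u k d)) (ℂ.*-comm u (u ^ k * u ^ d)))
      1^n≈1 : ∀ n → 1# ^ n ≈ 1#
      1^n≈1 zero    = ℂ.refl {1#}
      1^n≈1 (suc n) = ℂ.trans (ℂ.*-identityˡ (1# ^ n)) (1^n≈1 n)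
      AW≈1 : u ^ k * w ^ k ≈ 1#
      AW≈1 = ℂ.trans (ℂ.sym (ℂ.^-distrib-* u w k)) (ℂ.trans (ℂ.^-congˡ k uw≈1) (1^n≈1 k))
      D-value : ∀ l → l ≢ 0F → D l ⟨ v ⟩ ≈ H + ψ (l *F ρ) * w ^ k
      D-value l l≢0 = ℂ.trans
        (nondivisible-value g (l · a) k
          (λ n n<k → ≡.trans (·-⋆ g l a n) (≡.trans (cong (l *F_) (below n n<k)) (𝔽.zeroʳ l)))
          (λ eq → l*ρ≢0 (≡.trans (≡.sym at-l) eq))
          (D l) (D-continues l l≢0) v (D-regular l l≢0))
        (ℂ.+-congˡ {H} (ℂ.*-congʳ {w ^ k} (ℂ.reflexive (cong ψ at-l))))
        where
        at-l : ((l · a) ⋆ B′) k ≡ l *F ρ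
        at-l = ≡.trans (·-⋆ g l a k) (cong (l *F_) at)
        l*ρ≢0 : l *F ρ ≢ 0F
        l*ρ≢0 eq with domain l ρ eq
        ... | inj₁ l≡0 = l≢0 l≡0
        ... | inj₂ ρ≡0 = r_d≢0 ρ≡0
      small : S ≈ ε * u ^ d
      small = ℂ.trans (ℂ.Σ<-single m d d<m vanishing) (ℂ.*-congʳ {u ^ d} (count-degree g a d d<m higher))
        where
        count≈0 : ∀ n → n ℕ.< m → n ℕ.< d ⊎ d ℕ.< n → count g a n ≈ 0#
        count≈0 n n<m (inj₁ n<d) = count-small-higher g a n d n<d d<m r_d≢0
        count≈0 n n<m (inj₂ d<n) = count-small-≢ g a n n<m (λ r_n≡1 → FiniteField.0≢1 F (≡.trans (≡.sym (higher n d<n)) r_n≡1))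
        vanishing : ∀ n → n ℕ.< m → n ≢ d → series (count g a) u n ≈ 0#
        vanishing n n<m n≢d = ℂ.trans (ℂ.*-congʳ {u ^ n} (count≈0 n n<m
          (Sum.map (λ n≤d → ℕ.≤∧≢⇒< n≤d n≢d) (λ d≤n → ℕ.≤∧≢⇒< d≤n (n≢d ∘ ≡.sym)) (ℕ.≤-total n d)))) (ℂ.zeroˡ (u ^ n))

    identity : Z ⟨ u ⟩ ≈ U * ∑ units (λ l → kernel l * D l ⟨ v ⟩)
    identity = by-class (classify g a)
      where
      by-class : Class g a → Z ⟨ u ⟩ ≈ U * ∑ units (λ l → kernel l * D l ⟨ v ⟩)
      by-class (divisible r≈0 a⋆B≡0)                        = divisible-case r≈0 a⋆B≡0
      by-class (nondivisible d k k+d r_d≢0 higher below at) = nondivisible-case d k k+d r_d≢0 higher below at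

-- An identity of meromorphic functions is rendered pointwise, for arbitrary continuations at their
-- common regular points; the existence of continuations is part of the conclusion, so the pointwise
-- claim is not vacuous. At u = 0 and at q u = 1 the total inverse would give dummy values to the
-- right-hand side.
proposition3p2 : ∀ {c ℓ₁ ℓ₂ f} {p η : ℕ}
    (R : CompleteOrderedField c ℓ₁ ℓ₂) (π : CompleteOrderedField.Carrier R) → Complex.IsPi R π →
    ∀ (F : FiniteField f p η) →
    let open GeneratingSeries R π F in
    ∀ (g : Monic) (a : Poly) →
    (∃[ Z ] Z Continues 𝒵 a g) ×
    (∀ (b : Poly) → ∃[ D ] D Continues 𝒟₁ b g) ×
    (∀ (Z : RationalFunction) (D : 𝔽 → RationalFunction) →
    Z Continues 𝒵 a g →
    (∀ l → l ≢ 0F → D l Continues 𝒟₁ (l · a) g) →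
    ∀ (u : ℂ) → u ≉ 0# → 1# - q * u ≉ 0# →
    Z RegularAt u →
    (∀ l → l ≢ 0F → D l RegularAt ((q * u) ⁻¹)) →
    Z ⟨ u ⟩ ≈
    u ^ᶻ (+ deg g ℤ.- ℤ.1ℤ) *
    (∑[ l ∈ units ] (e_q (-F l) * q ⁻¹ - (q * (1# - q * u)) ⁻¹) * D l ⟨ (q * u) ⁻¹ ⟩))
proposition3p2 R π isPi F g a =
  ZetaSeries.continuation g a , 𝒟₁-continuation g ,
  λ Z D Z-continues D-continues u u≉0 X≉0 Z-regular D-regular →
    Identity.identity g a Z D Z-continues D-continues u u≉0 X≉0 Z-regular D-regular
  where open FunctionalEquation R π isPi F
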